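{- The operator $\Xi$ preserves the space of symmetric polynomials and maps $J_\lambda^{(\alpha)}$ to $J_\lambda^{r\delta}$ for every partition $\lambda$. Moreover, if $f$ is homogeneous symmetric of degree $d$, then $g=\Xi(f)$ is the unique polynomial such that (1) $g$ is symmetric, (2) $g-f$ has degree $<d$, and (3) $g(-\mu-r\delta)=0$ for all partitions $\mu$ with $|\mu|<d$.
   Context: Fix $n\ge1$; $r$ is an indeterminate, $\alpha=1/r$, $\mathbb{F}=\mathbb{Q}(r)$, polynomials in $\mathbb{F}[x_1,\dots,x_n]$. Compositions are $\eta\in\mathbb{N}^n$, $|\eta|=\sum\eta_i$; partitions are weakly decreasing compositions; $\delta=(n-1,\dots,0)$; permutations act on vectors by $(wv)_{w(i)}=v_i$; $w_\gamma$ is the minimal-length permutation with $w_\gamma^{ -1}(\gamma)$ a partition, $\overline\gamma=\gamma+w_\gamma(r\delta)$. $E_\eta^{r\delta}$ is the unique polynomial of degree $|\eta|$ vanishing at all $\overline\gamma$ with $\gamma\ne\eta$, $|\gamma|\le|\eta|$, with coefficient $1$ on $x^\eta$; $E_\eta^{(\alpha)}$ its top homogeneous component. With $a_\eta(i,j)=\eta_i-j$, $l_\eta(i,j)=\#\{k>i:j\le\eta_k\le\eta_i\}+\#\{k<i:j\le\eta_k+1\le\eta_i\}$, $d_\eta(\alpha)=\prod_{1\le j\le\eta_i}(\alpha(a_\eta(i,j)+1)+l_\eta(i,j)+1)$, set $F_\eta^{(\alpha)}=d_\eta E_\eta^{(\alpha)}$, $F_\eta^{r\delta}(x)=(-1)^{|\eta|}d_\eta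 E_\eta^{r\delta}(-x)$; $\Xi$ is the unique $\mathbb{F}$-linear operator with $\Xi(F_\eta^{(\alpha)})=F_\eta^{r\delta}$ for all $\eta$. $P_\lambda^{r\delta}$ is the unique symmetric polynomial of degree $|\lambda|$ with $P_\lambda^{r\delta}(\mu+r\delta)=0$ for partitions $\mu\ne\lambda$, $|\mu|\le|\lambda|$, and coefficient $1$ on $m_\lambda$; $P_\lambda^{(\alpha)}$ is the Jack polynomial, equal to the top homogeneous component of $P_\lambda^{r\delta}$. For a partition $\lambda$ and box $(i,j)$ ($1\le j\le\lambda_i$) let $a_\lambda(i,j)=\lambda_i-j$, $l_\lambda(i,j)=\#\{k>i:\lambda_k\ge j\}$, $c_\lambda(\alpha)=\prod_s(\alpha a_\lambda(s)+l_\lambda(s)+1)$; $J_\lambda^{(\alpha)}=c_\lambda(\alpha)P_\lambda^{(\alpha)}$ and $J_\lambda^{r\delta}(x)=(-1)^{|\lambda|}c_\lambda(\alpha)P_\lambda^{r\delta}(-x)$. -}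

module Defs where

open import Data.Nat as ℕ using (ℕ; zero; suc; _∸_; _≤_; _<_)
import Data.Nat.Properties as ℕP
open import Data.Fin as Fin using (Fin; toℕ)
import Data.Fin.Properties as FinP
open import Data.Fin.Permutation using (Permutation′; _⟨$⟩ʳ_; _⟨$⟩ˡ_)
open import Data.Rational as Q using (ℚ; 0ℚ; 1ℚ)
open import Data.Integer using (+_)
open import Data.List as L using (List; []; _∷_; length; filter; allFin; concatMap)
open import Data.Vec as V using (Vec; lookup; tabulate)
import Data.Vec.Properties as VP
open import Data.Product using (_×_; _,_; proj₁; proj₂)
open import Relation.Nullary using (¬_; yes; no)
open import Relation.Binary.PropositionalEquality using (_≡_)

-- ℚ[r] : univariate polynomials over ℚ as coefficient lists (low → high)

Poly1 : Set
Poly1 = List ℚ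

coeffAt : Poly1 → ℕ → ℚ
coeffAt []       _       = 0ℚ
coeffAt (a ∷ p)  zero    = a
coeffAt (a ∷ p)  (suc k) = coeffAt p k

_≈₁_ : Poly1 → Poly1 → Set
p ≈₁ q = ∀ k → coeffAt p k ≡ coeffAt q k

add₁ : Poly1 → Poly1 → Poly1
add₁ []       q        = q
add₁ p        []       = p
add₁ (a ∷ p)  (b ∷ q)  = (a Q.+ b) ∷ add₁ p q

neg₁ : Poly1 → Poly1
neg₁ = L.map (λ a → Q.- a)

mul₁ : Poly1 → Poly1 → Poly1
mul₁ []      q = []
mul₁ (a ∷ p) q = add₁ (L.map (a Q.*_) q) (0ℚ ∷ mul₁ p q)

-- 𝔽 = ℚ(r).  An element is num / den where den is a MONIC polynomial,
-- represented by its list cs of non-leading coefficients: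
-- den = cs + r^(length cs).  Every element of ℚ(r) has such a form,
-- and monic denominators are automatically nonzero.

monic : List ℚ → Poly1
monic cs = cs L.++ (1ℚ ∷ [])

monicMul : List ℚ → List ℚ → List ℚ
monicMul c d =
  V.toList (tabulate {n = length c ℕ.+ length d}
             (λ i → coeffAt (mul₁ (monic c) (monic d)) (toℕ i)))

record 𝔽 : Set where
  constructor _//_
  field
    num : Poly1
    den : List ℚ
open 𝔽 public

infix 4 _≈_
_≈_ : 𝔽 → 𝔽 → Set
x ≈ y = mul₁ (num x) (monic (den y)) ≈₁ mul₁ (num y) (monic (den x))

infixl 6 _+F_
infixl 7 _*F_
_+F_ : 𝔽 → 𝔽 → 𝔽
x +F y = add₁ (mul₁ (num x) (monic (den y))) (mul₁ (num y) (monic (den x)))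
         // monicMul (den x) (den y)

_*F_ : 𝔽 → 𝔽 → 𝔽
x *F y = mul₁ (num x) (num y) // monicMul (den x) (den y)

-F_ : 𝔽 → 𝔽
-F x = neg₁ (num x) // den x

0F 1F : 𝔽
0F = [] // []
1F = (1ℚ ∷ []) // []

ℕ→F : ℕ → 𝔽
ℕ→F k = ((+ k) Q./ 1 ∷ []) // []

rF : 𝔽
rF = (0ℚ ∷ 1ℚ ∷ []) // []

αF : 𝔽
αF = (1ℚ ∷ []) // (0ℚ ∷ [])      -- 1 / (0 + r)

prodF : List 𝔽 → 𝔽
prodF = L.foldr _*F_ 1F

sumF : List 𝔽 → 𝔽
sumF = L.foldr _+F_ 0F

_^F_ : 𝔽 → ℕ → 𝔽
x ^F zero  = 1F
x ^F suc k = x *F (x ^F k)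

sign : ℕ → 𝔽
sign k = (-F 1F) ^F k

Comp : ℕ → Set
Comp n = Vec ℕ n

∣_∣ : ∀ {n} → Comp n → ℕ
∣ η ∣ = V.sum η

IsPartition : ∀ {n} → Comp n → Set
IsPartition {n} μ = ∀ (i j : Fin n) → toℕ i ≤ toℕ j → lookup μ j ≤ lookup μ i

count : ∀ {n} (P : Fin n → Set) → (∀ k → Relation.Nullary.Dec (P k)) → ℕ
count {n} P P? = length (filter P? (allFin n))
  where import Relation.Nullary

Poly : ℕ → Set
Poly n = List (Comp n × 𝔽)

coeff : ∀ {n} → Poly n → Comp n → 𝔽
coeff []              η = 0F
coeff ((γ , c) ∷ p)   η with VP.≡-dec ℕP._≟_ γ η
... | yes _ = c +F coeff p η
... | no  _ = coeff p η

infix 4 _≈P_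
_≈P_ : ∀ {n} → Poly n → Poly n → Set
p ≈P q = ∀ η → coeff p η ≈ coeff q η

_+P_ : ∀ {n} → Poly n → Poly n → Poly n
p +P q = p L.++ q

_·P_ : ∀ {n} → 𝔽 → Poly n → Poly n
c ·P p = L.map (λ t → proj₁ t , c *F proj₂ t) p

-P_ : ∀ {n} → Poly n → Poly n
-P p = (-F 1F) ·P p

_-P_ : ∀ {n} → Poly n → Poly n → Poly n
p -P q = p +P (-P q)

monoEval : ∀ {n} → Comp n → Vec 𝔽 n → 𝔽
monoEval γ x = prodF (V.toList (V.zipWith _^F_ x γ))

eval : ∀ {n} → Poly n → Vec 𝔽 n → 𝔽
eval p x = sumF (L.map (λ t → proj₂ t *F monoEval (proj₁ t) x) p)

negArg : ∀ {n} → Poly n → Poly n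
negArg p = L.map (λ t → proj₁ t , sign ∣ proj₁ t ∣ *F proj₂ t) p

top : ∀ {n} → ℕ → Poly n → Poly n
top d p = filter (λ t → ∣ proj₁ t ∣ ℕ.≟ d) p

-- degree ≤ d  /  degree < d  (the zero polynomial has every such degree)
DegLe : ∀ {n} → ℕ → Poly n → Set
DegLe d p = ∀ η → d < ∣ η ∣ → coeff p η ≈ 0F

DegLt : ∀ {n} → ℕ → Poly n → Set
DegLt d p = ∀ η → d ≤ ∣ η ∣ → coeff p η ≈ 0F

Homogeneous : ∀ {n} → ℕ → Poly n → Set
Homogeneous d p = ∀ η → ¬ (∣ η ∣ ≡ d) → coeff p η ≈ 0F

act : ∀ {n} {A : Set} → Permutation′ n → Vec A n → Vec A n
act w v = tabulate (λ j → lookup v (w ⟨$⟩ˡ j))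

actInv : ∀ {n} {A : Set} → Permutation′ n → Vec A n → Vec A n
actInv w v = tabulate (λ j → lookup v (w ⟨$⟩ʳ j))

Symmetric : ∀ {n} → Poly n → Set
Symmetric {n} p = ∀ (w : Permutation′ n) η → coeff p (act w η) ≈ coeff p η

invLength : ∀ {n} → Permutation′ n → ℕ
invLength {n} w =
  length (filter (λ ij → Data.Product.uncurry (λ i j → FinP._<?_ i j) ij
                          Relation.Nullary.×-dec
                          FinP._<?_ (w ⟨$⟩ʳ proj₂ ij) (w ⟨$⟩ʳ proj₁ ij))
           (concatMap (λ i → L.map (λ j → (i , j)) (allFin n)) (allFin n)))
  where import Data.Product
        import Relation.Nullary

IsMinSort : ∀ {n} → Permutation′ n → Comp n → Set
IsMinSort {n} w γ =
  IsPartition (actInv w γ) ×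
  (∀ (w' : Permutation′ n) → IsPartition (actInv w' γ) → invLength w ℕ.≤ invLength w')

toF : ∀ {n} → Comp n → Vec 𝔽 n
toF = V.map ℕ→F

rδ : ∀ n → Vec 𝔽 n
rδ n = tabulate (λ i → rF *F ℕ→F (n ∸ suc (toℕ i)))

_+V_ : ∀ {n} → Vec 𝔽 n → Vec 𝔽 n → Vec 𝔽 n
_+V_ = V.zipWith _+F_

-V_ : ∀ {n} → Vec 𝔽 n → Vec 𝔽 n
-V_ = V.map -F_

-- γ̄ = γ + w(rδ), for the given minimal sorting permutation w = w_γ
bar : ∀ {n} → Permutation′ n → Comp n → Vec 𝔽 n
bar {n} w γ = toF γ +V act w (rδ n)

IsE : ∀ {n} → Comp n → Poly n → Set
IsE {n} η E =
  DegLe ∣ η ∣ E ×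
  (∀ (γ : Comp n) → ∣ γ ∣ ≤ ∣ η ∣ → ¬ (γ ≡ η) →
     ∀ (w : Permutation′ n) → IsMinSort w γ → eval E (bar w γ) ≈ 0F) ×
  coeff E η ≈ 1F

-- arm / leg for compositions (1-based j)
legE : ∀ {n} → Comp n → Fin n → ℕ → ℕ
legE η i j =
  count (λ k → (toℕ i < toℕ k) × (j ≤ lookup η k) × (lookup η k ≤ lookup η i))
        (λ k → (toℕ i ℕP.<? toℕ k) ×-dec ((j ℕP.≤? lookup η k) ×-dec (lookup η k ℕP.≤? lookup η i)))
  ℕ.+
  count (λ k → (toℕ k < toℕ i) × (j ≤ suc (lookup η k)) × (suc (lookup η k) ≤ lookup η i))
        (λ k → (toℕ k ℕP.<? toℕ i) ×-dec ((j ℕP.≤? suc (lookup η k)) ×-dec (suc (lookup η k) ℕP.≤? lookup η i)))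
  where open import Relation.Nullary using (_×-dec_)

boxes : ∀ {n} → Comp n → List (Fin n × ℕ)
boxes {n} η = concatMap (λ i → L.map (λ j → (i , suc j)) (L.upTo (lookup η i))) (allFin n)

dη : ∀ {n} → Comp n → 𝔽
dη η = prodF (L.map (λ s → αF *F ℕ→F (suc (lookup η (proj₁ s) ∸ proj₂ s))
                              +F ℕ→F (suc (legE η (proj₁ s) (proj₂ s))))
                    (boxes η))

-- F_η^{(α)} and F_η^{rδ}, computed from E = E_η^{rδ}
Fα : ∀ {n} → Comp n → Poly n → Poly n
Fα η E = dη η ·P top ∣ η ∣ E

Frδ : ∀ {n} → Comp n → Poly n → Poly n
Frδ η E = (sign ∣ η ∣ *F dη η) ·P negArg E

Linear : ∀ {n} → (Poly n → Poly n) → Set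
Linear Ξ = (∀ p q → p ≈P q → Ξ p ≈P Ξ q) ×
           (∀ p q → Ξ (p +P q) ≈P (Ξ p +P Ξ q)) ×
           (∀ c p → Ξ (c ·P p) ≈P (c ·P Ξ p))

IsΞ : ∀ {n} → (Poly n → Poly n) → Set
IsΞ {n} Ξ = Linear Ξ × (∀ (η : Comp n) E → IsE η E → Ξ (Fα η E) ≈P Frδ η E)

-- P is (the) P_λ^{rδ}  (coefficient of m_λ = coefficient of x^λ)
IsP : ∀ {n} → Comp n → Poly n → Set
IsP {n} λ' P =
  Symmetric P × DegLe ∣ λ' ∣ P ×
  (∀ (μ : Comp n) → IsPartition μ → ∣ μ ∣ ≤ ∣ λ' ∣ → ¬ (μ ≡ λ') →
     eval P (toF μ +V rδ n) ≈ 0F) ×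
  coeff P λ' ≈ 1F

legP : ∀ {n} → Comp n → Fin n → ℕ → ℕ
legP λ' i j = count (λ k → (toℕ i < toℕ k) × (j ≤ lookup λ' k))
                    (λ k → (toℕ i ℕP.<? toℕ k) ×-dec (j ℕP.≤? lookup λ' k))
  where open import Relation.Nullary using (_×-dec_)

cλ : ∀ {n} → Comp n → 𝔽
cλ λ' = prodF (L.map (λ s → αF *F ℕ→F (lookup λ' (proj₁ s) ∸ proj₂ s)
                             +F ℕ→F (suc (legP λ' (proj₁ s) (proj₂ s))))
                     (boxes λ'))

-- J_λ^{(α)} = c_λ P_λ^{(α)}, with P_λ^{(α)} the top component of P_λ^{rδ}
Jα : ∀ {n} → Comp n → Poly n → Poly n
Jα λ' P = cλ λ' ·P top ∣ λ' ∣ P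

Jrδ : ∀ {n} → Comp n → Poly n → Poly n
Jrδ λ' P = (sign ∣ λ' ∣ *F cλ λ') ·P negArg P

Char : ∀ {n} → ℕ → Poly n → Poly n → Set
Char {n} d f g =
  Symmetric g × DegLt d (g -P f) ×
  (∀ (μ : Comp n) → IsPartition μ → ∣ μ ∣ < d →
     eval g (-V (toF μ +V rδ n)) ≈ 0F)

{-# OPTIONS --safe #-}

{-
For f homogeneous of degree d, Ξ(f) is the unique g such that g − f has degree < d and g vanishes
at −γ̄ for all compositions γ with |γ| < d: this holds for f = F_η, and the top components of the
E_η with |η| = d span the homogeneous polynomials of degree d.  If f is symmetric, interpolation by
symmetric polynomials at the points μ + rδ yields a symmetric g with the weaker vanishing property (3).
Since γ̄ is a permutation of μ + rδ for the partition μ of γ, this g vanishes at all −γ̄ as well,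
so g = Ξ(f).

Interpolation at the nodes γ̄, |γ| ≤ d, goes by writing a polynomial as g(x₁,…,x_{n−1}) + x_n h(x).
The nodes with γ_n = 0 are those in n − 1 variables, translated by r, followed by 0; those with
γ_n = k + 1 arise from the nodes of (k, γ₁,…,γ_{n−1}) by (y₁,…,y_n) ↦ (y₂,…,y_n, y₁ + 1).
Only the elements m + 1 + k r have to be inverted, so this works over the local ring of functions
regular at r = 0.  Modulo r the nodes are γ̄ = γ, where the falling factorials ∏ x_i(x_i−1)⋯(x_i−η_i+1)
interpolate; hence the coefficient of x^η in E_η can be normalised to 1.
-}

module Submission where

open import Defs using (act; actInv; IsPartition; invLength; IsMinSort)
open import Algebra.Bundles using (CommutativeRing)
open import Algebra.Morphism.Structures using (IsRingHomomorphism)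
import Algebra.Properties.CommutativeMonoid.Sum
import Algebra.Properties.Semiring.Exp
import Algebra.Solver.Ring.NaturalCoefficients.Default as NatSolver
open import Data.Bool using (true; false; if_then_else_)
open import Data.Fin as Fin using (Fin; zero; suc; toℕ)
open import Data.Fin.Permutation as Perm using (Permutation′; _⟨$⟩ʳ_; _⟨$⟩ˡ_; permutation; flip; inverseˡ; inverseʳ)
import Data.Fin.Properties as FinP
open import Data.List as L using (List; []; _∷_; _++_; length)
import Data.List.Properties as LP
open import Data.List.Relation.Unary.All as All using (All; []; _∷_)
import Data.List.Relation.Unary.All.Properties as AllP
open import Data.Nat as ℕ using (ℕ; zero; suc; s≤s; z≤n; _∸_; _≤_)
import Data.Nat.Properties as ℕP
open import Data.Product using (_×_; _,_; proj₁; proj₂; Σ; ∃)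
open import Data.Rational as Q using (ℚ; 0ℚ; 1ℚ)
import Data.Rational.Properties as QP
import Data.Rational.Solver as QS
import Data.Rational.Unnormalised as QU
import Data.Rational.Unnormalised.Properties as QUP
open import Data.Sum using (_⊎_; inj₁; inj₂)
open import Data.Vec as V using (Vec; []; _∷_; lookup; tabulate; replicate; zipWith; _∷ʳ_; sum)
import Data.Vec.Properties as VP
open import Data.Vec.Relation.Binary.Pointwise.Inductive as PW using (Pointwise; []; _∷_)
open import Function using (_∘_; const; id)
open import Level using (0ℓ; _⊔_)
open import Relation.Nullary using (¬_; Dec; yes; no; contradiction; does; ¬?; _×-dec_; _⊎-dec_)
open import Relation.Nullary.Decidable using (dec-true; dec-false)
open import Relation.Binary.Definitions using (Tri; tri<; tri≈; tri>)
open import Relation.Binary.PropositionalEquality as ≡ using (_≡_; _≢_; cong; cong₂)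

-- Polynomials over a commutative ring

-- `IsΞ` constrains Ξ only through polynomials satisfying `IsE`, so nothing follows from it until
-- every E_η has been constructed. The obstacle is the coefficient of x^η: interpolation prescribes
-- values, and values alone do not show that one particular coefficient is nonzero. Reduction modulo
-- r shows it, but that requires interpolating over a ring in which r is not a unit. The
-- interpolation theory is therefore written over an arbitrary commutative ring with a parameter
-- `ρ`, taking the inverses of the node coordinates as a hypothesis. It is used over the regular
-- functions to build the E_η, and again over ℚ(r) to study Ξ; a ring homomorphism carries the E_η
-- across. Polynomials are unnormalised term lists and equality in the ring is not assumed
-- decidable. Uniqueness is accordingly proved by the same recursion on variables and degree as
-- existence, not by counting dimensions. It also shows that a polynomial is determined by its
-- values, so symmetry and changes of variables can be treated on values.

module Polynomials {c ℓ} (K : CommutativeRing c ℓ) where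
  open CommutativeRing K hiding (zero)
  open import Algebra.Properties.Semiring.Exp semiring using (_^_; ^-congˡ; ^-homo-*)
  open import Algebra.Properties.Ring ring using (-1*x≈-x)
  open import Algebra.Properties.Group +-group using (x∙y⁻¹≈ε⇒x≈y)
  open import Relation.Binary.Reasoning.Setoid setoid
  open NatSolver commutativeSemiring using (solve; _:+_; _:*_; _:=_)

  Exponent : ℕ → Set
  Exponent = Vec ℕ

  Polynomial : ℕ → Set c
  Polynomial n = List (Exponent n × Carrier)

  -- Coefficients (φ = δ η) and evaluations (φ = mono x) are instances of this linear functional.
  lin : ∀ {n} → (Exponent n → Carrier) → Polynomial n → Carrier
  lin φ []            = 0#
  lin φ ((γ , a) ∷ p) = a * φ γ + lin φ p

  infixr 7 _·_
  _·_ : ∀ {n} → Carrier → Polynomial n → Polynomial n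
  a · p = L.map (λ t → proj₁ t , a * proj₂ t) p

  mapExp : ∀ {m n} → (Exponent m → Exponent n) → Polynomial m → Polynomial n
  mapExp f = L.map (λ t → f (proj₁ t) , proj₂ t)

  bind : ∀ {m n} → (Exponent m → Polynomial n) → Polynomial m → Polynomial n
  bind T []            = []
  bind T ((γ , a) ∷ p) = a · T γ ++ bind T p

  restrict : ∀ {n} {P : Exponent n → Set} → (∀ γ → Dec (P γ)) → Polynomial n → Polynomial n
  restrict P? = L.filter (P? ∘ proj₁)

  module _ {n : ℕ} (φ : Exponent n → Carrier) where

    lin-++ : ∀ p q → lin φ (p ++ q) ≈ lin φ p + lin φ q
    lin-++ []            q = sym (+-identityˡ _)
    lin-++ ((γ , a) ∷ p) q = trans (+-congˡ (lin-++ p q)) (sym (+-assoc _ _ _))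

    lin-· : ∀ a p → lin φ (a · p) ≈ a * lin φ p
    lin-· a []            = sym (zeroʳ a)
    lin-· a ((γ , b) ∷ p) = trans (+-cong (*-assoc a b (φ γ)) (lin-· a p)) (sym (distribˡ a _ _))

    lin-mapExp : ∀ {m} (f : Exponent m → Exponent n) p → lin φ (mapExp f p) ≡ lin (φ ∘ f) p
    lin-mapExp f []            = ≡.refl
    lin-mapExp f ((γ , a) ∷ p) = cong (a * φ (f γ) +_) (lin-mapExp f p)

    lin-bind : ∀ {m} (T : Exponent m → Polynomial n) p → lin φ (bind T p) ≈ lin (lin φ ∘ T) p
    lin-bind T []            = refl
    lin-bind T ((γ , a) ∷ p) = trans (lin-++ (a · T γ) (bind T p)) (+-cong (lin-· a (T γ)) (lin-bind T p))

    lin-* : ∀ a p → lin (λ γ → a * φ γ) p ≈ a * lin φ p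
    lin-* a []            = sym (zeroʳ a)
    lin-* a ((γ , b) ∷ p) = trans (+-congˡ (lin-* a p))
      (solve 4 (λ a b x y → b :* (a :* x) :+ a :* y := a :* (b :* x :+ y)) refl a b (φ γ) (lin φ p))

  lin-cong : ∀ {n} {φ ψ : Exponent n → Carrier} → (∀ γ → φ γ ≈ ψ γ) → ∀ p → lin φ p ≈ lin ψ p
  lin-cong e []            = refl
  lin-cong e ((γ , a) ∷ p) = +-cong (*-congˡ (e γ)) (lin-cong e p)

  lin-cong-All : ∀ {n} {P : Exponent n → Set} {φ ψ : Exponent n → Carrier} →
    (∀ γ → P γ → φ γ ≈ ψ γ) → ∀ {p} → All (P ∘ proj₁) p → lin φ p ≈ lin ψ p
  lin-cong-All e []                        = refl
  lin-cong-All e (_∷_ {x = (γ , a)} Pγ Pp) = +-cong (*-congˡ (e γ Pγ)) (lin-cong-All e Pp)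

  lin-zero : ∀ {n} (p : Polynomial n) → lin (λ _ → 0#) p ≈ 0#
  lin-zero []            = refl
  lin-zero ((γ , a) ∷ p) = trans (+-cong (zeroʳ a) (lin-zero p)) (+-identityˡ 0#)

  _≟ᵉ_ : ∀ {n} (γ η : Exponent n) → Dec (γ ≡ η)
  _≟ᵉ_ = VP.≡-dec ℕP._≟_

  δ : ∀ {n} → Exponent n → Exponent n → Carrier
  δ η γ = if does (γ ≟ᵉ η) then 1# else 0#

  δ-≡ : ∀ {n} {γ η : Exponent n} → γ ≡ η → δ η γ ≡ 1#
  δ-≡ {γ = γ} {η} e = cong (if_then 1# else 0#) (dec-true (γ ≟ᵉ η) e)

  δ-≢ : ∀ {n} {γ η : Exponent n} → γ ≢ η → δ η γ ≡ 0#
  δ-≢ {γ = γ} {η} e = cong (if_then 1# else 0#) (dec-false (γ ≟ᵉ η) e)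

  coeff : ∀ {n} → Polynomial n → Exponent n → Carrier
  coeff p η = lin (δ η) p

  infix 4 _≋_
  -- A record rather than a function type, so that `p` and `q` can be recovered by unification.
  record _≋_ {n} (p q : Polynomial n) : Set ℓ where
    constructor coeffwise
    field coeff≈ : ∀ η → coeff p η ≈ coeff q η
  open _≋_ public

  ≋-refl : ∀ {n} {p : Polynomial n} → p ≋ p
  ≋-refl = coeffwise λ _ → refl

  ≋-sym : ∀ {n} {p q : Polynomial n} → p ≋ q → q ≋ p
  ≋-sym e = coeffwise λ η → sym (coeff≈ e η)

  ≋-trans : ∀ {n} {p q s : Polynomial n} → p ≋ q → q ≋ s → p ≋ s
  ≋-trans e f = coeffwise λ η → trans (coeff≈ e η) (coeff≈ f η)

  lin-split : ∀ {n} {P : Exponent n → Set} (P? : ∀ γ → Dec (P γ)) φ p →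
    lin φ p ≈ lin φ (restrict P? p) + lin φ (restrict (¬? ∘ P?) p)
  lin-split P? φ [] = sym (+-identityˡ 0#)
  lin-split P? φ ((γ , a) ∷ p) with P? γ
  ... | yes _ = trans (+-congˡ (lin-split P? φ p)) (sym (+-assoc _ _ _))
  ... | no  _ = trans (+-congˡ (lin-split P? φ p))
          (solve 3 (λ x y z → x :+ (y :+ z) := y :+ (x :+ z)) refl _ _ _)

  restrict-All : ∀ {n} {P : Exponent n → Set} (P? : ∀ γ → Dec (P γ)) p → All (P ∘ proj₁) (restrict P? p)
  restrict-All P? p = AllP.all-filter (P? ∘ proj₁) p

  coeff-absent : ∀ {n} {P : Exponent n → Set} {η} → ¬ P η → ∀ {p} → All (P ∘ proj₁) p → coeff p η ≈ 0#
  coeff-absent ¬Pη {p} Pp = trans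
    (lin-cong-All (λ γ Pγ → reflexive (δ-≢ {γ = γ} λ { ≡.refl → ¬Pη Pγ })) Pp) (lin-zero p)

  module _ {n} {P : Exponent n → Set} (P? : ∀ γ → Dec (P γ)) where
    coeff-restrict-yes : ∀ {η} → P η → ∀ p → coeff (restrict P? p) η ≈ coeff p η
    coeff-restrict-yes {η} Pη p = begin
      coeff (restrict P? p) η  ≈⟨ +-identityʳ _ ⟨
      coeff (restrict P? p) η + 0#
        ≈⟨ +-congˡ (coeff-absent (λ ¬Pη → ¬Pη Pη) (restrict-All (¬? ∘ P?) p)) ⟨
      coeff (restrict P? p) η + coeff (restrict (¬? ∘ P?) p) η  ≈⟨ lin-split P? (δ η) p ⟨
      coeff p η ∎

    coeff-restrict-no : ∀ {η} → ¬ P η → ∀ p → coeff (restrict P? p) η ≈ 0#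
    coeff-restrict-no ¬Pη p = coeff-absent ¬Pη (restrict-All P? p)

  lin-constant-exponent : ∀ {n} {γ : Exponent n} φ p → All ((_≡ γ) ∘ proj₁) p → lin φ p ≈ coeff p γ * φ γ
  lin-constant-exponent φ []            []            = sym (zeroˡ _)
  lin-constant-exponent φ ((γ , a) ∷ p) (≡.refl ∷ es) = begin
    a * φ γ + lin φ p  ≈⟨ +-congˡ (lin-constant-exponent φ p es) ⟩
    a * φ γ + coeff p γ * φ γ  ≈⟨ distribʳ (φ γ) a (coeff p γ) ⟨
    (a + coeff p γ) * φ γ
      ≈⟨ *-congʳ (+-congʳ (trans (sym (*-identityʳ a)) (*-congˡ (reflexive (≡.sym (δ-≡ {γ = γ} ≡.refl)))))) ⟩
    coeff ((γ , a) ∷ p) γ * φ γ ∎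

  -- Exponents may repeat in a term list and their coefficients may cancel. The terms sharing the
  -- exponent of the head contribute `coeff p γ * φ γ`, hence zero, and the rest is a shorter null
  -- list; the induction runs on a bound `k` for the length. Only exponents are compared, never ring
  -- elements. The consequence `lin-≋` makes evaluation well defined modulo `≋`.
  lin-null : ∀ {n} φ (p : Polynomial n) → p ≋ [] → lin φ p ≈ 0#
  lin-null {n} φ p = go (length p) p ℕP.≤-refl
    where
    go : ∀ k (p : Polynomial n) → length p ℕ.≤ k → p ≋ [] → lin φ p ≈ 0#
    go k       []              _       _ = refl
    go (suc k) p@((γ , a) ∷ q) (s≤s l) e = begin
      lin φ p  ≈⟨ lin-split (_≟ᵉ γ) φ p ⟩
      lin φ at-γ + lin φ off-γ  ≈⟨ +-cong zero-at (go k off-γ shorter off-null) ⟩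
      0# + 0#  ≈⟨ +-identityˡ 0# ⟩
      0# ∎
      where
      at-γ off-γ : Polynomial n
      at-γ  = restrict (_≟ᵉ γ) p
      off-γ = restrict (¬? ∘ (_≟ᵉ γ)) p
      shorter : length off-γ ℕ.≤ k
      shorter with γ ≟ᵉ γ
      ... | yes _ = ℕP.≤-trans (LP.length-filter _ q) l
      ... | no  x = contradiction ≡.refl x
      zero-at : lin φ at-γ ≈ 0#
      zero-at = begin
        lin φ at-γ  ≈⟨ lin-constant-exponent φ at-γ (restrict-All (_≟ᵉ γ) p) ⟩
        coeff at-γ γ * φ γ  ≈⟨ *-congʳ (trans (coeff-restrict-yes (_≟ᵉ γ) ≡.refl p) (coeff≈ e γ)) ⟩
        0# * φ γ  ≈⟨ zeroˡ (φ γ) ⟩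
        0# ∎
      off-null : off-γ ≋ []
      off-null = coeffwise λ η → off-coeff η (η ≟ᵉ γ)
        where
        off-coeff : ∀ η → Dec (η ≡ γ) → coeff off-γ η ≈ 0#
        off-coeff η (yes x) = coeff-restrict-no (¬? ∘ (_≟ᵉ γ)) (λ ¬x → ¬x x) p
        off-coeff η (no ¬x) = trans (coeff-restrict-yes (¬? ∘ (_≟ᵉ γ)) ¬x p) (coeff≈ e η)

  infixl 6 _⊖_
  _⊖_ : ∀ {n} → Polynomial n → Polynomial n → Polynomial n
  p ⊖ q = p ++ (- 1#) · q

  lin-⊖ : ∀ {n} φ (p q : Polynomial n) → lin φ (p ⊖ q) ≈ lin φ p - lin φ q
  lin-⊖ φ p q = trans (lin-++ φ p _) (+-congˡ (trans (lin-· φ (- 1#) q) (-1*x≈-x _)))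

  x-x≈0 : ∀ {x y} → x ≈ y → x - y ≈ 0#
  x-x≈0 {x} {y} e = trans (+-congʳ e) (-‿inverseʳ y)

  ≋⇒⊖-null : ∀ {n} {p q : Polynomial n} → p ≋ q → p ⊖ q ≋ []
  ≋⇒⊖-null {p = p} {q} e = coeffwise λ η → trans (lin-⊖ (δ η) p q) (x-x≈0 (coeff≈ e η))

  ⊖-null⇒≋ : ∀ {n} {p q : Polynomial n} → p ⊖ q ≋ [] → p ≋ q
  ⊖-null⇒≋ {p = p} {q} e = coeffwise λ η →
    x∙y⁻¹≈ε⇒x≈y _ _ (trans (sym (lin-⊖ (δ η) p q)) (coeff≈ e η))

  lin-≋ : ∀ {n} φ {p q : Polynomial n} → p ≋ q → lin φ p ≈ lin φ q
  lin-≋ φ {p} {q} e = x∙y⁻¹≈ε⇒x≈y _ _ (trans (sym (lin-⊖ φ p q)) (lin-null φ (p ⊖ q) (≋⇒⊖-null e)))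

  mono : ∀ {n} → Vec Carrier n → Exponent n → Carrier
  mono []       []      = 1#
  mono (x ∷ xs) (k ∷ γ) = x ^ k * mono xs γ

  eval : ∀ {n} → Polynomial n → Vec Carrier n → Carrier
  eval p x = lin (mono x) p

  infix 4 _≈ᵛ_
  _≈ᵛ_ : ∀ {n} → Vec Carrier n → Vec Carrier n → Set _
  _≈ᵛ_ = Pointwise _≈_

  ≈ᵛ-refl : ∀ {n} {x : Vec Carrier n} → x ≈ᵛ x
  ≈ᵛ-refl = PW.refl refl

  ≡⇒≈ᵛ : ∀ {n} {x y : Vec Carrier n} → x ≡ y → x ≈ᵛ y
  ≡⇒≈ᵛ ≡.refl = ≈ᵛ-refl

  ≈ᵛ-trans : ∀ {n} {x y z : Vec Carrier n} → x ≈ᵛ y → y ≈ᵛ z → x ≈ᵛ z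
  ≈ᵛ-trans = PW.trans trans

  pointwise : ∀ {n} {x y : Vec Carrier n} → (∀ i → lookup x i ≈ lookup y i) → x ≈ᵛ y
  pointwise {x = []}    {[]}    e = []
  pointwise {x = x ∷ _} {y ∷ _} e = e zero ∷ pointwise (e ∘ suc)

  ∷ʳ⁺ : ∀ {n} {x y : Vec Carrier n} {a b} → x ≈ᵛ y → a ≈ b → (x ∷ʳ a) ≈ᵛ (y ∷ʳ b)
  ∷ʳ⁺ []       e = e ∷ []
  ∷ʳ⁺ (f ∷ fs) e = f ∷ ∷ʳ⁺ fs e

  mono-cong : ∀ {n} {x y : Vec Carrier n} → x ≈ᵛ y → ∀ γ → mono x γ ≈ mono y γ
  mono-cong []       []      = refl
  mono-cong (e ∷ es) (k ∷ γ) = *-cong (^-congˡ k e) (mono-cong es γ)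

  eval-cong : ∀ {n} (p : Polynomial n) {x y} → x ≈ᵛ y → eval p x ≈ eval p y
  eval-cong p e = lin-cong (mono-cong e) p

  mono-+ : ∀ {n} (x : Vec Carrier n) γ η → mono x (zipWith ℕ._+_ γ η) ≈ mono x γ * mono x η
  mono-+ []      []      []      = sym (*-identityˡ 1#)
  mono-+ (x ∷ xs) (k ∷ γ) (l ∷ η) = trans (*-cong (^-homo-* x k l) (mono-+ xs γ η))
    (solve 4 (λ a b c d → (a :* b) :* (c :* d) := (a :* c) :* (b :* d)) refl _ _ _ _)

  mono-zeros : ∀ {n} (x : Vec Carrier n) → mono x (replicate n 0) ≈ 1#
  mono-zeros []       = refl
  mono-zeros (x ∷ xs) = trans (*-identityˡ _) (mono-zeros xs)

  raiseHead : ∀ {n} → Exponent (suc n) → Exponent (suc n)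
  raiseHead (k ∷ γ) = suc k ∷ γ

  mono-∷ʳ : ∀ {n} (x : Vec Carrier n) y γ k → mono (x ∷ʳ y) (γ ∷ʳ k) ≈ mono x γ * y ^ k
  mono-∷ʳ []       y []      k = *-comm _ _
  mono-∷ʳ (x ∷ xs) y (l ∷ γ) k = trans (*-congˡ (mono-∷ʳ xs y γ k)) (sym (*-assoc _ _ _))

  monomial : ∀ {n} → Exponent n → Carrier → Polynomial n
  monomial γ a = (γ , a) ∷ []

  _⊛_ : ∀ {n} → Polynomial n → Polynomial n → Polynomial n
  p ⊛ q = bind (λ γ → mapExp (zipWith ℕ._+_ γ) q) p

  eval-⊛ : ∀ {n} (p q : Polynomial n) x → eval (p ⊛ q) x ≈ eval p x * eval q x
  eval-⊛ p q x = begin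
    eval (p ⊛ q) x
      ≈⟨ lin-bind (mono x) (λ γ → mapExp (zipWith ℕ._+_ γ) q) p ⟩
    lin (λ γ → lin (mono x) (mapExp (zipWith ℕ._+_ γ) q)) p
      ≈⟨ lin-cong (λ γ → trans (reflexive (lin-mapExp (mono x) _ q))
           (trans (lin-cong (mono-+ x γ) q) (trans (lin-* (mono x) (mono x γ) q) (*-comm _ _)))) p ⟩
    lin (λ γ → eval q x * mono x γ) p  ≈⟨ lin-* (mono x) (eval q x) p ⟩
    eval q x * eval p x  ≈⟨ *-comm _ _ ⟩
    eval p x * eval q x ∎

  one : ∀ {n} → Polynomial n
  one {n} = monomial (replicate n 0) 1#

  eval-one : ∀ {n} (x : Vec Carrier n) → eval one x ≈ 1#
  eval-one x = trans (+-identityʳ _) (trans (*-identityˡ _) (mono-zeros x))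

  power : ∀ {n} → Polynomial n → ℕ → Polynomial n
  power p zero    = one
  power p (suc k) = p ⊛ power p k

  eval-power : ∀ {n} (p : Polynomial n) k x → eval (power p k) x ≈ eval p x ^ k
  eval-power p zero    x = eval-one x
  eval-power p (suc k) x = trans (eval-⊛ p (power p k) x) (*-congˡ (eval-power p k x))

  substMono : ∀ {m n} → Vec (Polynomial m) n → Exponent n → Polynomial m
  substMono []       []      = one
  substMono (q ∷ qs) (k ∷ γ) = power q k ⊛ substMono qs γ

  eval-substMono : ∀ {m n} (qs : Vec (Polynomial m) n) γ x →
    eval (substMono qs γ) x ≈ mono (V.map (λ q → eval q x) qs) γ
  eval-substMono []       []      x = eval-one x
  eval-substMono (q ∷ qs) (k ∷ γ) x = trans (eval-⊛ (power q k) (substMono qs γ) x)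
    (*-cong (eval-power q k x) (eval-substMono qs γ x))

  substitute : ∀ {m n} → Vec (Polynomial m) n → Polynomial n → Polynomial m
  substitute qs = bind (substMono qs)

  eval-substitute : ∀ {m n} (qs : Vec (Polynomial m) n) p x →
    eval (substitute qs p) x ≈ eval p (V.map (λ q → eval q x) qs)
  eval-substitute qs p x = trans (lin-bind (mono x) (substMono qs) p)
    (lin-cong (λ γ → eval-substMono qs γ x) p)

  unit : ∀ {n} → Fin n → Exponent n
  unit {suc n} zero    = 1 ∷ replicate n 0
  unit         (suc i) = 0 ∷ unit i

  mono-unit : ∀ {n} (x : Vec Carrier n) i → mono x (unit i) ≈ lookup x i
  mono-unit (x ∷ xs) zero    = trans (*-cong (*-identityʳ x) (mono-zeros xs)) (*-identityʳ x)
  mono-unit (x ∷ xs) (suc i) = trans (*-identityˡ _) (mono-unit xs i)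

  affine : ∀ {n} → Fin n → Carrier → Polynomial n
  affine {n} i a = (unit i , 1#) ∷ (replicate n 0 , a) ∷ []

  eval-affine : ∀ {n} i a (x : Vec Carrier n) → eval (affine i a) x ≈ lookup x i + a
  eval-affine i a x = +-cong (trans (*-identityˡ _) (mono-unit x i))
    (trans (+-identityʳ _) (trans (*-congˡ (mono-zeros x)) (*-identityʳ a)))

  -- A condition on the term list, stricter than vanishing of the coefficients above `d`: a term
  -- with coefficient zero still counts. In this form it passes through all list operations by
  -- structural induction; `coeff-above` recovers the statement on coefficients.
  Degree≤ : ∀ {n} → ℕ → Polynomial n → Set c
  Degree≤ d = All (λ t → sum (proj₁ t) ℕ.≤ d)

  degree-weaken : ∀ {n d e} {p : Polynomial n} → d ℕ.≤ e → Degree≤ d p → Degree≤ e p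
  degree-weaken d≤e = All.map (λ l → ℕP.≤-trans l d≤e)

  degree-· : ∀ {n d} a {p : Polynomial n} → Degree≤ d p → Degree≤ d (a · p)
  degree-· a = AllP.map⁺

  degree-++ : ∀ {n d} {p q : Polynomial n} → Degree≤ d p → Degree≤ d q → Degree≤ d (p ++ q)
  degree-++ = AllP.++⁺

  degree-⊖ : ∀ {n d} {p q : Polynomial n} → Degree≤ d p → Degree≤ d q → Degree≤ d (p ⊖ q)
  degree-⊖ {q = q} dp dq = degree-++ dp (degree-· (- 1#) dq)

  degree-bound : ∀ {n} (p : Polynomial n) → ∃ λ d → Degree≤ d p
  degree-bound []            = 0 , []
  degree-bound ((γ , a) ∷ p) with degree-bound p
  ... | d , l = sum γ ℕ.+ d , ℕP.m≤m+n _ _ ∷ degree-weaken (ℕP.m≤n+m d (sum γ)) l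

  degree-bind : ∀ {m n e} {T : Exponent m → Polynomial n} →
    (∀ γ → Degree≤ (e ℕ.+ sum γ) (T γ)) → ∀ {d p} → Degree≤ d p → Degree≤ (e ℕ.+ d) (bind T p)
  degree-bind         dT []                     = []
  degree-bind {e = e} dT (_∷_ {x = (γ , a)} l ls) =
    degree-++ (degree-· a (degree-weaken (ℕP.+-monoʳ-≤ e l) (dT γ))) (degree-bind dT ls)

  sum-+ : ∀ {n} (γ η : Exponent n) → sum (zipWith ℕ._+_ γ η) ≡ sum γ ℕ.+ sum η
  sum-+ []      []      = ≡.refl
  sum-+ (k ∷ γ) (l ∷ η) = ≡.trans (cong (k ℕ.+ l ℕ.+_) (sum-+ γ η)) (ℕSolve k l (sum γ) (sum η))
    where
    open import Data.Nat.Solver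
    ℕSolve : ∀ a b c d → a ℕ.+ b ℕ.+ (c ℕ.+ d) ≡ a ℕ.+ c ℕ.+ (b ℕ.+ d)
    ℕSolve = S.solve 4 (λ a b c d → a S.:+ b S.:+ (c S.:+ d) S.:= a S.:+ c S.:+ (b S.:+ d)) ≡.refl
      where module S = +-*-Solver

  sum-∷ʳ : ∀ {n} (γ : Exponent n) k → sum (γ ∷ʳ k) ≡ k ℕ.+ sum γ
  sum-∷ʳ []      k = ≡.refl
  sum-∷ʳ (l ∷ γ) k = ≡.trans (cong (l ℕ.+_) (sum-∷ʳ γ k))
    (≡.trans (≡.sym (ℕP.+-assoc l k (sum γ))) (≡.trans (cong (ℕ._+ sum γ) (ℕP.+-comm l k)) (ℕP.+-assoc k l (sum γ))))

  sum-zeros : ∀ n → sum (replicate n 0) ≡ 0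
  sum-zeros zero    = ≡.refl
  sum-zeros (suc n) = sum-zeros n

  sum-unit : ∀ {n} (i : Fin n) → sum (unit i) ≡ 1
  sum-unit {suc n} zero    = cong suc (sum-zeros n)
  sum-unit         (suc i) = sum-unit i

  degree-mapExp : ∀ {m n e} (f : Exponent m → Exponent n) → (∀ γ → sum (f γ) ℕ.≤ e ℕ.+ sum γ) →
    ∀ {d p} → Degree≤ d p → Degree≤ (e ℕ.+ d) (mapExp f p)
  degree-mapExp {e = e} f df dp = AllP.map⁺ (All.map (λ {t} l → ℕP.≤-trans (df (proj₁ t)) (ℕP.+-monoʳ-≤ e l)) dp)

  degree-⊛ : ∀ {n d e} {p q : Polynomial n} → Degree≤ d p → Degree≤ e q → Degree≤ (d ℕ.+ e) (p ⊛ q)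
  degree-⊛ {d = d} {e} dp dq = degree-weaken (ℕP.≤-reflexive (ℕP.+-comm e d))
    (degree-bind (λ γ → degree-weaken (ℕP.≤-reflexive (ℕP.+-comm (sum γ) e))
      (degree-mapExp (zipWith ℕ._+_ γ) (λ η → ℕP.≤-reflexive (sum-+ γ η)) dq)) dp)

  degree-one : ∀ {n} → Degree≤ {n} 0 one
  degree-one {n} = ℕP.≤-reflexive (sum-zeros n) ∷ []

  degree-power : ∀ {n} {q : Polynomial n} → Degree≤ 1 q → ∀ k → Degree≤ k (power q k)
  degree-power dq zero    = degree-one
  degree-power dq (suc k) = degree-⊛ dq (degree-power dq k)

  degree-substMono : ∀ {m n} (qs : Vec (Polynomial m) n) → (∀ i → Degree≤ 1 (lookup qs i)) →
    ∀ γ → Degree≤ (sum γ) (substMono qs γ)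
  degree-substMono []       dqs []      = degree-one
  degree-substMono (q ∷ qs) dqs (k ∷ γ) =
    degree-⊛ (degree-power (dqs zero) k) (degree-substMono qs (dqs ∘ suc) γ)

  degree-substitute : ∀ {m n} (qs : Vec (Polynomial m) n) → (∀ i → Degree≤ 1 (lookup qs i)) →
    ∀ {d p} → Degree≤ d p → Degree≤ d (substitute qs p)
  degree-substitute qs dqs = degree-bind {e = 0} (degree-substMono qs dqs)

  degree-affine : ∀ {n} (i : Fin n) a → Degree≤ 1 (affine i a)
  degree-affine {n} i a = ℕP.≤-reflexive (sum-unit i) ∷ ℕP.≤-trans (ℕP.≤-reflexive (sum-zeros n)) z≤n ∷ []

  coeff-above : ∀ {n d η} {p : Polynomial n} → Degree≤ d p → d ℕ.< sum η → coeff p η ≈ 0#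
  coeff-above {d = d} dp l = coeff-absent {P = λ γ → sum γ ℕ.≤ d} (ℕP.<⇒≱ l) dp

  δ-injective : ∀ {m n} (f : Exponent m → Exponent n) → (∀ {γ η} → f γ ≡ f η → γ ≡ η) → ∀ η γ → δ (f η) (f γ) ≡ δ η γ
  δ-injective f inj η γ with γ ≟ᵉ η
  ... | yes ≡.refl = δ-≡ {γ = f γ} ≡.refl
  ... | no ne      = δ-≢ {γ = f γ} (ne ∘ inj)

  coeff-mapExp : ∀ {m n} (f : Exponent m → Exponent n) → (∀ {γ η} → f γ ≡ f η → γ ≡ η) →
    ∀ p η → coeff (mapExp f p) (f η) ≈ coeff p η
  coeff-mapExp f inj p η = trans (reflexive (lin-mapExp (δ (f η)) f p))
    (lin-cong (λ γ → reflexive (δ-injective f inj η γ)) p)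

  coeff-mapExp-∉ : ∀ {m n} (f : Exponent m → Exponent n) {η} → (∀ γ → f γ ≢ η) → ∀ p → coeff (mapExp f p) η ≈ 0#
  coeff-mapExp-∉ f {η} ne p = trans (reflexive (lin-mapExp (δ η) f p))
    (trans (lin-cong (λ γ → reflexive (δ-≢ (ne γ))) p) (lin-zero p))

  -- Each exponent of sum at most `d` is visited exactly once: its head is zero, or it is raised
  -- from an exponent of sum at most `d - 1`.
  fromCoeffs : ∀ n → ℕ → (Exponent n → Carrier) → Polynomial n
  fromCoeffs zero    d       f = monomial [] (f [])
  fromCoeffs (suc n) zero    f = mapExp (0 ∷_) (fromCoeffs n 0 (f ∘ (0 ∷_)))
  fromCoeffs (suc n) (suc d) f =
    mapExp (0 ∷_) (fromCoeffs n (suc d) (f ∘ (0 ∷_))) ++ mapExp raiseHead (fromCoeffs (suc n) d (f ∘ raiseHead))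

  degree-fromCoeffs : ∀ n d f → Degree≤ d (fromCoeffs n d f)
  degree-fromCoeffs zero    d       f = z≤n ∷ []
  degree-fromCoeffs (suc n) zero    f = degree-mapExp {e = 0} (0 ∷_) (λ _ → ℕP.≤-refl) (degree-fromCoeffs n 0 _)
  degree-fromCoeffs (suc n) (suc d) f = degree-++
    (degree-mapExp {e = 0} (0 ∷_) (λ _ → ℕP.≤-refl) (degree-fromCoeffs n (suc d) _))
    (degree-mapExp {e = 1} raiseHead (λ { (_ ∷ _) → ℕP.≤-refl }) (degree-fromCoeffs (suc n) d _))

  coeff-fromCoeffs : ∀ n d f η → sum η ℕ.≤ d → coeff (fromCoeffs n d f) η ≈ f η
  coeff-fromCoeffs zero    d       f []      l = trans (+-identityʳ _) (*-identityʳ _)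
  coeff-fromCoeffs (suc n) zero    f (zero ∷ η) l =
    trans (coeff-mapExp (0 ∷_) VP.∷-injectiveʳ (fromCoeffs n 0 (f ∘ (0 ∷_))) η) (coeff-fromCoeffs n 0 _ η l)
  coeff-fromCoeffs (suc n) (suc d) f η l = trans (lin-++ (δ η) low high) (parts η l)
    where
    low  = mapExp (0 ∷_) (fromCoeffs n (suc d) (f ∘ (0 ∷_)))
    high = mapExp raiseHead (fromCoeffs (suc n) d (f ∘ raiseHead))
    parts : ∀ η → sum η ℕ.≤ suc d → coeff low η + coeff high η ≈ f η
    parts (zero ∷ η) l = trans (+-cong
      (trans (coeff-mapExp (0 ∷_) VP.∷-injectiveʳ (fromCoeffs n (suc d) _) η) (coeff-fromCoeffs n (suc d) _ η l))
      (coeff-mapExp-∉ raiseHead (λ { (_ ∷ _) () }) (fromCoeffs (suc n) d _))) (+-identityʳ _)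
    parts (suc k ∷ η) (s≤s l) = trans (+-cong
      (coeff-mapExp-∉ (0 ∷_) (λ { _ () }) (fromCoeffs n (suc d) _))
      (trans (coeff-mapExp raiseHead (λ { {_ ∷ _} {_ ∷ _} ≡.refl → ≡.refl }) (fromCoeffs (suc n) d _) (k ∷ η))
             (coeff-fromCoeffs (suc n) d _ (k ∷ η) l))) (+-identityˡ _)

-- Interpolation at the nodes γ̄

-- An indicator with values in `ℕ` that computes by recursion: `[ suc b ≤ suc a ]` reduces to
-- `[ b ≤ a ]`, which is what turns strict into weak comparison in `#<-suc` when an entry is raised
-- by one.
[_≤_] : ℕ → ℕ → ℕ
[ zero  ≤ b     ] = 1
[ suc a ≤ zero  ] = 0
[ suc a ≤ suc b ] = [ a ≤ b ]

#≤ #< : ∀ {n} → ℕ → Vec ℕ n → ℕ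
#≤ a []      = 0
#≤ a (b ∷ γ) = [ b ≤ a ] ℕ.+ #≤ a γ
#< a []      = 0
#< a (b ∷ γ) = [ suc b ≤ a ] ℕ.+ #< a γ

-- f a counts the entries to the left of the current vector that are smaller than a.
ranks : ∀ {n} → (ℕ → ℕ) → Vec ℕ n → Vec ℕ n
ranks f []      = []
ranks f (a ∷ γ) = (f a ℕ.+ #≤ a γ) ∷ ranks (λ b → [ suc a ≤ b ] ℕ.+ f b) γ

ranks-cong : ∀ {n} {f g : ℕ → ℕ} → (∀ a → f a ≡ g a) → (γ : Vec ℕ n) → ranks f γ ≡ ranks g γ
ranks-cong e []      = ≡.refl
ranks-cong e (a ∷ γ) = cong₂ _∷_ (cong (ℕ._+ #≤ a γ) (e a)) (ranks-cong (λ b → cong ([ suc a ≤ b ] ℕ.+_) (e b)) γ)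

#≤-∷ʳ : ∀ {n} a (γ : Vec ℕ n) b → #≤ a (γ ∷ʳ b) ≡ [ b ≤ a ] ℕ.+ #≤ a γ
#≤-∷ʳ a []      b = ≡.refl
#≤-∷ʳ a (c ∷ γ) b = ≡.trans (cong ([ c ≤ a ] ℕ.+_) (#≤-∷ʳ a γ b)) (+-swap [ c ≤ a ] [ b ≤ a ] (#≤ a γ))
  where
  +-swap : ∀ x y z → x ℕ.+ (y ℕ.+ z) ≡ y ℕ.+ (x ℕ.+ z)
  +-swap x y z = ≡.trans (≡.sym (ℕP.+-assoc x y z)) (≡.trans (cong (ℕ._+ z) (ℕP.+-comm x y)) (ℕP.+-assoc y x z))

ranks-∷ʳ : ∀ {n} f (γ : Vec ℕ n) a →
  ranks f (γ ∷ʳ a) ≡ ranks (λ b → [ a ≤ b ] ℕ.+ f b) γ ∷ʳ (#< a γ ℕ.+ f a)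
ranks-∷ʳ f []      a = cong (_∷ []) (ℕP.+-identityʳ (f a))
ranks-∷ʳ f (c ∷ γ) a = cong₂ _∷_
  (≡.trans (cong (f c ℕ.+_) (#≤-∷ʳ c γ a)) (rotate (f c) [ a ≤ c ] (#≤ c γ)))
  (≡.trans (ranks-∷ʳ (λ b → [ suc c ≤ b ] ℕ.+ f b) γ a)
    (cong₂ _∷ʳ_ (ranks-cong (λ b → swap [ a ≤ b ] [ suc c ≤ b ] (f b)) γ)
                (rotate′ (#< a γ) [ suc c ≤ a ] (f a))))
  where
  open import Data.Nat.Solver
  open +-*-Solver
  rotate : ∀ x y z → x ℕ.+ (y ℕ.+ z) ≡ y ℕ.+ x ℕ.+ z
  rotate = solve 3 (λ x y z → x :+ (y :+ z) := y :+ x :+ z) ≡.refl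
  swap : ∀ x y z → x ℕ.+ (y ℕ.+ z) ≡ y ℕ.+ (x ℕ.+ z)
  swap = solve 3 (λ x y z → x :+ (y :+ z) := y :+ (x :+ z)) ≡.refl
  rotate′ : ∀ x y z → x ℕ.+ (y ℕ.+ z) ≡ y ℕ.+ x ℕ.+ z
  rotate′ = solve 3 (λ x y z → x :+ (y :+ z) := y :+ x :+ z) ≡.refl

#<-zero : ∀ {n} (γ : Vec ℕ n) → #< 0 γ ≡ 0
#<-zero []      = ≡.refl
#<-zero (b ∷ γ) = #<-zero γ

#<-suc : ∀ {n} a (γ : Vec ℕ n) → #< (suc a) γ ≡ #≤ a γ
#<-suc a []      = ≡.refl
#<-suc a (b ∷ γ) = cong ([ b ≤ a ] ℕ.+_) (#<-suc a γ)

-- A final zero is at most every entry to its left, so it raises each of their ranks by one. On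
-- nodes this becomes the translation by `ρ`.
ranks-∷ʳ-zero : ∀ {n} (γ : Vec ℕ n) → ranks (const 0) (γ ∷ʳ 0) ≡ ranks (const 1) γ ∷ʳ 0
ranks-∷ʳ-zero γ = ≡.trans (ranks-∷ʳ (const 0) γ 0)
  (cong (ranks (const 1) γ ∷ʳ_) (≡.trans (ℕP.+-identityʳ (#< 0 γ)) (#<-zero γ)))

-- Moving the head `a` to the end as `suc a` changes no rank. An entry `b` counted `a` on its left
-- when a < b, and it counts `suc a` on its right when a + 1 ≤ b, which is the same condition; seen
-- from the moved entry, `#< (suc a)` is `#≤ a`.
ranks-cycle : ∀ {n} (γ : Vec ℕ n) a →
  ranks (const 0) (γ ∷ʳ suc a) ≡ V.tail (ranks (const 0) (a ∷ γ)) ∷ʳ #≤ a γ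
ranks-cycle γ a = ≡.trans (ranks-∷ʳ (const 0) γ (suc a))
  (cong (V.tail (ranks (const 0) (a ∷ γ)) ∷ʳ_) (≡.trans (ℕP.+-identityʳ (#< (suc a) γ)) (#<-suc a γ)))

module _ {a} {A : Set a} where
  lookup-∷ʳ-fromℕ : ∀ {n} (x : Vec A n) y → lookup (x ∷ʳ y) (Fin.fromℕ n) ≡ y
  lookup-∷ʳ-fromℕ []       y = ≡.refl
  lookup-∷ʳ-fromℕ (x ∷ xs) y = lookup-∷ʳ-fromℕ xs y

  lookup-∷ʳ-inject₁ : ∀ {n} (x : Vec A n) y i → lookup (x ∷ʳ y) (Fin.inject₁ i) ≡ lookup x i
  lookup-∷ʳ-inject₁ (x ∷ xs) y zero    = ≡.refl
  lookup-∷ʳ-inject₁ (x ∷ xs) y (suc i) = lookup-∷ʳ-inject₁ xs y i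

module Interpolation {c ℓ} (K : CommutativeRing c ℓ) where
  open CommutativeRing K hiding (zero)
  open Polynomials K public
  open import Algebra.Properties.Semiring.Exp semiring using (_^_)
  open import Relation.Binary.Reasoning.Setoid setoid
  open NatSolver commutativeSemiring using (solve; _:+_; _:*_; con; _:=_)

  ι : ℕ → Carrier
  ι zero    = 0#
  ι (suc k) = 1# + ι k

  module Points (ρ : Carrier) where

    point : ∀ {n} → Vec ℕ n → Vec ℕ n → Vec Carrier n
    point = zipWith (λ a k → ι a + ρ * ι k)

    -- The node γ̄ with `ρ` in place of r. The vector w_γ(δ) is computed entrywise by `ranks`, so
    -- that no permutation enters the interpolation; `bar≈` identifies the two descriptions.
    bar : ∀ {n} → Exponent n → Vec Carrier n
    bar γ = point γ (ranks (const 0) γ)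

    point-∷ʳ : ∀ {n} (γ κ : Vec ℕ n) a k → point (γ ∷ʳ a) (κ ∷ʳ k) ≡ point γ κ ∷ʳ (ι a + ρ * ι k)
    point-∷ʳ []      []      a k = ≡.refl
    point-∷ʳ (b ∷ γ) (l ∷ κ) a k = cong (_ ∷_) (point-∷ʳ γ κ a k)

    translate : ∀ {n} → Carrier → Vec Carrier n → Vec Carrier n
    translate a = V.map (_+ a)

    point-suc : ∀ {n} f (γ : Vec ℕ n) → point γ (ranks (suc ∘ f) γ) ≈ᵛ translate ρ (point γ (ranks f γ))
    point-suc f []      = []
    point-suc f (a ∷ γ) = lem (ι a) (ι (f a ℕ.+ #≤ a γ)) ∷
      ≈ᵛ-trans
        (≡⇒≈ᵛ (cong (point γ) (ranks-cong (λ b → ℕP.+-suc [ suc a ≤ b ] (f b)) γ)))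
        (point-suc (λ b → [ suc a ≤ b ] ℕ.+ f b) γ)
      where
      lem : ∀ x k → x + ρ * (1# + k) ≈ x + ρ * k + ρ
      lem = solve 3 (λ ρ x k → x :+ ρ :* (con 1 :+ k) := x :+ ρ :* k :+ ρ) refl ρ

    zero-entry : ι 0 + ρ * ι 0 ≈ 0#
    zero-entry = trans (+-identityˡ _) (zeroʳ ρ)

    bar-∷ʳ-zero : ∀ {n} (γ : Exponent n) → bar (γ ∷ʳ 0) ≈ᵛ (translate ρ (bar γ) ∷ʳ 0#)
    bar-∷ʳ-zero γ = ≈ᵛ-trans
      (≡⇒≈ᵛ (≡.trans (cong (point (γ ∷ʳ 0)) (ranks-∷ʳ-zero γ)) (point-∷ʳ γ (ranks (const 1) γ) 0 0)))
      (∷ʳ⁺ (point-suc (const 0) γ) zero-entry)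

    cycle : ∀ {n} → Vec Carrier (suc n) → Vec Carrier (suc n)
    cycle (x ∷ xs) = xs ∷ʳ (x + 1#)

    last-entry : ∀ {n} → ℕ → Exponent n → Carrier
    last-entry a γ = ι (suc a) + ρ * ι (#≤ a γ)

    bar-∷ʳ-suc : ∀ {n} (γ : Exponent n) a → bar (γ ∷ʳ suc a) ≡ V.tail (bar (a ∷ γ)) ∷ʳ last-entry a γ
    bar-∷ʳ-suc γ a = ≡.trans (cong (point (γ ∷ʳ suc a)) (ranks-cycle γ a)) (point-∷ʳ γ _ (suc a) _)

    bar-cycle : ∀ {n} (γ : Exponent n) a → bar (γ ∷ʳ suc a) ≈ᵛ cycle (bar (a ∷ γ))
    bar-cycle γ a = ≈ᵛ-trans (≡⇒≈ᵛ (bar-∷ʳ-suc γ a))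
      (∷ʳ⁺ ≈ᵛ-refl (solve 3 (λ x ρ k → con 1 :+ x :+ ρ :* k := x :+ ρ :* k :+ con 1) refl (ι a) ρ (ι (#≤ a γ))))

    translation : ∀ {n} → Carrier → Vec (Polynomial n) n
    translation a = tabulate (λ i → affine i a)

    shift : ∀ {n} → Carrier → Polynomial n → Polynomial n
    shift a = substitute (translation a)

    degree-shift : ∀ {n} a {d} {p : Polynomial n} → Degree≤ d p → Degree≤ d (shift a p)
    degree-shift a = degree-substitute (translation a)
      (λ i → ≡.subst (Degree≤ 1) (≡.sym (VP.lookup∘tabulate (λ i → affine i a) i)) (degree-affine i a))

    eval-translation : ∀ {n} a (x : Vec Carrier n) → V.map (λ q → eval q x) (translation a) ≈ᵛ translate a x
    eval-translation a x = pointwise (λ i → trans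
      (reflexive (≡.trans (VP.lookup-map i (λ q → eval q x) (translation a))
                          (cong (λ q → eval q x) (VP.lookup∘tabulate (λ i → affine i a) i))))
      (trans (eval-affine i a x) (reflexive (≡.sym (VP.lookup-map i (_+ a) x)))))

    eval-shift : ∀ {n} a (p : Polynomial n) x → eval (shift a p) x ≈ eval p (translate a x)
    eval-shift a p x = trans (eval-substitute (translation a) p x) (eval-cong p (eval-translation a x))

    translate-inverse : ∀ {n} {a b} → a + b ≈ 0# → (x : Vec Carrier n) → translate b (translate a x) ≈ᵛ x
    translate-inverse e []       = []
    translate-inverse e (x ∷ xs) =
      trans (+-assoc x _ _) (trans (+-congˡ e) (+-identityʳ x)) ∷ translate-inverse e xs

    module _ {n : ℕ} where
      raiseLast : Exponent (suc n) → Exponent (suc n)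
      raiseLast γ = V.init γ ∷ʳ suc (V.last γ)

      raiseLast-∷ʳ : ∀ (γ : Exponent n) k → raiseLast (γ ∷ʳ k) ≡ γ ∷ʳ suc k
      raiseLast-∷ʳ γ k = cong₂ (λ γ k → γ ∷ʳ suc k) (VP.init-∷ʳ k γ) (VP.last-∷ʳ k γ)

      mono-raiseLast : ∀ x y γ → mono (x ∷ʳ y) (raiseLast γ) ≈ y * mono (x ∷ʳ y) γ
      mono-raiseLast x y γ with V.initLast γ
      ... | γ′ , k , ≡.refl = begin
        mono (x ∷ʳ y) (γ′ ∷ʳ suc k)  ≈⟨ mono-∷ʳ x y γ′ (suc k) ⟩
        mono x γ′ * (y * y ^ k)
          ≈⟨ solve 3 (λ a b c → a :* (b :* c) := b :* (a :* c)) refl (mono x γ′) y (y ^ k) ⟩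
        y * (mono x γ′ * y ^ k)  ≈⟨ *-congˡ (mono-∷ʳ x y γ′ k) ⟨
        y * mono (x ∷ʳ y) (γ′ ∷ʳ k) ∎

      -- The decomposition g + x_n h, stated for all functionals `lin φ` at once so that it can be
      -- read both in coefficients and in values. The field `quotient-degree-0` starts the induction
      -- on the degree.
      record LastSplit (p : Polynomial (suc n)) : Set (c ⊔ ℓ) where
        field
          constant  : Polynomial n
          quotient  : Polynomial (suc n)
          lin-split-last : ∀ φ → lin φ p ≈ lin (φ ∘ (_∷ʳ 0)) constant + lin (φ ∘ raiseLast) quotient
          degree-constant : ∀ {d} → Degree≤ d p → Degree≤ d constant
          degree-quotient : ∀ {d} → Degree≤ (suc d) p → Degree≤ d quotient
          quotient-degree-0 : Degree≤ 0 p → quotient ≡ []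
      open LastSplit public

      splitLast : ∀ p → LastSplit p
      splitLast [] = record
        { constant = [] ; quotient = [] ; lin-split-last = λ φ → sym (+-identityʳ 0#)
        ; degree-constant = λ _ → [] ; degree-quotient = λ _ → [] ; quotient-degree-0 = λ _ → ≡.refl }
      splitLast ((γ , a) ∷ p) with V.initLast γ | splitLast p
      ... | γ′ , zero , ≡.refl | s = record
        { constant = (γ′ , a) ∷ constant s
        ; quotient = quotient s
        ; lin-split-last = λ φ → trans (+-congˡ (lin-split-last s φ)) (sym (+-assoc _ _ _))
        ; degree-constant = λ { (l ∷ ls) → ≡.subst (ℕ._≤ _) (sum-∷ʳ γ′ 0) l ∷ degree-constant s ls }
        ; degree-quotient = λ { (l ∷ ls) → degree-quotient s ls }
        ; quotient-degree-0 = λ { (l ∷ ls) → quotient-degree-0 s ls } }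
      ... | γ′ , suc k , ≡.refl | s = record
        { constant = constant s
        ; quotient = (γ′ ∷ʳ k , a) ∷ quotient s
        ; lin-split-last = λ φ → trans
            (+-cong (*-congˡ (reflexive (cong φ (≡.sym (raiseLast-∷ʳ γ′ k))))) (lin-split-last s φ))
            (solve 3 (λ x y z → x :+ (y :+ z) := y :+ (x :+ z)) refl _ _ _)
        ; degree-constant = λ { (l ∷ ls) → degree-constant s ls }
        ; degree-quotient = λ { (l ∷ ls) →
            ≡.subst (ℕ._≤ _) (≡.sym (sum-∷ʳ γ′ k)) (ℕP.≤-pred (≡.subst (ℕ._≤ _) (sum-∷ʳ γ′ (suc k)) l))
            ∷ degree-quotient s ls }
        ; quotient-degree-0 = λ { (l ∷ ls) → contradiction (≡.subst (ℕ._≤ 0) (sum-∷ʳ γ′ (suc k)) l) λ () } }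

      eval-split-last : ∀ p (x : Vec Carrier n) y → eval p (x ∷ʳ y) ≈
        eval (constant (splitLast p)) x + y * eval (quotient (splitLast p)) (x ∷ʳ y)
      eval-split-last p x y = trans (lin-split-last s (mono (x ∷ʳ y))) (+-cong
        (lin-cong (λ γ → trans (mono-∷ʳ x y γ 0) (*-identityʳ _)) (constant s))
        (trans (lin-cong (mono-raiseLast x y) (quotient s)) (lin-* (mono (x ∷ʳ y)) y (quotient s))))
        where s = splitLast p

    cyclic uncyclic : ∀ {n} → Vec (Polynomial (suc n)) (suc n)
    cyclic {n} = tabulate (λ (i : Fin n) → affine (suc i) 0#) ∷ʳ affine zero 1#
    uncyclic {n} = affine (Fin.fromℕ n) (- 1#) ∷ tabulate (λ i → affine (Fin.inject₁ i) 0#)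

    eval-tabulate-affine : ∀ {m n} (f : Fin m → Fin n) x → 
      V.map (λ q → eval q x) (tabulate (λ i → affine (f i) 0#)) ≈ᵛ tabulate (lookup x ∘ f)
    eval-tabulate-affine f x = pointwise (λ i → trans
      (reflexive (≡.trans (VP.lookup-map i (λ q → eval q x) (tabulate (λ i → affine (f i) 0#)))
                          (cong (λ q → eval q x) (VP.lookup∘tabulate (λ i → affine (f i) 0#) i))))
      (trans (eval-affine (f i) 0# x)
        (trans (+-identityʳ _) (reflexive (≡.sym (VP.lookup∘tabulate (lookup x ∘ f) i))))))

    eval-cyclic : ∀ {n} (p : Polynomial (suc n)) x → eval (substitute cyclic p) x ≈ eval p (cycle x)
    eval-cyclic {n} p x@(x₀ ∷ xs) = trans (eval-substitute cyclic p x) (eval-cong p (≈ᵛ-trans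
      (≡⇒≈ᵛ (VP.map-∷ʳ (λ q → eval q x) (affine zero 1#) (tabulate (λ (i : Fin n) → affine (suc i) 0#))))
      (∷ʳ⁺ (≈ᵛ-trans (eval-tabulate-affine suc x) (≡⇒≈ᵛ (VP.tabulate∘lookup xs))) (eval-affine zero 1# x))))

    eval-uncyclic : ∀ {n} (p : Polynomial (suc n)) (x : Vec Carrier n) y →
      eval (substitute uncyclic p) (x ∷ʳ y) ≈ eval p ((y - 1#) ∷ x)
    eval-uncyclic {n} p x y = trans (eval-substitute uncyclic p (x ∷ʳ y)) (eval-cong p
      (trans (eval-affine (Fin.fromℕ n) (- 1#) (x ∷ʳ y)) (+-congʳ (reflexive (lookup-∷ʳ-fromℕ x y)))
       ∷ ≈ᵛ-trans (eval-tabulate-affine Fin.inject₁ (x ∷ʳ y))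
           (pointwise λ i → reflexive (≡.trans (VP.lookup∘tabulate (lookup (x ∷ʳ y) ∘ Fin.inject₁) i) (lookup-∷ʳ-inject₁ x y i)))))

    degree-uncyclic : ∀ {n d} {p : Polynomial (suc n)} → Degree≤ d p → Degree≤ d (substitute uncyclic p)
    degree-uncyclic {n} = degree-substitute uncyclic λ where
      zero    → degree-affine (Fin.fromℕ n) (- 1#)
      (suc i) → ≡.subst (Degree≤ 1) (≡.sym (VP.lookup∘tabulate (λ i → affine (Fin.inject₁ i) 0#) i)) (degree-affine (Fin.inject₁ i) 0#)

    degree-cyclic : ∀ {n d} {p : Polynomial (suc n)} → Degree≤ d p → Degree≤ d (substitute cyclic p)
    degree-cyclic {n} = degree-substitute cyclic (all-∷ʳ (tabulate (λ (i : Fin n) → affine (suc i) 0#))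
      (λ i → ≡.subst (Degree≤ 1) (≡.sym (VP.lookup∘tabulate (λ i → affine (suc i) 0#) i)) (degree-affine (suc i) 0#))
      (degree-affine zero 1#))
      where
      all-∷ʳ : ∀ {m k} (qs : Vec (Polynomial k) m) {q} → (∀ i → Degree≤ 1 (lookup qs i)) → Degree≤ 1 q →
        ∀ i → Degree≤ 1 (lookup (qs ∷ʳ q) i)
      all-∷ʳ []       ds d zero    = d
      all-∷ʳ (_ ∷ qs) ds d zero    = ds zero
      all-∷ʳ (_ ∷ qs) ds d (suc i) = all-∷ʳ qs (ds ∘ suc) d i

    -- Over a ring, nonvanishing at η̄ is recorded as invertibility. Ring homomorphisms preserve it,
    -- and it supplies the divisions by which `top-span` expands a polynomial in the `E`.
    record InterpolationPoly {n} (η : Exponent n) : Set (c ⊔ ℓ) where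
      field
        E            : Polynomial n
        degree-E     : Degree≤ (sum η) E
        vanishing-E  : ∀ γ → sum γ ℕ.≤ sum η → γ ≢ η → eval E (bar γ) ≈ 0#
        monic-E      : coeff E η ≈ 1#
        invertible-E : ∃ λ y → eval E (bar η) * y ≈ 1#
    open InterpolationPoly public

    NodesInvertible : Set (c ⊔ ℓ)
    NodesInvertible = ∀ m k → ∃ λ y → (ι (suc m) + ρ * ι k) * y ≈ 1#

    module Theory (inverse : NodesInvertible) where

      invertible-cancel : ∀ {x y z} → x * y ≈ 1# → x * z ≈ 0# → z ≈ 0#
      invertible-cancel {x} {y} {z} xy xz = begin
        z  ≈⟨ *-identityˡ z ⟨
        1# * z  ≈⟨ *-congʳ xy ⟨
        x * y * z  ≈⟨ solve 3 (λ x y z → x :* y :* z := x :* z :* y) refl x y z ⟩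
        x * z * y  ≈⟨ *-congʳ xz ⟩
        0# * y  ≈⟨ zeroˡ y ⟩
        0# ∎

      Vanishing : ∀ {n} → ℕ → Polynomial n → Set ℓ
      Vanishing d p = ∀ γ → sum γ ℕ.≤ d → eval p (bar γ) ≈ 0#

      -- Lexicographic induction on `n` and `d`. The nodes ending in zero annihilate the part free
      -- of the last variable. At the remaining nodes only x_n h is left, and its factor x_n takes
      -- invertible values there.
      vanishing⇒null : ∀ n d (p : Polynomial n) → Degree≤ d p → Vanishing d p → p ≋ []
      vanishing⇒null zero d p dp van = coeffwise λ { [] →
        trans (lin-cong (λ { [] → refl }) p) (van [] z≤n) }
      vanishing⇒null (suc n) d p dp van = coeffwise λ η → begin
        coeff p η  ≈⟨ lin-split-last s (δ η) ⟩
        lin (δ η ∘ (_∷ʳ 0)) (constant s) + lin (δ η ∘ raiseLast) (quotient s)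
          ≈⟨ +-cong (lin-≋ _ constant-null) (lin-≋ _ (quotient-null d dp van)) ⟩
        0# + 0#  ≈⟨ +-identityˡ 0# ⟩
        0# ∎
        where
        s = splitLast p
        q = constant s
        shifted-null : shift ρ q ≋ []
        shifted-null = vanishing⇒null n d (shift ρ q) (degree-shift ρ (degree-constant s dp)) λ γ l → begin
          eval (shift ρ q) (bar γ)  ≈⟨ eval-shift ρ q (bar γ) ⟩
          eval q (translate ρ (bar γ))  ≈⟨ +-identityʳ _ ⟨
          eval q (translate ρ (bar γ)) + 0#  ≈⟨ +-congˡ (zeroˡ _) ⟨
          eval q (translate ρ (bar γ)) + 0# * eval (quotient s) (translate ρ (bar γ) ∷ʳ 0#)
                                                            ≈⟨ eval-split-last p (translate ρ (bar γ)) 0# ⟨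
          eval p (translate ρ (bar γ) ∷ʳ 0#)  ≈⟨ eval-cong p (bar-∷ʳ-zero γ) ⟨
          eval p (bar (γ ∷ʳ 0))
            ≈⟨ van (γ ∷ʳ 0) (ℕP.≤-trans (ℕP.≤-reflexive (sum-∷ʳ γ 0)) l) ⟩
          0# ∎
        -- The shift is undone on points rather than on coefficients: a null polynomial vanishes
        -- everywhere, in particular at the points translated back by `- ρ`.
        constant-null : q ≋ []
        constant-null = vanishing⇒null n d q (degree-constant s dp) λ γ l → begin
          eval q (bar γ)
            ≈⟨ eval-cong q (translate-inverse (-‿inverseˡ ρ) (bar γ)) ⟨
          eval q (translate ρ (translate (- ρ) (bar γ)))
            ≈⟨ eval-shift ρ q (translate (- ρ) (bar γ)) ⟨
          eval (shift ρ q) (translate (- ρ) (bar γ))  ≈⟨ lin-≋ _ shifted-null ⟩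
          0# ∎
        quotient-null : ∀ d → Degree≤ d p → Vanishing d p → quotient s ≋ []
        quotient-null zero    dp van rewrite quotient-degree-0 s dp = ≋-refl
        -- The induction hypothesis is used twice. Applied to h composed with `cycle` it gives a
        -- null polynomial; since `cycle` is onto, h is then zero at every point. Applied to h
        -- itself it leads from these values back to the coefficients.
        quotient-null (suc d) dp van = vanishing⇒null (suc n) d h (degree-quotient s dp) λ γ l → everywhere-zero (bar γ)
          where
          h = quotient s
          h-vanishes : ∀ γ a → a ℕ.+ sum γ ℕ.≤ d → eval h (bar (γ ∷ʳ suc a)) ≈ 0#
          h-vanishes γ a l = invertible-cancel (proj₂ (inverse a (#≤ a γ))) (begin
            y * eval h (bar (γ ∷ʳ suc a))
              ≈⟨ *-congˡ (reflexive (cong (eval h) (bar-∷ʳ-suc γ a))) ⟩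
            y * eval h (x ∷ʳ y)  ≈⟨ +-identityˡ _ ⟨
            0# + y * eval h (x ∷ʳ y)
              ≈⟨ +-congʳ (lin-≋ (mono x) constant-null) ⟨
            eval q x + y * eval h (x ∷ʳ y)  ≈⟨ eval-split-last p x y ⟨
            eval p (x ∷ʳ y)
              ≈⟨ reflexive (cong (eval p) (bar-∷ʳ-suc γ a)) ⟨
            eval p (bar (γ ∷ʳ suc a))
              ≈⟨ van (γ ∷ʳ suc a) (ℕP.≤-trans (ℕP.≤-reflexive (sum-∷ʳ γ (suc a))) (s≤s l)) ⟩
            0# ∎)
            where
            x = V.tail (bar (a ∷ γ))
            y = last-entry a γ
          cyclic-null : substitute cyclic h ≋ []
          cyclic-null = vanishing⇒null (suc n) d (substitute cyclic h) (degree-cyclic (degree-quotient s dp)) λ where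
            (a ∷ γ) l → begin
              eval (substitute cyclic h) (bar (a ∷ γ))  ≈⟨ eval-cyclic h (bar (a ∷ γ)) ⟩
              eval h (cycle (bar (a ∷ γ)))  ≈⟨ eval-cong h (bar-cycle γ a) ⟨
              eval h (bar (γ ∷ʳ suc a))  ≈⟨ h-vanishes γ a l ⟩
              0# ∎
          everywhere-zero : ∀ x → eval h x ≈ 0#
          everywhere-zero x with V.initLast x
          ... | x′ , y , ≡.refl = begin
            eval h (x′ ∷ʳ y)
              ≈⟨ eval-cong h (∷ʳ⁺ (≈ᵛ-refl {x = x′}) (trans (+-assoc y (- 1#) 1#) (trans (+-congˡ (-‿inverseˡ 1#)) (+-identityʳ y)))) ⟨
            eval h (x′ ∷ʳ (y - 1# + 1#))  ≈⟨ eval-cyclic h ((y - 1#) ∷ x′) ⟨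
            eval (substitute cyclic h) ((y - 1#) ∷ x′)  ≈⟨ lin-≋ _ cyclic-null ⟩
            0# ∎

      -- The nodes up to the degree of `p ⊖ q` are among the points, so uniqueness of interpolation
      -- applies. Identities between coefficients, such as symmetry, can therefore be verified on
      -- values.
      eval-injective : ∀ {n} {p q : Polynomial n} → (∀ x → eval p x ≈ eval q x) → p ≋ q
      eval-injective {n} {p} {q} e with degree-bound (p ⊖ q)
      ... | d , dpq = ⊖-null⇒≋ (vanishing⇒null n d (p ⊖ q) dpq λ γ _ →
              trans (lin-⊖ (mono (bar γ)) p q) (x-x≈0 (e (bar γ))))

      record Interpolant (n d : ℕ) (v : Exponent n → Carrier) : Set (c ⊔ ℓ) where
        field
          poly       : Polynomial n
          degree     : Degree≤ d poly
          eval-poly  : ∀ γ → sum γ ℕ.≤ d → eval poly (bar γ) ≈ v γ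
      open Interpolant public

      module Lift {n d : ℕ} (v : Exponent (suc n) → Carrier) (low : Interpolant n d (λ γ → v (γ ∷ʳ 0))) where
        g : Polynomial (suc n)
        -- The shift by `- ρ` compensates the translation that a final zero causes in the other
        -- coordinates.
        g = mapExp (_∷ʳ 0) (shift (- ρ) (poly low))
        degree-g : Degree≤ d g
        degree-g = degree-mapExp {e = 0} (_∷ʳ 0) (λ γ → ℕP.≤-reflexive (sum-∷ʳ γ 0)) (degree-shift (- ρ) (degree low))
        eval-g : ∀ γ → sum γ ℕ.≤ d → eval g (bar (γ ∷ʳ 0)) ≈ v (γ ∷ʳ 0)
        eval-g γ l = begin
          eval g (bar (γ ∷ʳ 0))  ≈⟨ eval-cong g (bar-∷ʳ-zero γ) ⟩
          eval g (x ∷ʳ 0#)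
            ≈⟨ reflexive (lin-mapExp (mono (x ∷ʳ 0#)) (_∷ʳ 0) g′) ⟩
          lin (mono (x ∷ʳ 0#) ∘ (_∷ʳ 0)) g′
            ≈⟨ lin-cong (λ γ → trans (mono-∷ʳ x 0# γ 0) (*-identityʳ _)) g′ ⟩
          eval g′ x  ≈⟨ eval-shift (- ρ) (poly low) x ⟩
          eval (poly low) (translate (- ρ) x)
            ≈⟨ eval-cong (poly low) (translate-inverse (-‿inverseʳ ρ) (bar γ)) ⟩
          eval (poly low) (bar γ)  ≈⟨ eval-poly low γ l ⟩
          v (γ ∷ʳ 0) ∎
          where
          x = translate ρ (bar γ)
          g′ = shift (- ρ) (poly low)

        -- Values at γ ∷ʳ suc a, divided by the last coordinate of bar (γ ∷ʳ suc a).
        residue : Exponent (suc n) → Carrier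
        residue (a ∷ γ) = (v (γ ∷ʳ suc a) - eval g (bar (γ ∷ʳ suc a))) * proj₁ (inverse a (#≤ a γ))

      interpolate-constant : ∀ {n} {v : Exponent (suc n) → Carrier} → Interpolant n 0 (λ γ → v (γ ∷ʳ 0)) → Interpolant (suc n) 0 v
      interpolate-constant {v = v} low = record { poly = g ; degree = degree-g ; eval-poly = eval-poly₀ }
        where
        open Lift v low
        eval-poly₀ : ∀ γ → sum γ ℕ.≤ 0 → eval g (bar γ) ≈ v γ
        eval-poly₀ γ l with V.initLast γ
        ... | γ′ , zero  , ≡.refl = eval-g γ′ (ℕP.≤-trans (ℕP.≤-reflexive (≡.sym (sum-∷ʳ γ′ 0))) l)
        ... | γ′ , suc a , ≡.refl = contradiction (ℕP.≤-trans (ℕP.≤-reflexive (≡.sym (sum-∷ʳ γ′ (suc a)))) l) λ ()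

      interpolate-raise : ∀ {n e v} (low : Interpolant n (suc e) (λ γ → v (γ ∷ʳ 0))) →
        Interpolant (suc n) e (Lift.residue v low) → Interpolant (suc n) (suc e) v
      interpolate-raise {n} {e} {v} low high = record
        { poly = g ++ h
        ; degree = degree-++ degree-g (degree-mapExp {e = 1} raiseLast sum-raiseLast (degree-uncyclic (degree high)))
        ; eval-poly = eval-poly₁ }
        where
        open Lift v low
        -- A multiple of the last variable, so the values of `g` at nodes ending in zero are
        -- undisturbed. At the other nodes `uncyclic` leads the argument back to `bar (a ∷ γ′)`, and
        -- the factor y is absorbed by the division built into `residue`.
        h = mapExp raiseLast (substitute uncyclic (poly high))
        sum-raiseLast : ∀ γ → sum (raiseLast γ) ℕ.≤ suc (sum γ)
        sum-raiseLast γ with V.initLast γ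
        ... | γ′ , k , ≡.refl = ℕP.≤-reflexive (≡.trans (sum-∷ʳ γ′ (suc k)) (cong suc (≡.sym (sum-∷ʳ γ′ k))))
        eval-h : ∀ x y → eval h (x ∷ʳ y) ≈ y * eval (poly high) ((y - 1#) ∷ x)
        eval-h x y = begin
          eval h (x ∷ʳ y)
            ≈⟨ reflexive (lin-mapExp (mono (x ∷ʳ y)) raiseLast (substitute uncyclic (poly high))) ⟩
          lin (mono (x ∷ʳ y) ∘ raiseLast) (substitute uncyclic (poly high))
            ≈⟨ lin-cong (mono-raiseLast x y) (substitute uncyclic (poly high)) ⟩
          lin (λ γ → y * mono (x ∷ʳ y) γ) (substitute uncyclic (poly high))
            ≈⟨ lin-* (mono (x ∷ʳ y)) y (substitute uncyclic (poly high)) ⟩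
          y * eval (substitute uncyclic (poly high)) (x ∷ʳ y)
            ≈⟨ *-congˡ (eval-uncyclic (poly high) x y) ⟩
          y * eval (poly high) ((y - 1#) ∷ x) ∎
        eval-poly₁ : ∀ γ → sum γ ℕ.≤ suc e → eval (g ++ h) (bar γ) ≈ v γ
        eval-poly₁ γ l with V.initLast γ
        ... | γ′ , zero , ≡.refl = begin
          eval (g ++ h) (bar (γ′ ∷ʳ 0))  ≈⟨ lin-++ _ g h ⟩
          eval g (bar (γ′ ∷ʳ 0)) + eval h (bar (γ′ ∷ʳ 0))
            ≈⟨ +-cong (eval-g γ′ (ℕP.≤-trans (ℕP.≤-reflexive (≡.sym (sum-∷ʳ γ′ 0))) l))
                 (trans (eval-cong h (bar-∷ʳ-zero γ′)) (trans (eval-h (translate ρ (bar γ′)) 0#) (zeroˡ _))) ⟩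
          v (γ′ ∷ʳ 0) + 0#  ≈⟨ +-identityʳ _ ⟩
          v (γ′ ∷ʳ 0) ∎
        ... | γ′ , suc a , ≡.refl = begin
          eval (g ++ h) X  ≈⟨ lin-++ _ g h ⟩
          G + eval h X
            ≈⟨ +-congˡ (trans (reflexive (cong (eval h) (bar-∷ʳ-suc γ′ a))) (eval-h x y)) ⟩
          G + y * eval (poly high) ((y - 1#) ∷ x)
            ≈⟨ +-congˡ (*-congˡ (trans (eval-cong (poly high) (y-1 ∷ ≈ᵛ-refl)) (eval-poly high (a ∷ γ′)
                 (ℕP.≤-pred (ℕP.≤-trans (ℕP.≤-reflexive (≡.sym (sum-∷ʳ γ′ (suc a)))) l))))) ⟩
          G + y * ((v (γ′ ∷ʳ suc a) - G) * z)
            ≈⟨ +-congˡ (solve 3 (λ y u z → y :* (u :* z) := u :* (y :* z)) refl y (v (γ′ ∷ʳ suc a) - G) z) ⟩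
          G + (v (γ′ ∷ʳ suc a) - G) * (y * z)
            ≈⟨ +-congˡ (trans (*-congˡ (proj₂ (inverse a (#≤ a γ′)))) (*-identityʳ _)) ⟩
          G + (v (γ′ ∷ʳ suc a) - G)
            ≈⟨ solve 3 (λ G v m → G :+ (v :+ m) := v :+ (G :+ m)) refl G (v (γ′ ∷ʳ suc a)) (- G) ⟩
          v (γ′ ∷ʳ suc a) + (G - G)
            ≈⟨ trans (+-congˡ (-‿inverseʳ G)) (+-identityʳ _) ⟩
          v (γ′ ∷ʳ suc a) ∎
          where
          X = bar (γ′ ∷ʳ suc a)
          G = eval g X
          x = V.tail (bar (a ∷ γ′))
          y = last-entry a γ′
          z = proj₁ (inverse a (#≤ a γ′))
          y-1 : y - 1# ≈ ι a + ρ * ι (#≤ a γ′)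
          y-1 = begin
            1# + ι a + ρ * ι (#≤ a γ′) - 1#
              ≈⟨ solve 4 (λ o a k m → o :+ a :+ k :+ m := a :+ k :+ (o :+ m)) refl 1# (ι a) (ρ * ι (#≤ a γ′)) (- 1#) ⟩
            ι a + ρ * ι (#≤ a γ′) + (1# - 1#)  ≈⟨ trans (+-congˡ (-‿inverseʳ 1#)) (+-identityʳ _) ⟩
            ι a + ρ * ι (#≤ a γ′) ∎

      interpolate : ∀ n d v → Interpolant n d v
      interpolate zero d v = record
        { poly = monomial [] (v []) ; degree = z≤n ∷ []
        ; eval-poly = λ { [] _ → trans (+-identityʳ _) (*-identityʳ _) } }
      interpolate (suc n) zero    v = interpolate-constant (interpolate n 0 (λ γ → v (γ ∷ʳ 0)))
      interpolate (suc n) (suc e) v =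
        let low = interpolate n (suc e) (λ γ → v (γ ∷ʳ 0))
        in interpolate-raise low (interpolate (suc n) e (Lift.residue v low))

-- The polynomials E_η

module InterpolationPolynomials {c ℓ} (K : CommutativeRing c ℓ) (ρ : CommutativeRing.Carrier K)
  (inverse : Interpolation.Points.NodesInvertible K ρ) where
  open CommutativeRing K hiding (zero)
  open Interpolation K
  open Points ρ
  open Theory inverse
  open import Relation.Binary.Reasoning.Setoid setoid
  open NatSolver commutativeSemiring using (solve; _:+_; _:*_; _:=_)

  falling : ℕ → Carrier → Carrier
  falling zero    x = 1#
  falling (suc a) x = (x - ι a) * falling a x

  fallingPoly : ∀ {n} → Exponent n → Polynomial n
  fallingPoly []          = one
  fallingPoly (zero  ∷ η) = mapExp (0 ∷_) (fallingPoly η)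
  fallingPoly (suc a ∷ η) = mapExp raiseHead (fallingPoly (a ∷ η)) ++ (- ι a) · fallingPoly (a ∷ η)

  eval-fallingPoly : ∀ {n} a (η : Exponent n) x xs →
    eval (fallingPoly (a ∷ η)) (x ∷ xs) ≈ falling a x * eval (fallingPoly η) xs
  eval-fallingPoly zero    η x xs = trans (reflexive (lin-mapExp (mono (x ∷ xs)) (0 ∷_) (fallingPoly η)))
    (trans (lin-cong (λ γ → *-identityˡ _) (fallingPoly η)) (sym (*-identityˡ _)))
  eval-fallingPoly (suc a) η x xs = begin
    eval (mapExp raiseHead p ++ (- ι a) · p) y  ≈⟨ lin-++ (mono y) (mapExp raiseHead p) _ ⟩
    eval (mapExp raiseHead p) y + eval ((- ι a) · p) y
      ≈⟨ +-cong eval-raised (lin-· (mono y) (- ι a) p) ⟩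
    x * eval p y + (- ι a) * eval p y  ≈⟨ distribʳ (eval p y) x (- ι a) ⟨
    (x - ι a) * eval p y  ≈⟨ *-congˡ (eval-fallingPoly a η x xs) ⟩
    (x - ι a) * (falling a x * eval (fallingPoly η) xs)  ≈⟨ *-assoc _ _ _ ⟨
    falling (suc a) x * eval (fallingPoly η) xs ∎
    where
    p = fallingPoly (a ∷ η)
    y = x ∷ xs
    eval-raised : eval (mapExp raiseHead p) y ≈ x * eval p y
    eval-raised = trans (reflexive (lin-mapExp (mono y) raiseHead p))
      (trans (lin-cong (λ { (k ∷ γ) → *-assoc _ _ _ }) p) (lin-* (mono y) x p))

  -- `fallingPoly` multiplies by x - a term by term, raised terms first, so that x^η stays literally
  -- at the head of the list. Degree and leading coefficient can then be read off after rewriting.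
  fallingPoly-leading : ∀ {n} (η : Exponent n) →
    ∃ λ q → fallingPoly η ≡ (η , 1#) ∷ q × All (λ t → sum (proj₁ t) ℕ.< sum η) q
  fallingPoly-leading []          = [] , ≡.refl , []
  fallingPoly-leading (zero  ∷ η) with fallingPoly-leading η
  ... | q , e , lower = mapExp (0 ∷_) q , cong (mapExp (0 ∷_)) e , AllP.map⁺ lower
  fallingPoly-leading (suc a ∷ η) with fallingPoly-leading (a ∷ η)
  ... | q , e , lower =
    mapExp raiseHead q ++ (- ι a) · ((a ∷ η , 1#) ∷ q) ,
    cong (λ p → mapExp raiseHead p ++ (- ι a) · p) e ,
    AllP.++⁺ (AllP.map⁺ (All.map (λ { {k ∷ γ , _} l → s≤s l }) lower))
             (ℕP.≤-refl ∷ AllP.map⁺ (All.map ℕP.m<n⇒m<1+n lower))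

  degree-fallingPoly : ∀ {n} (η : Exponent n) → Degree≤ (sum η) (fallingPoly η)
  degree-fallingPoly η with fallingPoly-leading η
  ... | q , e , lower rewrite e = ℕP.≤-refl ∷ All.map ℕP.<⇒≤ lower

  coeff-fallingPoly : ∀ {n} (η : Exponent n) → coeff (fallingPoly η) η ≈ 1#
  coeff-fallingPoly η with fallingPoly-leading η
  ... | q , e , lower rewrite e = begin
    1# * δ η η + coeff q η
      ≈⟨ +-cong (trans (*-identityˡ _) (reflexive (δ-≡ {γ = η} ≡.refl)))
           (coeff-absent {P = λ γ → sum γ ℕ.< sum η} (ℕP.<-irrefl ≡.refl) lower) ⟩
    1# + 0#  ≈⟨ +-identityʳ 1# ⟩
    1# ∎

  -- One of the factors is x - a, and at the given point it equals `ρ * ι k`.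
  falling-divisible : ∀ {a b} → a ℕ.< b → ∀ k → ∃ λ u → falling b (ι a + ρ * ι k) ≈ ρ * u
  falling-divisible {a} {suc b} (s≤s a≤b) k with ℕP.m≤n⇒m<n∨m≡n a≤b
  ... | inj₁ a<b with falling-divisible a<b k
  ...   | u , e = (x - ι b) * u , trans (*-congˡ e) (solve 3 (λ y r u → y :* (r :* u) := r :* (y :* u)) refl (x - ι b) ρ u)
    where x = ι a + ρ * ι k
  falling-divisible {a} {suc b} (s≤s a≤b) k | inj₂ ≡.refl = ι k * falling a x , (begin
    (ι a + ρ * ι k - ι a) * falling a x
      ≈⟨ *-congʳ (solve 3 (λ a r m → a :+ r :+ m := r :+ (a :+ m)) refl (ι a) (ρ * ι k) (- ι a)) ⟩
    (ρ * ι k + (ι a - ι a)) * falling a x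
      ≈⟨ *-congʳ (trans (+-congˡ (-‿inverseʳ (ι a))) (+-identityʳ _)) ⟩
    ρ * ι k * falling a x  ≈⟨ *-assoc ρ (ι k) _ ⟩
    ρ * (ι k * falling a x) ∎)
    where x = ι a + ρ * ι k

  -- Modulo ρ the point bar γ is γ itself, where the falling factorial of η vanishes.
  fallingPoly-divisible : ∀ {n} (γ κ η : Exponent n) → sum γ ℕ.≤ sum η → γ ≢ η →
    ∃ λ u → eval (fallingPoly η) (point γ κ) ≈ ρ * u
  fallingPoly-divisible []      []      []      l ne = contradiction ≡.refl ne
  fallingPoly-divisible (a ∷ γ) (k ∷ κ) (b ∷ η) l ne with a ℕP.<? b
  ... | yes a<b = let u , e = falling-divisible a<b k in
          u * eval (fallingPoly η) (point γ κ) ,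
          trans (eval-fallingPoly b η _ _) (trans (*-congʳ e) (*-assoc ρ u _))
  -- An entry that does not fall below `b` uses at least its share of the sum. The remaining entries
  -- thus satisfy the same inequality, and they cannot all agree with `η`, since then a = b as well.
  ... | no a≮b = let u , e = fallingPoly-divisible γ κ η γ≤η γ≢η in
          falling b (ι a + ρ * ι k) * u ,
          trans (eval-fallingPoly b η _ _) (trans (*-congˡ e)
            (solve 3 (λ f r u → f :* (r :* u) := r :* (f :* u)) refl (falling b (ι a + ρ * ι k)) ρ u))
    where
    b≤a : b ℕ.≤ a
    b≤a = ℕP.≮⇒≥ a≮b
    γ≤η : sum γ ℕ.≤ sum η
    γ≤η = ℕP.+-cancelˡ-≤ b _ _ (ℕP.≤-trans (ℕP.+-monoˡ-≤ (sum γ) b≤a) l)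
    γ≢η : γ ≢ η
    γ≢η ≡.refl = ne (cong (_∷ γ) (ℕP.≤-antisym (ℕP.+-cancelʳ-≤ (sum γ) a b l) b≤a))

  -- Since fallingPoly η ≡ 0 (mod ρ) at the other nodes, correcting it there
  -- changes its coefficients by multiples of ρ only.
  interpolationPoly : (∀ x → ∃ λ y → (1# - ρ * x) * y ≈ 1#) → ∀ {n} (η : Exponent n) → InterpolationPoly η
  interpolationPoly 1-ρx-invertible {n} η = record
    { E = y · e ; degree-E = degree-· y degree-e
    ; vanishing-E = λ γ l ne → trans (lin-· (mono (bar γ)) y e) (trans (*-congˡ (vanishing-e γ l ne)) (zeroʳ y))
    ; monic-E = monic
    -- By uniqueness `y · e` is `z` times the polynomial with values `δ η` at the nodes. Comparing
    -- coefficients of x^η gives 1 on the left, so the coefficient of that polynomial is an inverse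
    -- of the value `z`.
    ; invertible-E = coeff (poly basis) η , (begin
        z * coeff (poly basis) η  ≈⟨ lin-· (δ η) z (poly basis) ⟨
        coeff (z · poly basis) η  ≈⟨ coeff≈ basis-multiple η ⟨
        coeff (y · e) η  ≈⟨ monic ⟩
        1# ∎) }
    where
    -- The quotient of the value of `fallingPoly η` by `ρ`. At `η` itself the default `0#` is an
    -- arbitrary choice, as `e` has to vanish only at the other nodes.
    value : ∀ γ → Dec (γ ≡ η) → Dec (sum γ ℕ.≤ sum η) → Carrier
    value γ (no γ≢η) (yes l) = proj₁ (fallingPoly-divisible γ _ η l γ≢η)
    value γ _        _       = 0#
    correction : Interpolant n (sum η) (λ γ → value γ (γ ≟ᵉ η) (sum γ ℕP.≤? sum η))
    correction = interpolate n (sum η) _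
    h = poly correction
    e = fallingPoly η ⊖ ρ · h
    degree-e : Degree≤ (sum η) e
    degree-e = degree-⊖ (degree-fallingPoly η) (degree-· ρ (degree correction))
    vanishing-e : ∀ γ → sum γ ℕ.≤ sum η → γ ≢ η → eval e (bar γ) ≈ 0#
    vanishing-e γ l ne = trans (lin-⊖ (mono (bar γ)) (fallingPoly η) (ρ · h))
      (x-x≈0 (trans same (sym (trans (lin-· (mono (bar γ)) ρ h) (*-congˡ (eval-poly correction γ l))))))
      where
      same : eval (fallingPoly η) (bar γ) ≈ ρ * value γ (γ ≟ᵉ η) (sum γ ℕP.≤? sum η)
      same with γ ≟ᵉ η | sum γ ℕP.≤? sum η
      ... | yes x | _     = contradiction x ne
      ... | no x  | yes l = proj₂ (fallingPoly-divisible γ _ η l x)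
      ... | no x  | no ¬l = contradiction l ¬l
    y = proj₁ (1-ρx-invertible (coeff h η))
    monic : coeff (y · e) η ≈ 1#
    monic = begin
      coeff (y · e) η  ≈⟨ lin-· (δ η) y e ⟩
      y * coeff e η
        ≈⟨ *-congˡ (lin-⊖ (δ η) (fallingPoly η) (ρ · h)) ⟩
      y * (coeff (fallingPoly η) η - coeff (ρ · h) η)
        ≈⟨ *-congˡ (+-cong (coeff-fallingPoly η) (-‿cong (lin-· (δ η) ρ h))) ⟩
      y * (1# - ρ * coeff h η)  ≈⟨ *-comm _ _ ⟩
      (1# - ρ * coeff h η) * y
        ≈⟨ proj₂ (1-ρx-invertible (coeff h η)) ⟩
      1# ∎
    basis : Interpolant n (sum η) (δ η)
    basis = interpolate n (sum η) (δ η)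
    z = eval (y · e) (bar η)
    basis-multiple : y · e ≋ z · poly basis
    basis-multiple = ⊖-null⇒≋ (vanishing⇒null n (sum η) _
      (degree-⊖ (degree-· y degree-e) (degree-· z (degree basis))) λ γ l →
        trans (lin-⊖ (mono (bar γ)) (y · e) (z · poly basis))
          (x-x≈0 (trans (agree γ l (γ ≟ᵉ η))
            (sym (trans (lin-· (mono (bar γ)) z (poly basis)) (*-congˡ (eval-poly basis γ l)))))))
      where
      agree : ∀ γ → sum γ ℕ.≤ sum η → Dec (γ ≡ η) → eval (y · e) (bar γ) ≈ z * δ η γ
      agree γ l (yes ≡.refl) = sym (trans (*-congˡ (reflexive (δ-≡ {γ = γ} ≡.refl))) (*-identityʳ z))
      agree γ l (no ne) = trans (lin-· (mono (bar γ)) y e)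
        (trans (*-congˡ (vanishing-e γ l ne)) (trans (zeroʳ y)
          (sym (trans (*-congˡ (reflexive (δ-≢ {γ = γ} ne))) (zeroʳ z)))))

-- Transport of interpolation polynomials along a ring homomorphism

module BaseChange {a b c d} (K : CommutativeRing a b) (L : CommutativeRing c d)
  (f : CommutativeRing.Carrier K → CommutativeRing.Carrier L)
  (hom : IsRingHomomorphism (CommutativeRing.rawRing K) (CommutativeRing.rawRing L) f) where
  private
    module K  = CommutativeRing K
    module L′ = CommutativeRing L
    module IK = Interpolation K
    module IL = Interpolation L
  open IsRingHomomorphism hom
  open import Algebra.Properties.Semiring.Exp K.semiring using () renaming (_^_ to _^ᴷ_)
  open import Algebra.Properties.Semiring.Exp L′.semiring using () renaming (_^_ to _^ᴸ_)

  f-ι : ∀ k → f (IK.ι k) L′.≈ IL.ι k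
  f-ι zero    = 0#-homo
  f-ι (suc k) = L′.trans (+-homo K.1# (IK.ι k)) (L′.+-cong 1#-homo (f-ι k))

  f-^ : ∀ x k → f (x ^ᴷ k) L′.≈ (f x ^ᴸ k)
  f-^ x zero    = 1#-homo
  f-^ x (suc k) = L′.trans (*-homo x (x ^ᴷ k)) (L′.*-congˡ (f-^ x k))

  f-mono : ∀ {n} (x : Vec K.Carrier n) γ → f (IK.mono x γ) L′.≈ IL.mono (V.map f x) γ
  f-mono []       []      = 1#-homo
  f-mono (x ∷ xs) (k ∷ γ) = L′.trans (*-homo _ _) (L′.*-cong (f-^ x k) (f-mono xs γ))

  f-δ : ∀ {n} (η γ : Vec ℕ n) → f (IK.δ η γ) L′.≈ IL.δ η γ
  f-δ η γ with does (γ IK.≟ᵉ η)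
  ... | true  = 1#-homo
  ... | false = 0#-homo

  mapCoeffs : ∀ {n} → IK.Polynomial n → IL.Polynomial n
  mapCoeffs = L.map (λ t → proj₁ t , f (proj₂ t))

  f-lin : ∀ {n} {φ : Vec ℕ n → K.Carrier} {ψ} → (∀ γ → f (φ γ) L′.≈ ψ γ) → ∀ p → f (IK.lin φ p) L′.≈ IL.lin ψ (mapCoeffs p)
  f-lin e []            = 0#-homo
  f-lin e ((γ , x) ∷ p) = L′.trans (+-homo _ _) (L′.+-cong (L′.trans (*-homo _ _) (L′.*-congˡ (e γ))) (f-lin e p))

  module _ (ρ : K.Carrier) where
    private
      module PK = IK.Points ρ
      module PL = IL.Points (f ρ)

    f-bar : ∀ {n} (γ : Vec ℕ n) → V.map f (PK.bar γ) IL.≈ᵛ PL.bar γ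
    f-bar γ = points γ _
      where
      points : ∀ {n} (γ κ : Vec ℕ n) → V.map f (PK.point γ κ) IL.≈ᵛ PL.point γ κ
      points []      []      = []
      points (a ∷ γ) (k ∷ κ) = L′.trans (+-homo _ _) (L′.+-cong (f-ι a) (L′.trans (*-homo _ _) (L′.*-congˡ (f-ι k)))) ∷ points γ κ

    f-eval-bar : ∀ {n} (p : IK.Polynomial n) γ → f (IK.eval p (PK.bar γ)) L′.≈ IL.eval (mapCoeffs p) (PL.bar γ)
    f-eval-bar p γ = L′.trans (f-lin (f-mono (PK.bar γ)) p) (IL.eval-cong (mapCoeffs p) (f-bar γ))

    mapInterpolationPoly : ∀ {n} {η : Vec ℕ n} → PK.InterpolationPoly η → PL.InterpolationPoly η
    mapInterpolationPoly {η = η} P = record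
      { E            = mapCoeffs (PK.E P)
      ; degree-E     = AllP.map⁺ (PK.degree-E P)
      ; vanishing-E  = λ γ l ne → L′.trans (L′.sym (f-eval-bar (PK.E P) γ)) (L′.trans (⟦⟧-cong (PK.vanishing-E P γ l ne)) 0#-homo)
      ; monic-E      = L′.trans (L′.sym (f-lin (f-δ η) (PK.E P))) (L′.trans (⟦⟧-cong (PK.monic-E P)) 1#-homo)
      ; invertible-E = f y , L′.trans (L′.*-congʳ (L′.sym (f-eval-bar (PK.E P) η)))
                         (L′.trans (L′.sym (*-homo _ _)) (L′.trans (⟦⟧-cong e) 1#-homo)) }
      where
      y = proj₁ (PK.invertible-E P)
      e = proj₂ (PK.invertible-E P)

-- Identities and inverses in commutative rings

module RingIdentities {c ℓ} (K : CommutativeRing c ℓ) where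
  open CommutativeRing K

  ZeroOrInvertible : Set (c ⊔ ℓ)
  ZeroOrInvertible = ∀ x → x ≈ 0# ⊎ ∃ λ y → x * y ≈ 1#
  open NatSolver commutativeSemiring using (solve; _:+_; _:*_; _:=_)

  sum-fraction : ∀ x y u v → (x + y) * (u * v) ≈ x * u * v + y * v * u
  sum-fraction = solve 4 (λ x y u v → (x :+ y) :* (u :* v) := (x :* u) :* v :+ (y :* v) :* u) refl

  *-interchange : ∀ x y u v → x * y * (u * v) ≈ x * u * (y * v)
  *-interchange = solve 4 (λ x y u v → x :* y :* (u :* v) := (x :* u) :* (y :* v)) refl

  *-regroup : ∀ y c x q → y * (c * (x * q)) ≈ x * y * (c * q)
  *-regroup = solve 4 (λ y c x q → y :* (c :* (x :* q)) := (x :* y) :* (c :* q)) refl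

  -- Because α r = 1, the sum α A + B is α (A + r B), whose inverse is r y. This relates the box
  -- factors of d_η to the coordinates of nodes.
  common-denominator : ∀ {α r A B y} → α * r ≈ 1# → (A + r * B) * y ≈ 1# → (α * A + B) * (r * y) ≈ 1#
  common-denominator {α} {r} {A} {B} {y} αr e = begin
    (α * A + B) * (r * y)
      ≈⟨ solve 5 (λ α r A B y → (α :* A :+ B) :* (r :* y) := (α :* r) :* (A :* y) :+ r :* B :* y) refl α r A B y ⟩
    α * r * (A * y) + r * B * y  ≈⟨ +-congʳ (trans (*-congʳ αr) (*-identityˡ _)) ⟩
    A * y + r * B * y  ≈⟨ distribʳ y A (r * B) ⟨
    (A + r * B) * y  ≈⟨ e ⟩
    1# ∎
    where open import Relation.Binary.Reasoning.Setoid setoid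

  product-invertible : ∀ {x y x′ y′} → x * y ≈ 1# → x′ * y′ ≈ 1# → x * x′ * (y * y′) ≈ 1#
  product-invertible {x} {y} {x′} {y′} e e′ = trans (*-interchange x x′ y y′) (trans (*-cong e e′) (*-identityˡ 1#))

-- Sorting permutations

module SortingPermutations where
  module ∑ = Algebra.Properties.CommutativeMonoid.Sum ℕP.+-0-commutativeMonoid
  open ∑ using () renaming (sum to ∑)

  ind : ∀ {P : Set} → Dec P → ℕ
  ind p = if does p then 1 else 0

  ind-⇔ : ∀ {P Q : Set} → (P → Q) → (Q → P) → (p : Dec P) (q : Dec Q) → ind p ≡ ind q
  ind-⇔ f g (yes _)  (yes _)  = ≡.refl
  ind-⇔ f g (no _)   (no _)   = ≡.refl
  ind-⇔ f g (yes p)  (no ¬q)  = contradiction (f p) ¬q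
  ind-⇔ f g (no ¬p)  (yes q)  = contradiction (g q) ¬p

  ind-no : ∀ {P : Set} → ¬ P → (p : Dec P) → ind p ≡ 0
  ind-no ¬p (yes p) = contradiction p ¬p
  ind-no ¬p (no _)  = ≡.refl

  ind-yes : ∀ {P : Set} → P → (p : Dec P) → ind p ≡ 1
  ind-yes p (yes _) = ≡.refl
  ind-yes p (no ¬p) = contradiction p ¬p

  ind-≤ : ∀ {P Q : Set} → (P → Q) → (p : Dec P) (q : Dec Q) → ind p ℕ.≤ ind q
  ind-≤ f (yes p) q      = ℕP.≤-reflexive (≡.sym (ind-yes (f p) q))
  ind-≤ f (no _)  q      = z≤n

  ind-≡⇒ : ∀ {P Q : Set} (p : Dec P) (q : Dec Q) → ind p ≡ ind q → P → Q
  ind-≡⇒ (yes _) (yes q) e p = q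
  ind-≡⇒ (no ¬p) _       e p = contradiction p ¬p

  [≤]≡ind : ∀ a b (p : Dec (a ℕ.≤ b)) → [ a ≤ b ] ≡ ind p
  [≤]≡ind zero    b       p = ≡.sym (ind-yes z≤n p)
  [≤]≡ind (suc a) zero    p = ≡.sym (ind-no (λ ()) p)
  [≤]≡ind (suc a) (suc b) p = ≡.trans ([≤]≡ind a b (a ℕP.≤? b)) (ind-⇔ s≤s ℕP.≤-pred (a ℕP.≤? b) p)

  ∑-mono : ∀ {n} {f g : Fin n → ℕ} → (∀ i → f i ℕ.≤ g i) → ∑ f ℕ.≤ ∑ g
  ∑-mono {zero}  le = z≤n
  ∑-mono {suc n} le = ℕP.+-mono-≤ (le zero) (∑-mono (le ∘ suc))

  ∑-mono-< : ∀ {n} {f g : Fin n → ℕ} → (∀ i → f i ℕ.≤ g i) → ∀ i → f i ℕ.< g i → ∑ f ℕ.< ∑ g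
  ∑-mono-< le zero    lt = ℕP.+-mono-<-≤ lt (∑-mono (le ∘ suc))
  ∑-mono-< le (suc i) lt = ℕP.+-mono-≤-< (le zero) (∑-mono-< (le ∘ suc) i lt)

  ∑-mono-≡ : ∀ {n} {f g : Fin n → ℕ} → (∀ i → f i ℕ.≤ g i) → ∑ g ℕ.≤ ∑ f → ∀ i → f i ≡ g i
  ∑-mono-≡ {f = f} {g} le ge i with ℕP.m≤n⇒m<n∨m≡n (le i)
  ... | inj₁ lt = contradiction ge (ℕP.<⇒≱ (∑-mono-< le i lt))
  ... | inj₂ e  = e

  ∑-const-1 : ∀ n → ∑ {n} (const 1) ≡ n
  ∑-const-1 zero    = ≡.refl
  ∑-const-1 (suc n) = cong suc (∑-const-1 n)

  ∑-cong : ∀ {n} {f g : Fin n → ℕ} → (∀ i → f i ≡ g i) → ∑ f ≡ ∑ g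
  ∑-cong = ∑.sum-cong-≗

  ∑-above : ∀ {n} (i : Fin n) → ∑ {n} (λ j → ind (i FinP.<? j)) ≡ n ∸ suc (toℕ i)
  ∑-above {suc n} zero    = ∑-const-1 n
  ∑-above {suc n} (suc i) = ≡.trans (∑-cong {n} (λ j → ind-⇔ (λ { (s≤s l) → l }) s≤s (suc i FinP.<? suc j) (i FinP.<? j))) (∑-above {n} i)

  vec-sum : ∀ {n} (γ : Vec ℕ n) → V.sum γ ≡ ∑ (lookup γ)
  vec-sum []      = ≡.refl
  vec-sum (a ∷ γ) = cong (a ℕ.+_) (vec-sum γ)

  Loses : ∀ {n} → Vec ℕ n → Fin n → Fin n → Set
  Loses γ i k = lookup γ k ℕ.< lookup γ i ⊎ (lookup γ k ≡ lookup γ i × i Fin.< k)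

  -- Loses γ i k: in the sorted rearrangement of γ, entry k is placed after entry i.
  loses? : ∀ {n} (γ : Vec ℕ n) i k → Dec (Loses γ i k)
  loses? γ i k = (lookup γ k ℕP.<? lookup γ i) ⊎-dec ((lookup γ k ℕP.≟ lookup γ i) ×-dec (i FinP.<? k))

  module _ {n} (γ : Vec ℕ n) where
    loses-trans : ∀ {i j k} → Loses γ i j → Loses γ j k → Loses γ i k
    loses-trans (inj₁ a)       (inj₁ b)       = inj₁ (ℕP.<-trans b a)
    loses-trans (inj₁ a)       (inj₂ (b , _)) = inj₁ (≡.subst (ℕ._< _) (≡.sym b) a)
    loses-trans (inj₂ (a , _)) (inj₁ b)       = inj₁ (≡.subst (_ ℕ.<_) a b)
    loses-trans (inj₂ (a , l)) (inj₂ (b , m)) = inj₂ (≡.trans b a , ℕP.<-trans l m)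

    loses-irrefl : ∀ {i} → ¬ Loses γ i i
    loses-irrefl (inj₁ a)       = ℕP.<-irrefl ≡.refl a
    loses-irrefl (inj₂ (_ , l)) = ℕP.<-irrefl ≡.refl l

    loses-total : ∀ {i k} → i ≢ k → Loses γ i k ⊎ Loses γ k i
    loses-total {i} {k} ne with ℕP.<-cmp (lookup γ k) (lookup γ i)
    ... | tri< a _ _ = inj₁ (inj₁ a)
    ... | tri> _ _ a = inj₂ (inj₁ a)
    ... | tri≈ _ e _ with FinP.<-cmp i k
    ...   | tri< l _ _ = inj₁ (inj₂ (e , l))
    ...   | tri> _ _ l = inj₂ (inj₂ (≡.sym e , l))
    ...   | tri≈ _ x _ = contradiction x ne

    rank : Fin n → ℕ
    rank i = ∑ (λ k → ind (loses? γ i k))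

    rank-< : ∀ i → rank i ℕ.< n
    rank-< i = ≡.subst (rank i ℕ.<_) (∑-const-1 n) (∑-mono-< (λ k → ≤1 (loses? γ i k)) i
      (≡.subst (ℕ._< 1) (≡.sym (ind-no loses-irrefl (loses? γ i i))) (s≤s z≤n)))
      where
      ≤1 : ∀ {P : Set} (p : Dec P) → ind p ℕ.≤ 1
      ≤1 (yes _) = ℕP.≤-refl
      ≤1 (no _)  = z≤n

    rank-mono : ∀ {i k} → Loses γ i k → rank k ℕ.< rank i
    rank-mono {i} {k} l = ∑-mono-< (λ j → ind-≤ (loses-trans l) (loses? γ k j) (loses? γ i j)) k
      (≡.subst₂ ℕ._<_ (≡.sym (ind-no loses-irrefl (loses? γ k k))) (≡.sym (ind-yes l (loses? γ i k))) (s≤s z≤n))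

  -- The induction needs arbitrary `f`: stepping past the head `a` moves its contribution
  -- `[ suc a ≤ b ]` into `f`, while `rank` of the whole vector counts the head as one of the
  -- indices.
  ranks-lookup : ∀ {n} f (γ : Vec ℕ n) i → lookup (ranks f γ) i ≡ f (lookup γ i) ℕ.+ rank γ i
  ranks-lookup {suc n} f (a ∷ γ) zero = cong (f a ℕ.+_) (begin
    #≤ a γ  ≡⟨ #≤-∑ γ ⟩
    ∑ {n} (λ k → ind (lookup γ k ℕP.≤? a))
      ≡⟨ ∑-cong {n} (λ k → ind-⇔ (λ le → ≤⇒loses k (ℕP.m≤n⇒m<n∨m≡n le)) loses⇒≤
           (lookup γ k ℕP.≤? a) (loses? (a ∷ γ) zero (suc k))) ⟩
    ∑ {n} (λ k → ind (loses? (a ∷ γ) zero (suc k)))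
      ≡⟨ cong (ℕ._+ ∑ {n} (λ k → ind (loses? (a ∷ γ) zero (suc k))))
           (ind-no (loses-irrefl (a ∷ γ) {zero}) (loses? (a ∷ γ) zero zero)) ⟨
    rank (a ∷ γ) zero ∎)
    where
    open ≡.≡-Reasoning
    ≤⇒loses : ∀ k → lookup γ k ℕ.< a ⊎ lookup γ k ≡ a → Loses (a ∷ γ) zero (suc k)
    ≤⇒loses k (inj₁ l) = inj₁ l
    ≤⇒loses k (inj₂ e) = inj₂ (e , s≤s z≤n)
    loses⇒≤ : ∀ {k} → Loses (a ∷ γ) zero (suc k) → lookup γ k ℕ.≤ a
    loses⇒≤ (inj₁ l)       = ℕP.<⇒≤ l
    loses⇒≤ (inj₂ (e , _)) = ℕP.≤-reflexive e
    #≤-∑ : ∀ {n} (γ : Vec ℕ n) → #≤ a γ ≡ ∑ (λ k → ind (lookup γ k ℕP.≤? a))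
    #≤-∑ []      = ≡.refl
    #≤-∑ (b ∷ γ) = cong₂ ℕ._+_ ([≤]≡ind b a (b ℕP.≤? a)) (#≤-∑ γ)
  ranks-lookup f (a ∷ γ) (suc i) = ≡.trans (ranks-lookup (λ b → [ suc a ≤ b ] ℕ.+ f b) γ i)
    (≡.trans (move [ suc a ≤ b ] (f b) (rank γ i)) (cong (f b ℕ.+_) (cong₂ ℕ._+_
      (≡.trans ([≤]≡ind (suc a) b (suc a ℕP.≤? b))
        (ind-⇔ inj₁ (λ { (inj₁ l) → l ; (inj₂ (_ , ())) }) (suc a ℕP.≤? b) (loses? (a ∷ γ) (suc i) zero)))
      (∑-cong λ k → ind-⇔ (λ { (inj₁ l) → inj₁ l ; (inj₂ (e , l)) → inj₂ (e , s≤s l) })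
                          (λ { (inj₁ l) → inj₁ l ; (inj₂ (e , s≤s l)) → inj₂ (e , l) })
                          (loses? γ i k) (loses? (a ∷ γ) (suc i) (suc k))))))
    where
    b = lookup γ i
    move : ∀ x y z → x ℕ.+ y ℕ.+ z ≡ y ℕ.+ (x ℕ.+ z)
    move x y z = ≡.trans (cong (ℕ._+ z) (ℕP.+-comm x y)) (ℕP.+-assoc y x z)

  -- Characterises the minimal sorting permutation w = w_γ.
  Orders : ∀ {n} → Permutation′ n → Vec ℕ n → Set
  Orders w γ = ∀ i k → ((w ⟨$⟩ˡ i) Fin.< (w ⟨$⟩ˡ k) → Loses γ i k) × (Loses γ i k → (w ⟨$⟩ˡ i) Fin.< (w ⟨$⟩ˡ k))

  -- The entry of δ at a position counts the positions after it. Reindexed along `w`, the positions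
  -- after that of `i` are the indices `k` with `Loses γ i k`.
  orders⇒rank : ∀ {n} (w : Permutation′ n) γ → Orders w γ → ∀ i → n ∸ suc (toℕ (w ⟨$⟩ˡ i)) ≡ lookup (ranks (const 0) γ) i
  orders⇒rank {n} w γ o i = begin
    n ∸ suc (toℕ (w ⟨$⟩ˡ i))  ≡⟨ ∑-above {n} (w ⟨$⟩ˡ i) ⟨
    ∑ {n} (λ j → ind ((w ⟨$⟩ˡ i) FinP.<? j))
      ≡⟨ ∑.sum-permute (λ j → ind ((w ⟨$⟩ˡ i) FinP.<? j)) (flip w) ⟩
    ∑ {n} (λ k → ind ((w ⟨$⟩ˡ i) FinP.<? (w ⟨$⟩ˡ k)))
      ≡⟨ ∑-cong {n} (λ k → ind-⇔ (proj₁ (o i k)) (proj₂ (o i k)) ((w ⟨$⟩ˡ i) FinP.<? (w ⟨$⟩ˡ k)) (loses? γ i k)) ⟩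
    rank γ i  ≡⟨ ranks-lookup (const 0) γ i ⟨
    lookup (ranks (const 0) γ) i ∎
    where open ≡.≡-Reasoning

  orders⇒partition : ∀ {n} (w : Permutation′ n) γ → Orders w γ → IsPartition (actInv w γ)
  orders⇒partition w γ o i j i≤j
    rewrite VP.lookup∘tabulate (λ j → lookup γ (w ⟨$⟩ʳ j)) i | VP.lookup∘tabulate (λ j → lookup γ (w ⟨$⟩ʳ j)) j
    with ℕP.m≤n⇒m<n∨m≡n i≤j
  ... | inj₂ e = ℕP.≤-reflexive (cong (λ i → lookup γ (w ⟨$⟩ʳ i)) (≡.sym (FinP.toℕ-injective e)))
  ... | inj₁ l with proj₁ (o (w ⟨$⟩ʳ i) (w ⟨$⟩ʳ j)) (≡.subst₂ Fin._<_ (≡.sym (inverseˡ w)) (≡.sym (inverseˡ w)) l)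
  ...   | inj₁ x       = ℕP.<⇒≤ x
  ...   | inj₂ (e , _) = ℕP.≤-reflexive e

  -- A missed value could be punched out of the codomain, leaving an injection into a smaller `Fin`.
  injective⇒surjective : ∀ {n} (f : Fin n → Fin n) → (∀ {i j} → f i ≡ f j → i ≡ j) → ∀ j → ∃ λ i → f i ≡ j
  injective⇒surjective {suc n} f inj j with FinP.any? (λ i → f i FinP.≟ j)
  ... | yes found = found
  ... | no ¬found = contradiction
          (λ {a} {b} e → inj (FinP.punchOut-injective (λ x → ¬found (a , ≡.sym x)) (λ x → ¬found (b , ≡.sym x)) e))
          (FinP.<⇒notInjective {f = λ i → Fin.punchOut {i = j} {j = f i} (λ x → ¬found (i , ≡.sym x))} ℕP.≤-refl)

  module _ {n} (γ : Vec ℕ n) where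
    position : Fin n → Fin n
    -- `rank` counts the entries placed after `i`, whereas a position counts those before it.
    position i = Fin.opposite (Fin.fromℕ< (rank-< γ i))

    position-< : ∀ {i k} → Loses γ i k → position i Fin.< position k
    position-< {i} {k} l = ≡.subst₂ ℕ._<_ (≡.sym (FinP.opposite-prop (Fin.fromℕ< (rank-< γ i)))) (≡.sym (FinP.opposite-prop (Fin.fromℕ< (rank-< γ k))))
      (ℕP.∸-monoʳ-< (s≤s (≡.subst₂ ℕ._<_ (≡.sym (FinP.toℕ-fromℕ< (rank-< γ k))) (≡.sym (FinP.toℕ-fromℕ< (rank-< γ i))) (rank-mono γ l)))
        (FinP.toℕ<n (Fin.fromℕ< (rank-< γ i))))

    position-injective : ∀ {i k} → position i ≡ position k → i ≡ k
    position-injective {i} {k} e with i FinP.≟ k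
    ... | yes x = x
    ... | no ne with loses-total γ ne
    ...   | inj₁ l = contradiction (≡.subst (position i Fin.<_) (≡.sym e) (position-< l)) (ℕP.<-irrefl ≡.refl)
    ...   | inj₂ l = contradiction (≡.subst (position k Fin.<_) e (position-< l)) (ℕP.<-irrefl ≡.refl)

    sortPerm : Permutation′ n
    sortPerm = permutation (proj₁ ∘ surj) position
      (λ i → position-injective (proj₂ (surj (position i)))) (λ j → proj₂ (surj j))
      where surj = injective⇒surjective position position-injective

    sortPerm-orders : Orders sortPerm γ
    sortPerm-orders i k = to , position-<
      where
      to : position i Fin.< position k → Loses γ i k
      to lt with i FinP.≟ k
      ... | yes ≡.refl = contradiction lt (ℕP.<-irrefl ≡.refl)
      ... | no ne with loses-total γ ne
      ...   | inj₁ l = l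
      ...   | inj₂ l = contradiction lt (ℕP.<-asym (position-< l))

  filter-tabulate : ∀ {A : Set} {P : A → Set} (P? : ∀ x → Dec (P x)) n (g : Fin n → A) →
    length (L.filter P? (L.tabulate g)) ≡ ∑ (λ i → ind (P? (g i)))
  filter-tabulate P? zero    g = ≡.refl
  filter-tabulate P? (suc n) g with P? (g zero)
  ... | yes _ = cong suc (filter-tabulate P? n (g ∘ suc))
  ... | no _  = filter-tabulate P? n (g ∘ suc)

  filter-concatMap : ∀ {A B : Set} {P : A → Set} (P? : ∀ x → Dec (P x)) n (h : B → List A) (g : Fin n → B) →
    length (L.filter P? (L.concatMap h (L.tabulate g))) ≡ ∑ (λ i → length (L.filter P? (h (g i))))
  filter-concatMap P? zero    h g = ≡.refl
  filter-concatMap P? (suc n) h g = ≡.trans (cong length (LP.filter-++ P? (h (g zero)) _))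
    (≡.trans (LP.length-++ (L.filter P? (h (g zero)))) (cong (length (L.filter P? (h (g zero))) ℕ.+_) (filter-concatMap P? n h (g ∘ suc))))

  count-pairs : ∀ {n} {P : Fin n × Fin n → Set} (P? : ∀ x → Dec (P x)) →
    length (L.filter P? (L.concatMap (λ i → L.map (λ j → (i , j)) (L.allFin n)) (L.allFin n)))
    ≡ ∑ (λ i → ∑ (λ j → ind (P? (i , j))))
  count-pairs {n} P? = ≡.trans (filter-concatMap P? n _ id) (∑-cong λ i →
    ≡.trans (cong (length ∘ L.filter P?) (LP.map-tabulate id (i ,_))) (filter-tabulate P? n (i ,_)))

  -- Inversions are indexed by pairs of values of w, not of arguments: for a sorting permutation,
  -- those with distinct entries of γ are then forced, and only the ties are optional.
  inverted? : ∀ {n} (w : Permutation′ n) b a → Dec (a Fin.< b × (w ⟨$⟩ˡ b) Fin.< (w ⟨$⟩ˡ a))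
  inverted? w b a = (a FinP.<? b) ×-dec ((w ⟨$⟩ˡ b) FinP.<? (w ⟨$⟩ˡ a))

  invLength-∑ : ∀ {n} (w : Permutation′ n) → invLength w ≡ ∑ {n} (λ b → ∑ {n} (λ a → ind (inverted? w b a)))
  invLength-∑ {n} w = begin
    invLength w
      ≡⟨ count-pairs {n} (λ (i , j) → pair? i j) ⟩
    ∑ {n} (λ i → ∑ {n} (λ j → ind (pair? i j)))
      ≡⟨ ∑.sum-permute (λ i → ∑ {n} (λ j → ind (pair? i j))) (flip w) ⟩
    ∑ {n} (λ b → ∑ {n} (λ j → ind (pair? (w ⟨$⟩ˡ b) j)))
      ≡⟨ ∑-cong {n} (λ b → ∑.sum-permute (λ j → ind (pair? (w ⟨$⟩ˡ b) j)) (flip w)) ⟩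
    ∑ {n} (λ b → ∑ {n} (λ a → ind (pair? (w ⟨$⟩ˡ b) (w ⟨$⟩ˡ a))))
      ≡⟨ ∑-cong {n} (λ b → ∑-cong {n} (λ a → ind-⇔
           (λ (l , m) → ≡.subst₂ Fin._<_ (inverseʳ w) (inverseʳ w) m , l)
           (λ (m , l) → l , ≡.subst₂ Fin._<_ (≡.sym (inverseʳ w)) (≡.sym (inverseʳ w)) m)
           (pair? (w ⟨$⟩ˡ b) (w ⟨$⟩ˡ a)) (inverted? w b a))) ⟩
    ∑ {n} (λ b → ∑ {n} (λ a → ind (inverted? w b a))) ∎
    where
    open ≡.≡-Reasoning
    pair? : ∀ i j → Dec (i Fin.< j × (w ⟨$⟩ʳ j) Fin.< (w ⟨$⟩ʳ i))
    pair? i j = (i FinP.<? j) ×-dec ((w ⟨$⟩ʳ j) FinP.<? (w ⟨$⟩ʳ i))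

  -- Every inversion of the stable sorting permutation `c` comes from a strict inequality in γ, so
  -- it is also an inversion of `w`. As `w` has minimal length, the two inversion sets coincide, and
  -- the inversion set determines the relative order of any two indices (`agree`).
  minSort⇒orders : ∀ {n} (w : Permutation′ n) γ → IsMinSort w γ → Orders w γ
  minSort⇒orders {n} w γ (sorted , minimal) i k =
    (λ l → proj₁ (sortPerm-orders γ i k) (agree w c same (λ b a → proj₂ ∘ forced b a) i k l)) ,
    (λ l → agree c w (λ b a → proj₂ ∘ forced b a) same i k (proj₂ (sortPerm-orders γ i k) l))
    where
    c = sortPerm γ
    forced : ∀ b a → a Fin.< b × (c ⟨$⟩ˡ b) Fin.< (c ⟨$⟩ˡ a) → a Fin.< b × (w ⟨$⟩ˡ b) Fin.< (w ⟨$⟩ˡ a)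
    forced b a (a<b , l) with proj₁ (sortPerm-orders γ b a) l
    ... | inj₂ (_ , b<a) = contradiction b<a (ℕP.<-asym a<b)
    ... | inj₁ γa<γb = a<b , ℕP.≰⇒> λ le → ℕP.<⇒≱ γa<γb
          (≡.subst₂ ℕ._≤_ (lookup-sorted b) (lookup-sorted a) (sorted (w ⟨$⟩ˡ a) (w ⟨$⟩ˡ b) le))
      where
      lookup-sorted : ∀ b → lookup (actInv w γ) (w ⟨$⟩ˡ b) ≡ lookup γ b
      lookup-sorted b = ≡.trans (VP.lookup∘tabulate (λ j → lookup γ (w ⟨$⟩ʳ j)) (w ⟨$⟩ˡ b)) (cong (lookup γ) (inverseʳ w))
    pointwise-≤ : ∀ b a → ind (inverted? c b a) ℕ.≤ ind (inverted? w b a)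
    pointwise-≤ b a = ind-≤ (forced b a) (inverted? c b a) (inverted? w b a)
    equal : ∀ b a → ind (inverted? c b a) ≡ ind (inverted? w b a)
    -- Minimality bounds the double sum of `w` by that of `c`. Against the termwise inequality this
    -- forces equality, first of the rows and then of the entries in each row.
    equal b = ∑-mono-≡ (pointwise-≤ b) (ℕP.≤-reflexive (≡.sym
      (∑-mono-≡ (λ b → ∑-mono (pointwise-≤ b)) (≡.subst₂ ℕ._≤_ (invLength-∑ w) (invLength-∑ c)
        (minimal c (orders⇒partition c γ (sortPerm-orders γ)))) b)))
    same : ∀ b a → a Fin.< b × (w ⟨$⟩ˡ b) Fin.< (w ⟨$⟩ˡ a) → (c ⟨$⟩ˡ b) Fin.< (c ⟨$⟩ˡ a)
    same b a l = proj₂ (ind-≡⇒ (inverted? w b a) (inverted? c b a) (≡.sym (equal b a)) l)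
    Implies : Permutation′ n → Permutation′ n → Set
    Implies u v = ∀ b a → a Fin.< b × (u ⟨$⟩ˡ b) Fin.< (u ⟨$⟩ˡ a) → (v ⟨$⟩ˡ b) Fin.< (v ⟨$⟩ˡ a)
    agree : ∀ u v → Implies u v → Implies v u → ∀ i k → (u ⟨$⟩ˡ i) Fin.< (u ⟨$⟩ˡ k) → (v ⟨$⟩ˡ i) Fin.< (v ⟨$⟩ˡ k)
    agree u v uv vu i k l with FinP.<-cmp i k
    ... | tri> _ _ k<i = uv i k (k<i , l)
    ... | tri≈ _ ≡.refl _ = contradiction l (ℕP.<-irrefl ≡.refl)
    ... | tri< i<k i≢k _ with FinP.<-cmp (v ⟨$⟩ˡ i) (v ⟨$⟩ˡ k)
    ...   | tri< m _ _ = m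
    ...   | tri≈ _ e _ = contradiction (≡.trans (≡.sym (inverseʳ v)) (≡.trans (cong (v ⟨$⟩ʳ_) e) (inverseʳ v))) i≢k
    ...   | tri> _ _ m = contradiction (vu k i (i<k , m)) (ℕP.<-asym l)

-- Symmetric interpolation

module PermutationAction where
  open SortingPermutations
  open ∑ using () renaming (sum to ∑)

  module _ {a} {A : Set a} where
    lookup-ext : ∀ {n} {x y : Vec A n} → (∀ i → lookup x i ≡ lookup y i) → x ≡ y
    lookup-ext {x = x} {y} e = ≡.trans (≡.sym (VP.tabulate∘lookup x)) (≡.trans (VP.tabulate-cong e) (VP.tabulate∘lookup y))

  module _ {A : Set} {n} (w : Permutation′ n) where
    lookup-act : ∀ (x : Vec A n) i → lookup (act w x) i ≡ lookup x (w ⟨$⟩ˡ i)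
    lookup-act x = VP.lookup∘tabulate (λ j → lookup x (w ⟨$⟩ˡ j))

    lookup-actInv : ∀ (x : Vec A n) i → lookup (actInv w x) i ≡ lookup x (w ⟨$⟩ʳ i)
    lookup-actInv x = VP.lookup∘tabulate (λ j → lookup x (w ⟨$⟩ʳ j))

    act-actInv : ∀ (x : Vec A n) → act w (actInv w x) ≡ x
    act-actInv x = lookup-ext λ i → ≡.trans (lookup-act (actInv w x) i)
      (≡.trans (lookup-actInv x (w ⟨$⟩ˡ i)) (cong (lookup x) (inverseʳ w)))

    actInv-act : ∀ (x : Vec A n) → actInv w (act w x) ≡ x
    actInv-act x = lookup-ext λ i → ≡.trans (lookup-actInv (act w x) i)
      (≡.trans (lookup-act x (w ⟨$⟩ʳ i)) (cong (lookup x) (inverseˡ w)))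

    act-map : ∀ {B : Set} (f : B → A) (x : Vec B n) → V.map f (act w x) ≡ act w (V.map f x)
    act-map f x = lookup-ext λ i → ≡.trans (VP.lookup-map i f (act w x)) (≡.trans (cong f (VP.lookup∘tabulate (λ j → lookup x (w ⟨$⟩ˡ j)) i))
      (≡.trans (≡.sym (VP.lookup-map (w ⟨$⟩ˡ i) f x)) (≡.sym (lookup-act (V.map f x) i))))

  sum-act : ∀ {n} (w : Permutation′ n) γ → sum (act w γ) ≡ sum γ
  sum-act {n} w γ = begin
    sum (act w γ)  ≡⟨ vec-sum (act w γ) ⟩
    ∑ {n} (lookup (act w γ))  ≡⟨ ∑-cong {n} (lookup-act w γ) ⟩
    ∑ {n} (λ i → lookup γ (w ⟨$⟩ˡ i)) ≡⟨ ∑.sum-permute (lookup γ) (flip w) ⟨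
    ∑ {n} (lookup γ)  ≡⟨ vec-sum γ ⟨
    sum γ ∎
    where open ≡.≡-Reasoning

  sum-actInv : ∀ {n} (w : Permutation′ n) γ → sum (actInv w γ) ≡ sum γ
  sum-actInv w γ = ≡.trans (≡.sym (sum-act w (actInv w γ))) (cong sum (act-actInv w γ))

  dropAt : ∀ {n} → Fin (suc n) → Vec ℕ (suc n) → Vec ℕ n
  dropAt i γ = tabulate (λ j → lookup γ (Fin.punchIn i j))

  lookup-dropAt : ∀ {n} i (γ : Vec ℕ (suc n)) j → lookup (dropAt i γ) j ≡ lookup γ (Fin.punchIn i j)
  lookup-dropAt i γ = VP.lookup∘tabulate (λ j → lookup γ (Fin.punchIn i j))

  -- `Perm.remove i w` is what remains of `w` once `i` and its image are deleted. Through it a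
  -- permutation of `n + 1` variables acts on coefficients in `n` variables.
  dropAt-act : ∀ {n} (w : Permutation′ (suc n)) γ i → dropAt (w ⟨$⟩ʳ i) (act w γ) ≡ act (Perm.remove i w) (dropAt i γ)
  dropAt-act w γ i = lookup-ext λ j → begin
    lookup (dropAt (w ⟨$⟩ʳ i) (act w γ)) j
      ≡⟨ lookup-dropAt (w ⟨$⟩ʳ i) (act w γ) j ⟩
    lookup (act w γ) (Fin.punchIn (w ⟨$⟩ʳ i) j)  ≡⟨ lookup-act w γ _ ⟩
    lookup γ (w ⟨$⟩ˡ Fin.punchIn (w ⟨$⟩ʳ i) j)
      ≡⟨ cong (λ k → lookup γ (w ⟨$⟩ˡ Fin.punchIn (w ⟨$⟩ʳ i) k)) (inverseʳ u) ⟨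
    lookup γ (w ⟨$⟩ˡ Fin.punchIn (w ⟨$⟩ʳ i) (u ⟨$⟩ʳ (u ⟨$⟩ˡ j)))
      ≡⟨ cong (λ k → lookup γ (w ⟨$⟩ˡ k)) (Perm.punchIn-permute w i (u ⟨$⟩ˡ j)) ⟨
    lookup γ (w ⟨$⟩ˡ (w ⟨$⟩ʳ Fin.punchIn i (u ⟨$⟩ˡ j)))  ≡⟨ cong (lookup γ) (inverseˡ w) ⟩
    lookup γ (Fin.punchIn i (u ⟨$⟩ˡ j))  ≡⟨ lookup-dropAt i γ (u ⟨$⟩ˡ j) ⟨
    lookup (dropAt i γ) (u ⟨$⟩ˡ j)  ≡⟨ lookup-act u (dropAt i γ) j ⟨
    lookup (act u (dropAt i γ)) j ∎
    where
    open ≡.≡-Reasoning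
    u = Perm.remove i w

  transpose-fixes : ∀ {n} (γ : Vec ℕ n) i j → lookup γ i ≡ lookup γ j → act (Perm.transpose i j) γ ≡ γ
  transpose-fixes γ i j e = lookup-ext λ k → ≡.trans (lookup-act (Perm.transpose i j) γ k) (swapped k)
    where
    swapped : ∀ k → lookup γ (Perm.transpose i j ⟨$⟩ˡ k) ≡ lookup γ k
    swapped k with k FinP.≟ j
    ... | yes ≡.refl = e
    ... | no _ with k FinP.≟ i
    ...   | yes ≡.refl = ≡.sym e
    ...   | no _       = ≡.refl

  transpose-source : ∀ {n} (i j : Fin n) → Perm.transpose i j ⟨$⟩ʳ i ≡ j
  transpose-source i j with i FinP.≟ i
  ... | yes _ = ≡.refl
  ... | no ne = contradiction ≡.refl ne

  dropAt-last : ∀ {n} (γ : Vec ℕ n) k → dropAt (Fin.fromℕ n) (γ ∷ʳ k) ≡ γ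
  dropAt-last γ k = lookup-ext λ j → ≡.trans (lookup-dropAt (Fin.fromℕ _) (γ ∷ʳ k) j)
    (≡.trans (cong (lookup (γ ∷ʳ k)) (punchIn-fromℕ j)) (lookup-∷ʳ-inject₁ γ k j))
    where
    punchIn-fromℕ : ∀ {n} (j : Fin n) → Fin.punchIn (Fin.fromℕ n) j ≡ Fin.inject₁ j
    punchIn-fromℕ zero    = ≡.refl
    punchIn-fromℕ (suc j) = cong suc (punchIn-fromℕ j)

  partition-init : ∀ {n} (μ : Vec ℕ n) k → IsPartition (μ ∷ʳ k) → IsPartition μ
  partition-init μ k part i j i≤j = ≡.subst₂ ℕ._≤_ (lookup-∷ʳ-inject₁ μ k j) (lookup-∷ʳ-inject₁ μ k i)
    (part (Fin.inject₁ i) (Fin.inject₁ j) (≡.subst₂ ℕ._≤_ (≡.sym (FinP.toℕ-inject₁ i)) (≡.sym (FinP.toℕ-inject₁ j)) i≤j))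

  -- The last entry of a partition is its smallest, so all entries are positive once it is.
  partition-positive : ∀ {n} (μ : Vec ℕ n) k → IsPartition (μ ∷ʳ suc k) → V.map suc (V.map ℕ.pred (μ ∷ʳ suc k)) ≡ μ ∷ʳ suc k
  partition-positive {n} μ k part = lookup-ext λ i → ≡.trans (VP.lookup-map i suc (V.map ℕ.pred ν))
    (≡.trans (cong suc (VP.lookup-map i ℕ.pred ν)) (positive (lookup ν i) (ℕP.≤-trans (s≤s z≤n)
      (≡.subst (ℕ._≤ lookup ν i) (lookup-∷ʳ-fromℕ μ (suc k)) (part i (Fin.fromℕ n)
        (≡.subst (toℕ i ℕ.≤_) (≡.sym (FinP.toℕ-fromℕ n)) (ℕP.≤-pred (FinP.toℕ<n i))))))))
    where
    ν = μ ∷ʳ suc k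
    positive : ∀ m → 1 ℕ.≤ m → suc (ℕ.pred m) ≡ m
    positive (suc m) _ = ≡.refl

  partition-pred : ∀ {n} (μ : Vec ℕ n) → IsPartition μ → IsPartition (V.map ℕ.pred μ)
  partition-pred μ part i j i≤j = ≡.subst₂ ℕ._≤_ (≡.sym (VP.lookup-map j ℕ.pred μ)) (≡.sym (VP.lookup-map i ℕ.pred μ))
    (ℕP.pred-mono-≤ (part i j i≤j))

  sum-map-suc : ∀ {n} (μ : Vec ℕ n) → sum (V.map suc μ) ≡ n ℕ.+ sum μ
  sum-map-suc []              = ≡.refl
  sum-map-suc {suc n} (a ∷ μ) = cong suc (≡.trans (cong (a ℕ.+_) (sum-map-suc μ))
    (≡.trans (≡.sym (ℕP.+-assoc a n (sum μ))) (≡.trans (cong (ℕ._+ sum μ) (ℕP.+-comm a n)) (ℕP.+-assoc n a (sum μ)))))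

  stair : ∀ n → Vec ℕ n
  stair n = tabulate (λ i → n ∸ suc (toℕ i))

  stair-∷ʳ : ∀ n → stair (suc n) ≡ V.map suc (stair n) ∷ʳ 0
  stair-∷ʳ zero    = ≡.refl
  stair-∷ʳ (suc n) = cong (suc n ∷_) (stair-∷ʳ n)

-- Symmetric polynomials with prescribed values at the points μ + ρδ

module SymmetricInterpolation {ℓ} (K : CommutativeRing 0ℓ ℓ) (ρ : CommutativeRing.Carrier K)
  (inverse : Interpolation.Points.NodesInvertible K ρ) where
  open CommutativeRing K hiding (zero)
  open Interpolation K
  open Points ρ
  open Theory inverse
  open PermutationAction
  open import Algebra.Properties.Semiring.Exp semiring using (_^_)
  open import Relation.Binary.Reasoning.Setoid setoid
  open NatSolver commutativeSemiring using (solve; _:+_; _:*_; con; _:=_)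
  private
    module ∏ = Algebra.Properties.CommutativeMonoid.Sum *-commutativeMonoid
    open ∏ using () renaming (sum to ∏)

  mono-∏ : ∀ {n} (x : Vec Carrier n) γ → mono x γ ≈ ∏ {n} (λ i → lookup x i ^ lookup γ i)
  mono-∏ []       []      = refl
  mono-∏ (x ∷ xs) (k ∷ γ) = *-congˡ (mono-∏ xs γ)

  mono-act : ∀ {n} (w : Permutation′ n) x γ → mono (act w x) γ ≈ mono x (actInv w γ)
  mono-act {n} w x γ = begin
    mono (act w x) γ  ≈⟨ mono-∏ (act w x) γ ⟩
    ∏ {n} (λ i → lookup (act w x) i ^ lookup γ i)
      ≈⟨ ∏.sum-permute (λ i → lookup (act w x) i ^ lookup γ i) w ⟩
    ∏ {n} (λ i → lookup (act w x) (w ⟨$⟩ʳ i) ^ lookup γ (w ⟨$⟩ʳ i))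
      ≡⟨ ∏.sum-cong-≗ {n} (λ i → cong₂ _^_
           (≡.trans (lookup-act w x (w ⟨$⟩ʳ i)) (cong (lookup x) (inverseˡ w)))
           (≡.sym (lookup-actInv w γ i))) ⟩
    ∏ {n} (λ i → lookup x i ^ lookup (actInv w γ) i)  ≈⟨ mono-∏ x (actInv w γ) ⟨
    mono x (actInv w γ) ∎

  Symmetric : ∀ {n} → Polynomial n → Set _
  Symmetric {n} p = ∀ (w : Permutation′ n) η → coeff p (act w η) ≈ coeff p η

  eval-act : ∀ {n} (w : Permutation′ n) p x → eval p (act w x) ≈ eval (mapExp (actInv w) p) x
  eval-act w p x = trans (lin-cong (mono-act w x) p) (reflexive (≡.sym (lin-mapExp (mono x) (actInv w) p)))

  coeff-actInv : ∀ {n} (w : Permutation′ n) p η → coeff (mapExp (actInv w) p) η ≈ coeff p (act w η)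
  coeff-actInv w p η = trans (reflexive (cong (coeff (mapExp (actInv w) p)) (≡.sym (actInv-act w η))))
    (coeff-mapExp (actInv w) (λ {γ} {η} e → ≡.trans (≡.sym (act-actInv w γ)) (≡.trans (cong (act w) e) (act-actInv w η))) p (act w η))

  symmetric⇒eval : ∀ {n} {p : Polynomial n} → Symmetric p → ∀ w x → eval p (act w x) ≈ eval p x
  symmetric⇒eval {p = p} sym-p w x = trans (eval-act w p x)
    (lin-≋ (mono x) {mapExp (actInv w) p} {p} (coeffwise λ η → trans (coeff-actInv w p η) (sym-p w η)))

  eval⇒symmetric : ∀ {n} {p : Polynomial n} → (∀ w x → eval p (act w x) ≈ eval p x) → Symmetric p
  eval⇒symmetric {p = p} e w η = trans (sym (coeff-actInv w p η))
    (coeff≈ (eval-injective {p = mapExp (actInv w) p} {p} (λ x → trans (sym (eval-act w p x)) (e w x))) η)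

  symmetric-++ : ∀ {n} {p q : Polynomial n} → Symmetric p → Symmetric q → Symmetric (p ++ q)
  symmetric-++ {p = p} {q} sp sq w η = trans (lin-++ _ p q) (trans (+-cong (sp w η) (sq w η)) (sym (lin-++ _ p q)))

  symmetric-shift : ∀ {n} a {p : Polynomial n} → Symmetric p → Symmetric (shift a p)
  symmetric-shift a {p} sp = eval⇒symmetric {p = shift a p} λ w x → begin
    eval (shift a p) (act w x)  ≈⟨ eval-shift a p (act w x) ⟩
    eval p (translate a (act w x)) ≡⟨ cong (eval p) (act-map w (_+ a) x) ⟩
    eval p (act w (translate a x)) ≈⟨ symmetric⇒eval {p = p} sp w (translate a x) ⟩
    eval p (translate a x)  ≈⟨ eval-shift a p x ⟨
    eval (shift a p) x ∎

  -- For symmetric p the choice of the zero entry to be dropped does not matter.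
  module _ {n} (p : Polynomial n) where
    extendCoeff : Exponent (suc n) → Carrier
    extendCoeff η with FinP.any? (λ i → lookup η i ℕP.≟ 0)
    ... | yes (i , _) = coeff p (dropAt i η)
    ... | no _        = 0#

    -- On symmetric polynomials of degree at most `d` this is the map m_λ ↦ m_λ from `n` to `n + 1`
    -- variables: it is supported on exponents with a zero entry and is a section of setting the
    -- last variable to zero.
    extension : ℕ → Polynomial (suc n)
    extension d = fromCoeffs (suc n) d extendCoeff

    module _ (sp : Symmetric p) where
      -- If `i` and `j` are both zero entries, their transposition fixes `η` and turns dropping `i`
      -- into dropping `j`, up to a permutation of the remaining entries, under which `p` is
      -- invariant.
      extendCoeff-zero : ∀ η i → lookup η i ≡ 0 → extendCoeff η ≈ coeff p (dropAt i η)
      extendCoeff-zero η i z with FinP.any? (λ i → lookup η i ℕP.≟ 0)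
      ... | no none      = contradiction (i , z) none
      ... | yes (j , z′) = begin
        coeff p (dropAt j η)
          ≡⟨ cong₂ (λ k γ → coeff p (dropAt k γ)) (transpose-source i j) (transpose-fixes η i j (≡.trans z (≡.sym z′))) ⟨
        coeff p (dropAt (t ⟨$⟩ʳ i) (act t η))  ≡⟨ cong (coeff p) (dropAt-act t η i) ⟩
        coeff p (act (Perm.remove i t) (dropAt i η))  ≈⟨ sp (Perm.remove i t) (dropAt i η) ⟩
        coeff p (dropAt i η) ∎
        where t = Perm.transpose i j

      extendCoeff-act : ∀ w η → extendCoeff (act w η) ≈ extendCoeff η
      extendCoeff-act w η = by-zero (FinP.any? (λ i → lookup η i ℕP.≟ 0)) (FinP.any? (λ i → lookup (act w η) i ℕP.≟ 0))
        where
        none⇒0 : ∀ η → ¬ (∃ λ i → lookup η i ≡ 0) → extendCoeff η ≈ 0#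
        none⇒0 η none with FinP.any? (λ i → lookup η i ℕP.≟ 0)
        ... | no _  = refl
        ... | yes z = contradiction z none
        by-zero : Dec (∃ λ i → lookup η i ≡ 0) → Dec (∃ λ i → lookup (act w η) i ≡ 0) → extendCoeff (act w η) ≈ extendCoeff η
        by-zero (yes (i , z)) _ = begin
          extendCoeff (act w η)
            ≈⟨ extendCoeff-zero (act w η) (w ⟨$⟩ʳ i)
                 (≡.trans (lookup-act w η _) (≡.trans (cong (lookup η) (inverseˡ w)) z)) ⟩
          coeff p (dropAt (w ⟨$⟩ʳ i) (act w η))  ≡⟨ cong (coeff p) (dropAt-act w η i) ⟩
          coeff p (act (Perm.remove i w) (dropAt i η))  ≈⟨ sp (Perm.remove i w) (dropAt i η) ⟩
          coeff p (dropAt i η)  ≈⟨ extendCoeff-zero η i z ⟨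
          extendCoeff η ∎
        by-zero (no none) (yes (i , z)) = contradiction (w ⟨$⟩ˡ i , ≡.trans (≡.sym (lookup-act w η i)) z) none
        by-zero (no none) (no none′)    = trans (none⇒0 (act w η) none′) (sym (none⇒0 η none))

      symmetric-extension : ∀ d → Symmetric (extension d)
      symmetric-extension d w η with sum η ℕP.≤? d
      ... | yes l = trans (coeff-fromCoeffs (suc n) d extendCoeff (act w η) (≡.subst (ℕ._≤ d) (≡.sym (sum-act w η)) l))
                      (trans (extendCoeff-act w η) (sym (coeff-fromCoeffs (suc n) d extendCoeff η l)))
      ... | no ¬l = trans (coeff-above (degree-fromCoeffs (suc n) d extendCoeff) (≡.subst (d ℕ.<_) (≡.sym (sum-act w η)) (ℕP.≰⇒> ¬l)))
                      (sym (coeff-above (degree-fromCoeffs (suc n) d extendCoeff) (ℕP.≰⇒> ¬l)))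

      eval-extension : ∀ {d} → Degree≤ d p → ∀ x → eval (extension d) (x ∷ʳ 0#) ≈ eval p x
      eval-extension {d} dp x = begin
        eval q (x ∷ʳ 0#)  ≈⟨ eval-split-last q x 0# ⟩
        eval (constant s) x + 0# * eval (quotient s) (x ∷ʳ 0#)
          ≈⟨ trans (+-congˡ (zeroˡ _)) (+-identityʳ _) ⟩
        eval (constant s) x
          ≈⟨ lin-≋ (mono x) {constant s} {p} (coeffwise constant-coeff) ⟩
        eval p x ∎
        where
        q = extension d
        s = splitLast q
        raiseLast≢ : ∀ γ {η} → raiseLast γ ≢ η ∷ʳ 0
        raiseLast≢ γ {η} e with VP.∷ʳ-injectiveʳ (V.init γ) η e
        ... | ()
        coeff-∷ʳ : ∀ η → coeff q (η ∷ʳ 0) ≈ coeff (constant s) η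
        coeff-∷ʳ η = begin
          coeff q (η ∷ʳ 0)
            ≈⟨ lin-split-last s (δ (η ∷ʳ 0)) ⟩
          lin (δ (η ∷ʳ 0) ∘ (_∷ʳ 0)) (constant s) + lin (δ (η ∷ʳ 0) ∘ raiseLast) (quotient s)
            ≈⟨ +-cong
                 (lin-cong (λ γ → reflexive (δ-injective (_∷ʳ 0) (λ {γ} {η} → VP.∷ʳ-injectiveˡ γ η) η γ)) (constant s))
                 (trans (lin-cong (λ γ → reflexive (δ-≢ (raiseLast≢ γ))) (quotient s)) (lin-zero (quotient s))) ⟩
          coeff (constant s) η + 0#
            ≈⟨ +-identityʳ _ ⟩
          coeff (constant s) η ∎
        constant-coeff : ∀ η → coeff (constant s) η ≈ coeff p η
        constant-coeff η with sum η ℕP.≤? d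
        ... | yes l = begin
          coeff (constant s) η  ≈⟨ coeff-∷ʳ η ⟨
          coeff q (η ∷ʳ 0)
            ≈⟨ coeff-fromCoeffs (suc n) d extendCoeff (η ∷ʳ 0) (≡.subst (ℕ._≤ d) (≡.sym (sum-∷ʳ η 0)) l) ⟩
          extendCoeff (η ∷ʳ 0)
            ≈⟨ extendCoeff-zero (η ∷ʳ 0) (Fin.fromℕ n) (lookup-∷ʳ-fromℕ η 0) ⟩
          coeff p (dropAt (Fin.fromℕ n) (η ∷ʳ 0))  ≡⟨ cong (coeff p) (dropAt-last η 0) ⟩
          coeff p η ∎
        ... | no ¬l = trans (coeff-above (degree-constant s (degree-fromCoeffs (suc n) d extendCoeff)) (ℕP.≰⇒> ¬l))
                        (sym (coeff-above dp (ℕP.≰⇒> ¬l)))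

  partitionPoint : ∀ {n} → Exponent n → Vec Carrier n
  partitionPoint {n} μ = point μ (stair n)

  partitionPoint-∷ʳ-zero : ∀ {n} (μ : Exponent n) → partitionPoint (μ ∷ʳ 0) ≈ᵛ (translate ρ (partitionPoint μ) ∷ʳ 0#)
  partitionPoint-∷ʳ-zero {n} μ = ≈ᵛ-trans
    (≡⇒≈ᵛ (≡.trans (cong (point (μ ∷ʳ 0)) (stair-∷ʳ n)) (point-∷ʳ μ (V.map suc (stair n)) 0 0)))
    (∷ʳ⁺ (raised μ (stair n)) zero-entry)
    where
    raised : ∀ {m} (μ κ : Vec ℕ m) → point μ (V.map suc κ) ≈ᵛ translate ρ (point μ κ)
    raised []      []      = []
    raised (a ∷ μ) (k ∷ κ) = solve 3 (λ ρ x k → x :+ ρ :* (con 1 :+ k) := x :+ ρ :* k :+ ρ) refl ρ (ι a) (ι k) ∷ raised μ κ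

  point-map-suc : ∀ {n} (μ κ : Vec ℕ n) → translate (- 1#) (point (V.map suc μ) κ) ≈ᵛ point μ κ
  point-map-suc []      []      = []
  point-map-suc (a ∷ μ) (k ∷ κ) = (begin
    1# + ι a + ρ * ι k - 1#
      ≈⟨ solve 4 (λ o a k m → o :+ a :+ k :+ m := a :+ k :+ (o :+ m)) refl 1# (ι a) (ρ * ι k) (- 1#) ⟩
    ι a + ρ * ι k + (1# - 1#)  ≈⟨ trans (+-congˡ (-‿inverseʳ 1#)) (+-identityʳ _) ⟩
    ι a + ρ * ι k ∎) ∷ point-map-suc μ κ

  product : ∀ {n} → Vec Carrier n → Carrier
  product {n} x = mono x (replicate n 1)

  product-act : ∀ {n} (w : Permutation′ n) x → product (act w x) ≈ product x
  product-act {n} w x = trans (mono-act w x (replicate n 1)) (reflexive (cong (mono x)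
    (lookup-ext λ i → ≡.trans (lookup-actInv w (replicate n 1) i)
      (≡.trans (VP.lookup-replicate (w ⟨$⟩ʳ i) 1) (≡.sym (VP.lookup-replicate i 1))))))

  product-∷ʳ-zero : ∀ {n} (x : Vec Carrier n) → product (x ∷ʳ 0#) ≈ 0#
  product-∷ʳ-zero []       = trans (*-identityʳ _) (*-identityʳ 0#)
  product-∷ʳ-zero (x ∷ xs) = trans (*-congˡ (product-∷ʳ-zero xs)) (zeroʳ _)

  -- With all parts positive, every coordinate has the invertible form m + 1 + kρ.
  product-inverse : ∀ {n} (μ κ : Vec ℕ n) → ∃ λ y → product (point (V.map suc μ) κ) * y ≈ 1#
  product-inverse []      []      = 1# , *-identityˡ 1#
  product-inverse (a ∷ μ) (k ∷ κ) with inverse a k | product-inverse μ κ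
  ... | y , e | z , f = y * z , (begin
    (ι (suc a) + ρ * ι k) ^ 1 * P * (y * z)  ≈⟨ *-congʳ (*-congʳ (*-identityʳ _)) ⟩
    (ι (suc a) + ρ * ι k) * P * (y * z)
      ≈⟨ solve 4 (λ a b c d → a :* b :* (c :* d) := a :* c :* (b :* d)) refl _ P y z ⟩
    (ι (suc a) + ρ * ι k) * y * (P * z)  ≈⟨ *-cong e f ⟩
    1# * 1#  ≈⟨ *-identityˡ 1# ⟩
    1# ∎)
    where P = product (point (V.map suc μ) κ)

  eval-map-suc : ∀ {n} (p : Polynomial n) x → eval (mapExp (V.map suc) p) x ≈ product x * eval p x
  eval-map-suc {n} p x = trans (reflexive (lin-mapExp (mono x) (V.map suc) p))
    (trans (lin-cong (λ γ → trans (reflexive (cong (mono x) (≡.sym (VP.zipWith-replicate₁ ℕ._+_ 1 γ)))) (mono-+ x (replicate n 1) γ)) p)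
      (lin-* (mono x) (product x) p))

  record SymmetricInterpolant (n d : ℕ) (v : Exponent n → Carrier) : Set ℓ where
    field
      poly      : Polynomial n
      degree    : Degree≤ d poly
      symmetric : Symmetric poly
      eval-poly : ∀ μ → IsPartition μ → sum μ ℕ.≤ d → eval poly (partitionPoint μ) ≈ v μ
  open SymmetricInterpolant public

  module _ {n} (interpolateₙ : ∀ d v → SymmetricInterpolant n d v) where
    module Base (d : ℕ) (v : Exponent (suc n) → Carrier) where
      low = interpolateₙ d (λ μ → v (μ ∷ʳ 0))
      p = shift (- ρ) (poly low)
      degree-p : Degree≤ d p
      degree-p = degree-shift (- ρ) (degree low)
      symmetric-p : Symmetric p
      symmetric-p = symmetric-shift (- ρ) {poly low} (symmetric low)
      g : Polynomial (suc n)
      g = extension p d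
      degree-g : Degree≤ d g
      degree-g = degree-fromCoeffs (suc n) d (extendCoeff p)
      eval-g : ∀ μ → IsPartition μ → sum μ ℕ.≤ d → eval g (partitionPoint (μ ∷ʳ 0)) ≈ v (μ ∷ʳ 0)
      eval-g μ part l = begin
        eval g (partitionPoint (μ ∷ʳ 0))
          ≈⟨ eval-cong g (partitionPoint-∷ʳ-zero μ) ⟩
        eval g (translate ρ (partitionPoint μ) ∷ʳ 0#)
          ≈⟨ eval-extension p symmetric-p degree-p (translate ρ (partitionPoint μ)) ⟩
        eval p (translate ρ (partitionPoint μ))
          ≈⟨ eval-shift (- ρ) (poly low) (translate ρ (partitionPoint μ)) ⟩
        eval (poly low) (translate (- ρ) (translate ρ (partitionPoint μ)))
          ≈⟨ eval-cong (poly low) (translate-inverse (-‿inverseʳ ρ) (partitionPoint μ)) ⟩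
        eval (poly low) (partitionPoint μ)  ≈⟨ eval-poly low μ part l ⟩
        v (μ ∷ʳ 0) ∎

    -- Partitions ending in zero are those with one entry fewer, their points translated by `ρ`; `g`
    -- takes care of them. All others are ν + (1,...,1) with |ν| smaller by n + 1, and the point of
    -- ν is obtained by subtracting 1 from each coordinate. They are corrected by x_1⋯x_(n+1) times
    -- a shifted symmetric polynomial, which is zero at the points of the first kind. Since `d`
    -- drops by `suc n`, the recursion is carried by `fuel`.
    interpolateₙ₊₁ : ∀ fuel d → d ℕ.≤ fuel → ∀ v → SymmetricInterpolant (suc n) d v
    interpolateₙ₊₁ fuel d d≤fuel v with suc n ℕP.≤? d
    interpolateₙ₊₁ fuel d d≤fuel v | no n≮d = record
      { poly = g ; degree = degree-g ; symmetric = symmetric-extension p symmetric-p d ; eval-poly = eval-poly₀ }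
      where
      open Base d v
      eval-poly₀ : ∀ μ → IsPartition μ → sum μ ℕ.≤ d → eval g (partitionPoint μ) ≈ v μ
      eval-poly₀ μ part l with V.initLast μ
      ... | μ′ , zero  , ≡.refl = eval-g μ′ (partition-init μ′ 0 part) (≡.subst (ℕ._≤ d) (sum-∷ʳ μ′ 0) l)
      -- All n + 1 parts would be positive, so the size would be at least n + 1, which exceeds `d`.
      ... | μ′ , suc k , ≡.refl = contradiction (ℕP.≤-trans (ℕP.m≤m+n (suc n) _) (≡.subst (ℕ._≤ d)
              (≡.trans (cong sum (≡.sym (partition-positive μ′ k part))) (sum-map-suc (V.map ℕ.pred (μ′ ∷ʳ suc k)))) l)) n≮d
    interpolateₙ₊₁ (suc fuel) d d≤fuel v | yes n<d = record
      { poly = g ++ h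
      ; degree = degree-++ degree-g degree-h
      ; symmetric = symmetric-++ {p = g} {h} (symmetric-extension p symmetric-p d) symmetric-h
      ; eval-poly = eval-poly₁ }
      where
      open Base d v
      d′ = d ∸ suc n
      n+d′ : suc n ℕ.+ d′ ≡ d
      n+d′ = ℕP.m+[n∸m]≡n n<d
      residue : Exponent (suc n) → Carrier
      residue μ = (v (V.map suc μ) - eval g (partitionPoint (V.map suc μ))) * proj₁ (product-inverse μ (stair (suc n)))
      high = interpolateₙ₊₁ fuel d′ (ℕP.≤-pred (ℕP.≤-trans (ℕP.∸-monoʳ-< {d} {suc n} {0} (s≤s z≤n) n<d) d≤fuel)) residue
      q = shift (- 1#) (poly high)
      h = mapExp (V.map suc) q
      degree-h : Degree≤ d h
      degree-h = ≡.subst (λ e → Degree≤ e h) n+d′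
        (degree-mapExp {e = suc n} (V.map suc) (λ γ → ℕP.≤-reflexive (sum-map-suc γ)) (degree-shift (- 1#) (degree high)))
      symmetric-h : Symmetric h
      symmetric-h = eval⇒symmetric {p = h} λ w x → trans (eval-map-suc q (act w x))
        (trans (*-cong (product-act w x) (symmetric⇒eval {p = q} (symmetric-shift (- 1#) {poly high} (symmetric high)) w x)) (sym (eval-map-suc q x)))
      eval-poly₁ : ∀ μ → IsPartition μ → sum μ ℕ.≤ d → eval (g ++ h) (partitionPoint μ) ≈ v μ
      eval-poly₁ μ part l with V.initLast μ
      ... | μ′ , zero , ≡.refl = begin
        eval (g ++ h) X  ≈⟨ lin-++ _ g h ⟩
        eval g X + eval h X
          ≈⟨ +-cong (eval-g μ′ (partition-init μ′ 0 part) (≡.subst (ℕ._≤ d) (sum-∷ʳ μ′ 0) l))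
               (trans (eval-cong h (partitionPoint-∷ʳ-zero μ′)) (trans (eval-map-suc q Y) (*-congʳ (product-∷ʳ-zero (translate ρ (partitionPoint μ′)))))) ⟩
        v (μ′ ∷ʳ 0) + 0# * eval q Y  ≈⟨ trans (+-congˡ (zeroˡ _)) (+-identityʳ _) ⟩
        v (μ′ ∷ʳ 0) ∎
        where
        X = partitionPoint (μ′ ∷ʳ 0)
        Y = translate ρ (partitionPoint μ′) ∷ʳ 0#
      ... | μ′ , suc k , ≡.refl = ≡.subst (λ μ → eval (g ++ h) (partitionPoint μ) ≈ v μ) (partition-positive μ′ k part) (begin
        eval (g ++ h) X  ≈⟨ lin-++ _ g h ⟩
        G + eval h X  ≈⟨ +-congˡ (eval-map-suc q X) ⟩
        G + product X * eval q X
          ≈⟨ +-congˡ (*-congˡ (trans (eval-shift (- 1#) (poly high) X)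
               (trans (eval-cong (poly high) (point-map-suc ν (stair (suc n)))) (eval-poly high ν (partition-pred (μ′ ∷ʳ suc k) part) ν≤d′)))) ⟩
        G + product X * ((V - G) * z)
          ≈⟨ +-congˡ (solve 3 (λ y u z → y :* (u :* z) := u :* (y :* z)) refl (product X) (V - G) z) ⟩
        G + (V - G) * (product X * z)
          ≈⟨ +-congˡ (trans (*-congˡ (proj₂ (product-inverse ν (stair (suc n))))) (*-identityʳ _)) ⟩
        G + (V - G)
          ≈⟨ solve 3 (λ G v m → G :+ (v :+ m) := v :+ (G :+ m)) refl G V (- G) ⟩
        V + (G - G)  ≈⟨ trans (+-congˡ (-‿inverseʳ G)) (+-identityʳ _) ⟩
        V ∎)
        where
        ν = V.map ℕ.pred (μ′ ∷ʳ suc k)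
        X = partitionPoint (V.map suc ν)
        G = eval g X
        V = v (V.map suc ν)
        z = proj₁ (product-inverse ν (stair (suc n)))
        ν≤d′ : sum ν ℕ.≤ d′
        ν≤d′ = ℕP.+-cancelˡ-≤ (suc n) _ _ (≡.subst₂ ℕ._≤_
          (≡.trans (cong sum (≡.sym (partition-positive μ′ k part))) (sum-map-suc ν)) (≡.sym n+d′) l)
    interpolateₙ₊₁ zero d d≤0 v | yes n<d = contradiction (ℕP.≤-trans n<d d≤0) λ ()

  symmetricInterpolate : ∀ n d v → SymmetricInterpolant n d v
  symmetricInterpolate zero d v = record
    { poly = monomial [] (v []) ; degree = z≤n ∷ [] ; symmetric = λ { w [] → refl }
    ; eval-poly = λ { [] _ _ → trans (+-identityʳ _) (*-identityʳ _) } }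
  symmetricInterpolate (suc n) d v = interpolateₙ₊₁ (symmetricInterpolate n) d d ℕP.≤-refl v

-- The operator Ξ

module DualOperator {ℓ} (K : CommutativeRing 0ℓ ℓ) (ρ : CommutativeRing.Carrier K)
  (inverse : Interpolation.Points.NodesInvertible K ρ)
  (interpolationPoly : ∀ {n} (η : Vec ℕ n) → Interpolation.Points.InterpolationPoly K ρ η) where
  open CommutativeRing K hiding (zero)
  open Interpolation K
  open Points ρ
  open Theory inverse
  open PermutationAction
  open SortingPermutations
  open SymmetricInterpolation K ρ inverse hiding (poly; degree; eval-poly)
  private module S = SymmetricInterpolation K ρ inverse
  open import Algebra.Properties.Semiring.Exp semiring using (_^_)
  open import Algebra.Properties.Ring ring using (-1*x≈-x; -‿involutive)
  open import Algebra.Properties.Group +-group using (x∙y⁻¹≈ε⇒x≈y)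
  open import Relation.Binary.Reasoning.Setoid setoid
  open NatSolver commutativeSemiring using (solve; _:*_; _:=_)

  sign : ℕ → Carrier
  sign k = (- 1#) ^ k

  sign-square : ∀ k → sign k * sign k ≈ 1#
  sign-square zero    = *-identityˡ 1#
  sign-square (suc k) = begin
    - 1# * sign k * (- 1# * sign k)
      ≈⟨ solve 2 (λ m s → m :* s :* (m :* s) := m :* m :* (s :* s)) refl (- 1#) (sign k) ⟩
    - 1# * - 1# * (sign k * sign k)
      ≈⟨ *-cong (trans (-1*x≈-x (- 1#)) (-‿involutive 1#)) (sign-square k) ⟩
    1# * 1#  ≈⟨ *-identityˡ 1# ⟩
    1# ∎

  sign-+ : ∀ k l → sign (k ℕ.+ l) ≈ sign k * sign l
  sign-+ zero    l = sym (*-identityˡ _)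
  sign-+ (suc k) l = trans (*-congˡ (sign-+ k l)) (sym (*-assoc _ _ _))

  negate : ∀ {n} → Vec Carrier n → Vec Carrier n
  negate = V.map (-_)

  negate-involutive : ∀ {n} (x : Vec Carrier n) → negate (negate x) ≈ᵛ x
  negate-involutive []       = []
  negate-involutive (x ∷ xs) = -‿involutive x ∷ negate-involutive xs

  negate-cong : ∀ {n} {x y : Vec Carrier n} → x ≈ᵛ y → negate x ≈ᵛ negate y
  negate-cong []       = []
  negate-cong (e ∷ es) = -‿cong e ∷ negate-cong es

  negArg : ∀ {n} → Polynomial n → Polynomial n
  negArg = L.map (λ t → proj₁ t , sign (sum (proj₁ t)) * proj₂ t)

  lin-negArg : ∀ {n} φ (p : Polynomial n) → lin φ (negArg p) ≈ lin (λ γ → sign (sum γ) * φ γ) p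
  lin-negArg φ []            = refl
  lin-negArg φ ((γ , a) ∷ p) = +-cong (solve 3 (λ s a x → s :* a :* x := a :* (s :* x)) refl (sign (sum γ)) a (φ γ)) (lin-negArg φ p)

  neg-^ : ∀ x k → (- x) ^ k ≈ sign k * x ^ k
  neg-^ x zero    = sym (*-identityˡ 1#)
  neg-^ x (suc k) = trans (*-cong (sym (-1*x≈-x x)) (neg-^ x k))
    (solve 4 (λ m x s y → m :* x :* (s :* y) := m :* s :* (x :* y)) refl (- 1#) x (sign k) (x ^ k))

  mono-negate : ∀ {n} (x : Vec Carrier n) γ → mono (negate x) γ ≈ sign (sum γ) * mono x γ
  mono-negate []       []      = sym (*-identityˡ 1#)
  mono-negate (x ∷ xs) (k ∷ γ) = begin
    (- x) ^ k * mono (negate xs) γ  ≈⟨ *-cong (neg-^ x k) (mono-negate xs γ) ⟩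
    sign k * x ^ k * (sign (sum γ) * mono xs γ)
      ≈⟨ solve 4 (λ a b c d → a :* b :* (c :* d) := a :* c :* (b :* d)) refl (sign k) (x ^ k) (sign (sum γ)) (mono xs γ) ⟩
    sign k * sign (sum γ) * (x ^ k * mono xs γ)  ≈⟨ *-congʳ (sign-+ k (sum γ)) ⟨
    sign (k ℕ.+ sum γ) * mono (x ∷ xs) (k ∷ γ) ∎

  eval-negArg : ∀ {n} (p : Polynomial n) x → eval (negArg p) x ≈ eval p (negate x)
  eval-negArg p x = trans (lin-negArg (mono x) p) (lin-cong (λ γ → sym (mono-negate x γ)) p)

  eval-negArg-negate : ∀ {n} (p : Polynomial n) x → eval (negArg p) (negate x) ≈ eval p x
  eval-negArg-negate p x = trans (eval-negArg p (negate x)) (eval-cong p (negate-involutive x))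

  coeff-negArg : ∀ {n} (p : Polynomial n) η → coeff (negArg p) η ≈ sign (sum η) * coeff p η
  coeff-negArg p η = trans (lin-negArg (δ η) p) (trans (lin-cong same p) (lin-* (δ η) (sign (sum η)) p))
    where
    same : ∀ γ → sign (sum γ) * δ η γ ≈ sign (sum η) * δ η γ
    same γ with γ ≟ᵉ η
    ... | yes ≡.refl = refl
    ... | no ne      = trans (zeroʳ _) (sym (zeroʳ _))

  top : ∀ {n} → ℕ → Polynomial n → Polynomial n
  top d = restrict (λ γ → sum γ ℕP.≟ d)

  -- Stated on coefficients, unlike `Degree≤`: the leading terms of `g ⊖ f` cancel without
  -- disappearing from the list.
  Degree< : ∀ {n} → ℕ → Polynomial n → Set ℓ
  Degree< d p = ∀ η → d ℕ.≤ sum η → coeff p η ≈ 0#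

  Homogeneous : ∀ {n} → ℕ → Polynomial n → Set ℓ
  Homogeneous d p = ∀ η → sum η ≢ d → coeff p η ≈ 0#

  -- Ξ f is characterised, for f homogeneous of degree d, by Dual d f (Ξ f).
  record Dual {n} (d : ℕ) (f g : Polynomial n) : Set ℓ where
    constructor dual
    field
      degree-difference : Degree< d (g ⊖ f)
      vanishing         : ∀ γ → sum γ ℕ.< d → eval g (negate (bar γ)) ≈ 0#

  record SymmetricDual {n} (d : ℕ) (f g : Polynomial n) : Set ℓ where
    constructor symmetricDual
    field
      symmetric-dual    : Symmetric g
      degree-difference : Degree< d (g ⊖ f)
      vanishing         : ∀ μ → IsPartition μ → sum μ ℕ.< d → eval g (negate (partitionPoint μ)) ≈ 0#

  restrict-≋ : ∀ {n} {P : Exponent n → Set} (P? : ∀ γ → Dec (P γ)) {p : Polynomial n} →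
    (∀ η → ¬ P η → coeff p η ≈ 0#) → restrict P? p ≋ p
  restrict-≋ P? {p} outside = coeffwise λ η → by η (P? η)
    where
    by : ∀ η → Dec _ → coeff (restrict P? p) η ≈ coeff p η
    by η (yes Pη) = coeff-restrict-yes P? Pη p
    by η (no ¬Pη) = trans (coeff-restrict-no P? ¬Pη p) (sym (outside η ¬Pη))

  sign-cancel : ∀ k {x} → sign k * x ≈ 0# → x ≈ 0#
  sign-cancel k e = invertible-cancel (sign-square k) e

  -- Truncation turns the bound on coefficients into the bound on terms required by
  -- `vanishing⇒null`, and replacing x by -x moves the points -γ̄ to the nodes. For d = 0 the degree
  -- bound alone suffices.
  dual-null : ∀ {n} d (h : Polynomial n) → Degree< d h → (∀ γ → sum γ ℕ.< d → eval h (negate (bar γ)) ≈ 0#) → h ≋ []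
  dual-null     zero    h dh van = coeffwise λ η → dh η z≤n
  dual-null {n} (suc e) h dh van = ≋-trans (≋-sym trunc≋h) (coeffwise λ η →
    sign-cancel (sum η) (trans (sym (coeff-negArg trunc η)) (coeff≈ negated-null η)))
    where
    small? : ∀ γ → Dec (sum γ ℕ.≤ e)
    small? γ = sum γ ℕP.≤? e
    trunc : Polynomial n
    trunc = restrict small? h
    trunc≋h : trunc ≋ h
    trunc≋h = restrict-≋ small? (λ η l → dh η (ℕP.≰⇒> l))
    negated-null : negArg trunc ≋ []
    negated-null = vanishing⇒null n e (negArg trunc) (AllP.map⁺ (restrict-All small? h)) λ γ l →
      trans (eval-negArg trunc (bar γ)) (trans (lin-≋ (mono (negate (bar γ))) trunc≋h) (van γ (s≤s l)))

  dual-unique : ∀ {n} d {f g h : Polynomial n} → Dual d f g → Dual d f h → g ≋ h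
  dual-unique d {f} {g} {h} (dual dg vg) (dual dh vh) = ⊖-null⇒≋ (dual-null d (g ⊖ h)
    (λ η l → trans (lin-⊖ (δ η) g h) (x-x≈0 (trans (agree g dg η l) (sym (agree h dh η l)))))
    (λ γ l → trans (lin-⊖ (mono (negate (bar γ))) g h) (x-x≈0 (trans (vg γ l) (sym (vh γ l))))))
    where
    agree : ∀ p → Degree< d (p ⊖ f) → ∀ η → d ℕ.≤ sum η → coeff p η ≈ coeff f η
    agree p dp η l = x∙y⁻¹≈ε⇒x≈y _ _ (trans (sym (lin-⊖ (δ η) p f)) (dp η l))

  dual-cong : ∀ {n d} {f f′ g g′ : Polynomial n} → f ≋ f′ → g ≋ g′ → Dual d f g → Dual d f′ g′
  dual-cong {f = f} {f′} {g} {g′} ef eg (dual dg vg) = dual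
    (λ η l → trans (lin-⊖ (δ η) g′ f′) (trans (+-cong (sym (coeff≈ eg η)) (-‿cong (sym (coeff≈ ef η))))
               (trans (sym (lin-⊖ (δ η) g f)) (dg η l))))
    (λ γ l → trans (lin-≋ (mono (negate (bar γ))) (≋-sym eg)) (vg γ l))

  symmetricDual-cong : ∀ {n d} {f g g′ : Polynomial n} → g ≋ g′ → SymmetricDual d f g → SymmetricDual d f g′
  symmetricDual-cong {f = f} {g} {g′} eg (symmetricDual sg dg vg) = symmetricDual
    (λ w η → trans (sym (coeff≈ eg (act w η))) (trans (sg w η) (coeff≈ eg η)))
    (λ η l → trans (lin-⊖ (δ η) g′ f) (trans (+-congʳ (sym (coeff≈ eg η))) (trans (sym (lin-⊖ (δ η) g f)) (dg η l))))
    (λ μ part l → trans (lin-≋ (mono (negate (partitionPoint μ))) (≋-sym eg)) (vg μ part l))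

  dual-++ : ∀ {n d} {f f′ g g′ : Polynomial n} → Dual d f g → Dual d f′ g′ → Dual d (f ++ f′) (g ++ g′)
  dual-++ {f = f} {f′} {g} {g′} (dual dg vg) (dual dg′ vg′) = dual
    (λ η l → begin
      coeff ((g ++ g′) ⊖ (f ++ f′)) η
        ≈⟨ lin-⊖ (δ η) (g ++ g′) (f ++ f′) ⟩
      coeff (g ++ g′) η - coeff (f ++ f′) η
        ≈⟨ x-x≈0 (trans (lin-++ (δ η) g g′) (trans
             (+-cong (agree g f (dg η l)) (agree g′ f′ (dg′ η l))) (sym (lin-++ (δ η) f f′)))) ⟩
      0# ∎)
    (λ γ l → trans (lin-++ (mono (negate (bar γ))) g g′) (trans (+-cong (vg γ l) (vg′ γ l)) (+-identityˡ 0#)))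
    where
    agree : ∀ p q {η} → coeff (p ⊖ q) η ≈ 0# → coeff p η ≈ coeff q η
    agree p q {η} e = x∙y⁻¹≈ε⇒x≈y _ _ (trans (sym (lin-⊖ (δ η) p q)) e)

  dual-· : ∀ {n d} a {f g : Polynomial n} → Dual d f g → Dual d (a · f) (a · g)
  dual-· a {f} {g} (dual dg vg) = dual
    (λ η l → trans (lin-⊖ (δ η) (a · g) (a · f)) (x-x≈0 (trans (lin-· (δ η) a g)
      (trans (*-congˡ (x∙y⁻¹≈ε⇒x≈y _ _ (trans (sym (lin-⊖ (δ η) g f)) (dg η l)))) (sym (lin-· (δ η) a f))))))
    (λ γ l → trans (lin-· (mono (negate (bar γ))) a g) (trans (*-congˡ (vg γ l)) (zeroʳ a)))

  ++-congˡ : ∀ {n} {p p′ q : Polynomial n} → p ≋ p′ → p ++ q ≋ p′ ++ q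
  ++-congˡ {p = p} {p′} {q} e = coeffwise λ η →
    trans (lin-++ (δ η) p q) (trans (+-congʳ (coeff≈ e η)) (sym (lin-++ (δ η) p′ q)))

  dual-[] : ∀ {n} d → Dual {n} d [] []
  dual-[] d = dual (λ η l → refl) (λ γ l → refl)

  -- In degree `d` the sign produced by x ↦ -x cancels the prefactor `sign d`; above `d` all
  -- coefficients are zero. This explains the factor (-1)^|η| in F_η and the factor (-1)^|λ| in J_λ.
  top-negArg-Degree< : ∀ {n} d a (p : Polynomial n) → (∀ η → d ℕ.< sum η → coeff p η ≈ 0#) →
    Degree< d ((sign d * a) · negArg p ⊖ a · top d p)
  top-negArg-Degree< d a p dp η l = trans (lin-⊖ (δ η) ((sign d * a) · negArg p) (a · top d p)) (x-x≈0 (begin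
    coeff ((sign d * a) · negArg p) η  ≈⟨ lin-· (δ η) (sign d * a) (negArg p) ⟩
    sign d * a * coeff (negArg p) η  ≈⟨ *-congˡ (coeff-negArg p η) ⟩
    sign d * a * (sign (sum η) * coeff p η)  ≈⟨ same (ℕP.m≤n⇒m<n∨m≡n l) ⟩
    a * coeff (top d p) η  ≈⟨ lin-· (δ η) a (top d p) ⟨
    coeff (a · top d p) η ∎))
    where
    same : d ℕ.< sum η ⊎ d ≡ sum η → sign d * a * (sign (sum η) * coeff p η) ≈ a * coeff (top d p) η
    same (inj₁ d<η) = begin
      sign d * a * (sign (sum η) * coeff p η)  ≈⟨ *-congˡ (trans (*-congˡ (dp η d<η)) (zeroʳ _)) ⟩
      sign d * a * 0#  ≈⟨ zeroʳ _ ⟩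
      0#  ≈⟨ zeroʳ a ⟨
      a * 0#
        ≈⟨ *-congˡ (coeff-restrict-no (λ γ → sum γ ℕP.≟ d) (λ e → ℕP.<⇒≢ d<η (≡.sym e)) p) ⟨
      a * coeff (top d p) η ∎
    same (inj₂ ≡.refl) = begin
      sign d * a * (sign d * coeff p η)
        ≈⟨ solve 3 (λ s a x → s :* a :* (s :* x) := s :* s :* (a :* x)) refl (sign d) a (coeff p η) ⟩
      sign d * sign d * (a * coeff p η)
        ≈⟨ trans (*-congʳ (sign-square d)) (*-identityˡ _) ⟩
      a * coeff p η
        ≈⟨ *-congˡ (coeff-restrict-yes (λ γ → sum γ ℕP.≟ d) ≡.refl p) ⟨
      a * coeff (top d p) η ∎

  eval-·-negArg-negate : ∀ {n} a (p : Polynomial n) x → eval p x ≈ 0# → eval (a · negArg p) (negate x) ≈ 0#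
  eval-·-negArg-negate a p x e = trans (lin-· (mono (negate x)) a (negArg p))
    (trans (*-congˡ (trans (eval-negArg-negate p x) e)) (zeroʳ a))

  dual-E : ∀ {n} a (η : Exponent n) → let P = E (interpolationPoly η) in
    Dual (sum η) (a · top (sum η) P) ((sign (sum η) * a) · negArg P)
  dual-E a η = dual
    (top-negArg-Degree< (sum η) a P (λ ζ l → coeff-above (degree-E (interpolationPoly η)) l))
    (λ γ l → eval-·-negArg-negate (sign (sum η) * a) P (bar γ)
      (vanishing-E (interpolationPoly η) γ (ℕP.<⇒≤ l) (λ { ≡.refl → ℕP.<-irrefl ≡.refl l })))
    where P = E (interpolationPoly η)

  bar-sorted : ∀ {n} (γ : Exponent n) → bar γ ≈ᵛ act (sortPerm γ) (partitionPoint (actInv (sortPerm γ) γ))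
  bar-sorted {n} γ = pointwise λ i → begin
    lookup (bar γ) i
      ≡⟨ VP.lookup-zipWith (λ a k → ι a + ρ * ι k) i γ (ranks (const 0) γ) ⟩
    ι (lookup γ i) + ρ * ι (lookup (ranks (const 0) γ) i)
      ≡⟨ cong₂ (λ a k → ι a + ρ * ι k)
           (≡.trans (cong (lookup γ) (≡.sym (inverseʳ w))) (≡.sym (lookup-actInv w γ (w ⟨$⟩ˡ i))))
           (≡.trans (≡.sym (orders⇒rank w γ (sortPerm-orders γ) i)) (≡.sym (VP.lookup∘tabulate _ (w ⟨$⟩ˡ i)))) ⟩
    ι (lookup μ (w ⟨$⟩ˡ i)) + ρ * ι (lookup (stair n) (w ⟨$⟩ˡ i))
      ≡⟨ VP.lookup-zipWith (λ a k → ι a + ρ * ι k) (w ⟨$⟩ˡ i) μ (stair n) ⟨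
    lookup (partitionPoint μ) (w ⟨$⟩ˡ i)
      ≡⟨ lookup-act w (partitionPoint μ) i ⟨
    lookup (act w (partitionPoint μ)) i ∎
    where
    w = sortPerm γ
    μ = actInv w γ

  symmetricDual⇒dual : ∀ {n d} {f g : Polynomial n} → SymmetricDual d f g → Dual d f g
  symmetricDual⇒dual {d = d} {f} {g} (symmetricDual sg dg vg) = dual dg λ γ l →
    let w = sortPerm γ ; μ = actInv w γ in begin
    eval g (negate (bar γ))  ≈⟨ eval-cong g (negate-cong (bar-sorted γ)) ⟩
    eval g (negate (act w (partitionPoint μ)))
      ≡⟨ cong (eval g) (act-map w (-_) (partitionPoint μ)) ⟩
    eval g (act w (negate (partitionPoint μ)))
      ≈⟨ symmetric⇒eval {p = g} sg w (negate (partitionPoint μ)) ⟩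
    eval g (negate (partitionPoint μ))
      ≈⟨ vg μ (orders⇒partition w γ (sortPerm-orders γ)) (≡.subst (ℕ._< d) (≡.sym (sum-actInv w γ)) l) ⟩
    0# ∎

  -- For d = e + 1 a symmetric correction of degree at most e cancels the values of `f` at the
  -- points -(μ + ρδ) with |μ| ≤ e. It is interpolated at the points μ + ρδ and then reflected by
  -- `negArg`. For d = 0 nothing has to be corrected.
  symmetricDual-exists : ∀ {n} d (f : Polynomial n) → Symmetric f → ∃ λ g → SymmetricDual d f g
  symmetricDual-exists zero    f sf = f , symmetricDual sf (λ η _ → trans (lin-⊖ (δ η) f f) (x-x≈0 refl)) λ _ _ ()
  symmetricDual-exists {n} (suc e) f sf = f ++ negArg q , symmetricDual
    (λ w η → trans (lin-++ (δ (act w η)) f (negArg q)) (trans (+-cong (sf w η) (symmetric-negArg w η)) (sym (lin-++ (δ η) f (negArg q)))))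
    (λ η l → trans (lin-⊖ (δ η) (f ++ negArg q) f) (x-x≈0 (trans (lin-++ (δ η) f (negArg q))
      (trans (+-congˡ (coeff-above {p = negArg q} (AllP.map⁺ (S.degree low)) l)) (+-identityʳ _)))))
    (λ μ part l → begin
      eval (f ++ negArg q) (negate (partitionPoint μ))
        ≈⟨ lin-++ (mono (negate (partitionPoint μ))) f (negArg q) ⟩
      eval f (negate (partitionPoint μ)) + eval (negArg q) (negate (partitionPoint μ))
        ≈⟨ +-congˡ (trans (eval-negArg-negate q (partitionPoint μ)) (S.eval-poly low μ part (ℕP.≤-pred l))) ⟩
      eval f (negate (partitionPoint μ)) - eval f (negate (partitionPoint μ))
        ≈⟨ -‿inverseʳ _ ⟩
      0# ∎)
    where
    low : SymmetricInterpolant n e (λ μ → - eval f (negate (partitionPoint μ)))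
    low = symmetricInterpolate n e _
    q = S.poly low
    symmetric-negArg : Symmetric (negArg q)
    symmetric-negArg w η = trans (coeff-negArg q (act w η))
      (trans (*-cong (reflexive (cong sign (sum-act w η))) (symmetric low w η)) (sym (coeff-negArg q η)))

  -- Lift f to a polynomial vanishing at the nodes of degree < d, and expand the lift in the E_η.
  top-span : ∀ {n} d (f : Polynomial n) → Homogeneous d f → ∃ λ s → All ((λ γ → sum γ ≡ d) ∘ proj₁) s ×
    f ≋ bind (λ γ → top d (E (interpolationPoly γ))) s
  top-span {n} d f hf = s , sum-s , coeffwise λ η → expand η (sum η ℕP.≟ d)
    where
    top? : ∀ γ → Dec (sum γ ≡ d)
    top? γ = sum γ ℕP.≟ d
    P : Exponent n → Polynomial n
    P γ = E (interpolationPoly γ)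
    f′ : Polynomial n
    f′ = restrict top? f
    degree-f′ : Degree≤ d f′
    degree-f′ = All.map ℕP.≤-reflexive (restrict-All top? f)
    Lift : Polynomial n → Set _
    Lift G = Degree≤ d G × (∀ η → sum η ≡ d → coeff G η ≈ coeff f η) × (∀ γ → sum γ ℕ.< d → eval G (bar γ) ≈ 0#)
    lift : ∀ e → e ≡ d → ∃ Lift
    lift zero    ≡.refl = f′ , degree-f′ , (λ η e → coeff-restrict-yes top? e f) , λ _ ()
    lift (suc e) ≡.refl = f′ ++ poly low , degree-++ degree-f′ (degree-weaken (ℕP.n≤1+n e) (degree low)) ,
      (λ η eq → trans (lin-++ (δ η) f′ (poly low)) (trans (+-cong (coeff-restrict-yes top? eq f)
        (coeff-above (degree low) (ℕP.≤-reflexive (≡.sym eq)))) (+-identityʳ _))) ,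
      (λ γ l → trans (lin-++ (mono (bar γ)) f′ (poly low)) (trans (+-congˡ (eval-poly low γ (ℕP.≤-pred l))) (-‿inverseʳ _)))
      where
      low : Interpolant n e (λ γ → - eval f′ (bar γ))
      low = interpolate n e _
    G : Polynomial n
    G = proj₁ (lift d ≡.refl)
    degree-G = proj₁ (proj₂ (lift d ≡.refl))
    coeff-G = proj₁ (proj₂ (proj₂ (lift d ≡.refl)))
    vanishing-G = proj₂ (proj₂ (proj₂ (lift d ≡.refl)))
    weight : Exponent n → Carrier
    -- At γ̄ with |γ| = d only E_γ survives among the E_ζ with |ζ| = d, so its coefficient must be
    -- G(γ̄) / E_γ(γ̄). At nodes of smaller degree both `G` and all these E_ζ vanish.
    weight γ = eval G (bar γ) * proj₁ (invertible-E (interpolationPoly γ))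
    s : Polynomial n
    s = restrict top? (fromCoeffs n d weight)
    sum-s : All ((λ γ → sum γ ≡ d) ∘ proj₁) s
    sum-s = restrict-All top? (fromCoeffs n d weight)
    eval-combination : ∀ γ → sum γ ℕ.≤ d → eval (bind P s) (bar γ) ≈ eval G (bar γ)
    eval-combination γ l with ℕP.m≤n⇒m<n∨m≡n l
    ... | inj₁ γ<d = begin
      eval (bind P s) (bar γ)  ≈⟨ lin-bind (mono (bar γ)) P s ⟩
      lin (λ ζ → eval (P ζ) (bar γ)) s
        ≈⟨ lin-cong-All (λ ζ e → vanishing-E (interpolationPoly ζ) γ (≡.subst (sum γ ℕ.≤_) (≡.sym e) l)
             (λ { ≡.refl → ℕP.<-irrefl e γ<d })) sum-s ⟩
      lin (λ _ → 0#) s  ≈⟨ lin-zero s ⟩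
      0#  ≈⟨ vanishing-G γ γ<d ⟨
      eval G (bar γ) ∎
    ... | inj₂ γ≡d = begin
      eval (bind P s) (bar γ)  ≈⟨ lin-bind (mono (bar γ)) P s ⟩
      lin (λ ζ → eval (P ζ) (bar γ)) s  ≈⟨ lin-cong-All diagonal sum-s ⟩
      lin (λ ζ → x * δ γ ζ) s  ≈⟨ lin-* (δ γ) x s ⟩
      x * coeff s γ
        ≈⟨ *-congˡ (trans (coeff-restrict-yes top? γ≡d (fromCoeffs n d weight)) (coeff-fromCoeffs n d weight γ l)) ⟩
      x * (eval G (bar γ) * y)
        ≈⟨ solve 3 (λ x g y → x :* (g :* y) := g :* (x :* y)) refl x (eval G (bar γ)) y ⟩
      eval G (bar γ) * (x * y)
        ≈⟨ trans (*-congˡ (proj₂ (invertible-E (interpolationPoly γ)))) (*-identityʳ _) ⟩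
      eval G (bar γ) ∎
      where
      x = eval (P γ) (bar γ)
      y = proj₁ (invertible-E (interpolationPoly γ))
      diagonal : ∀ ζ → sum ζ ≡ d → eval (P ζ) (bar γ) ≈ x * δ γ ζ
      diagonal ζ e with ζ ≟ᵉ γ
      ... | yes ≡.refl = sym (*-identityʳ x)
      ... | no ne = trans (vanishing-E (interpolationPoly ζ) γ (≡.subst (sum γ ℕ.≤_) (≡.sym e) l) (ne ∘ ≡.sym)) (sym (zeroʳ x))
    degree-combination : Degree≤ d (bind P s)
    degree-combination = go sum-s
      where
      go : ∀ {s} → All ((λ γ → sum γ ≡ d) ∘ proj₁) s → Degree≤ d (bind P s)
      go []                          = []
      go (_∷_ {x = (γ , a)} e es) =
        degree-++ (degree-· a (≡.subst (λ k → Degree≤ k (P γ)) e (degree-E (interpolationPoly γ)))) (go es)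
    G≋combination : G ≋ bind P s
    G≋combination = ⊖-null⇒≋ (vanishing⇒null n d (G ⊖ bind P s) (degree-⊖ degree-G degree-combination) λ γ l →
      trans (lin-⊖ (mono (bar γ)) G (bind P s)) (x-x≈0 (sym (eval-combination γ l))))
    expand : ∀ η → Dec (sum η ≡ d) → coeff f η ≈ coeff (bind (λ γ → top d (P γ)) s) η
    expand η (yes e) = begin
      coeff f η  ≈⟨ coeff-G η e ⟨
      coeff G η  ≈⟨ coeff≈ G≋combination η ⟩
      coeff (bind P s) η  ≈⟨ lin-bind (δ η) P s ⟩
      lin (λ γ → coeff (P γ) η) s
        ≈⟨ lin-cong (λ γ → coeff-restrict-yes top? e (P γ)) s ⟨
      lin (λ γ → coeff (top d (P γ)) η) s  ≈⟨ lin-bind (δ η) (λ γ → top d (P γ)) s ⟨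
      coeff (bind (λ γ → top d (P γ)) s) η ∎
    expand η (no ne) = begin
      coeff f η  ≈⟨ hf η ne ⟩
      0#  ≈⟨ lin-zero s ⟨
      lin (λ _ → 0#) s
        ≈⟨ lin-cong (λ γ → coeff-restrict-no top? ne (P γ)) s ⟨
      lin (λ γ → coeff (top d (P γ)) η) s  ≈⟨ lin-bind (δ η) (λ γ → top d (P γ)) s ⟨
      coeff (bind (λ γ → top d (P γ)) s) η ∎

  module _ {n} (Ξ : Polynomial n → Polynomial n)
    (Ξ-cong : ∀ {p q} → p ≋ q → Ξ p ≋ Ξ q)
    (Ξ-++ : ∀ p q → Ξ (p ++ q) ≋ Ξ p ++ Ξ q)
    (Ξ-· : ∀ a p → Ξ (a · p) ≋ a · Ξ p)
    (norm : Exponent n → Carrier) (norm⁻¹ : ∀ η → ∃ λ y → norm η * y ≈ 1#)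
    (Ξ-E : ∀ η → Ξ (norm η · top (sum η) (E (interpolationPoly η)))
                 ≋ (sign (sum η) * norm η) · negArg (E (interpolationPoly η))) where

    Ξ-[] : Ξ [] ≋ []
    Ξ-[] = ≋-trans (Ξ-· 0# []) (coeffwise λ η → trans (lin-· (δ η) 0# (Ξ [])) (zeroˡ _))

    -- `norm` stands for d_η. By `Ξ-E` and `dual-E` the claim holds for `norm η` times the top
    -- component, and multiplication by the inverse of `norm η` commutes with Ξ.
    dual-top-E : ∀ η → Dual (sum η) (top (sum η) (E (interpolationPoly η))) (Ξ (top (sum η) (E (interpolationPoly η))))
    dual-top-E η = dual-cong normalise (≋-trans (≋-sym (Ξ-· y (norm η · T))) (Ξ-cong normalise))
      (dual-· y (dual-cong ≋-refl (≋-sym (Ξ-E η)) (dual-E (norm η) η)))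
      where
      T = top (sum η) (E (interpolationPoly η))
      y = proj₁ (norm⁻¹ η)
      normalise : y · norm η · T ≋ T
      normalise = coeffwise λ ζ → begin
        coeff (y · norm η · T) ζ  ≈⟨ lin-· (δ ζ) y (norm η · T) ⟩
        y * coeff (norm η · T) ζ  ≈⟨ *-congˡ (lin-· (δ ζ) (norm η) T) ⟩
        y * (norm η * coeff T ζ)
          ≈⟨ solve 3 (λ y d t → y :* (d :* t) := d :* y :* t) refl y (norm η) (coeff T ζ) ⟩
        norm η * y * coeff T ζ  ≈⟨ trans (*-congʳ (proj₂ (norm⁻¹ η))) (*-identityˡ _) ⟩
        coeff T ζ ∎

    -- `Dual d` is closed under sums and scalar multiples taken in both arguments simultaneously, so
    -- it extends from the spanning top components to all homogeneous polynomials of degree `d`.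
    dual-Ξ : ∀ d f → Homogeneous d f → Dual d f (Ξ f)
    dual-Ξ d f hf with top-span d f hf
    ... | s , sum-s , e = dual-cong (≋-sym e) (Ξ-cong (≋-sym e)) (combine sum-s)
      where
      combine : ∀ {s} → All ((λ γ → sum γ ≡ d) ∘ proj₁) s →
        let b = bind (λ γ → top d (E (interpolationPoly γ))) s in Dual d b (Ξ b)
      combine [] = dual-cong ≋-refl (≋-sym Ξ-[]) (dual-[] d)
      combine (_∷_ {x = (γ , a)} {xs = s} ≡.refl es) = dual-cong ≋-refl
        (≋-sym (≋-trans (Ξ-++ (a · T) b) (++-congˡ (Ξ-· a T))))
        (dual-++ (dual-· a (dual-top-E γ)) (combine es))
        where
        T = top d (E (interpolationPoly γ))
        b = bind (λ γ → top d (E (interpolationPoly γ))) s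

    symmetricDual-unique : ∀ d f → Homogeneous d f → ∀ h → SymmetricDual d f h → h ≋ Ξ f
    symmetricDual-unique d f hf h ch = dual-unique d {f} (symmetricDual⇒dual ch) (dual-Ξ d f hf)

    symmetricDual-Ξ : ∀ d f → Homogeneous d f → Symmetric f → SymmetricDual d f (Ξ f)
    symmetricDual-Ξ d f hf sf with symmetricDual-exists d f sf
    ... | g , cg = symmetricDual-cong (symmetricDual-unique d f hf g cg) cg

    -- The characterisation concerns homogeneous polynomials, so `f` is built up one homogeneous
    -- component at a time. The components are symmetric because permuting an exponent preserves its
    -- sum, and Ξ is additive.
    Ξ-symmetric : ∀ f → Symmetric f → Symmetric (Ξ f)
    Ξ-symmetric f sf = ≋-symmetric (Ξ-cong whole) (below (suc D))
      where
      D = proj₁ (degree-bound f)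
      <? : ∀ k γ → Dec (sum γ ℕ.< k)
      <? k γ = sum γ ℕP.<? k
      ≋-symmetric : ∀ {p q : Polynomial n} → p ≋ q → Symmetric p → Symmetric q
      ≋-symmetric e sp w η = trans (sym (coeff≈ e (act w η))) (trans (sp w η) (coeff≈ e η))
      whole : restrict (<? (suc D)) f ≋ f
      whole = restrict-≋ (<? (suc D)) (λ η l → coeff-above (proj₂ (degree-bound f)) (ℕP.≮⇒≥ l))
      symmetric-top : ∀ k → Symmetric (top k f)
      symmetric-top k w η = by (sum η ℕP.≟ k)
        where
        by : Dec (sum η ≡ k) → coeff (top k f) (act w η) ≈ coeff (top k f) η
        by (yes e) = trans (coeff-restrict-yes (λ γ → sum γ ℕP.≟ k) (≡.trans (sum-act w η) e) f)
          (trans (sf w η) (sym (coeff-restrict-yes (λ γ → sum γ ℕP.≟ k) e f)))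
        by (no ne) = trans (coeff-restrict-no (λ γ → sum γ ℕP.≟ k) (ne ∘ ≡.trans (≡.sym (sum-act w η))) f)
          (sym (coeff-restrict-no (λ γ → sum γ ℕP.≟ k) ne f))
      split : ∀ k → restrict (<? (suc k)) f ≋ restrict (<? k) f ++ top k f
      split k = coeffwise λ η → trans (by η (ℕP.<-cmp (sum η) k)) (sym (lin-++ (δ η) (restrict (<? k) f) (top k f)))
        where
        by : ∀ η → Tri (sum η ℕ.< k) (sum η ≡ k) (k ℕ.< sum η) →
          coeff (restrict (<? (suc k)) f) η ≈ coeff (restrict (<? k) f) η + coeff (top k f) η
        by η (tri< l ne _) = trans (coeff-restrict-yes (<? (suc k)) (ℕP.m<n⇒m<1+n l) f) (sym (trans
          (+-cong (coeff-restrict-yes (<? k) l f) (coeff-restrict-no (λ γ → sum γ ℕP.≟ k) ne f)) (+-identityʳ _)))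
        by η (tri≈ nl e _) = trans (coeff-restrict-yes (<? (suc k)) (s≤s (ℕP.≤-reflexive e)) f) (sym (trans
          (+-cong (coeff-restrict-no (<? k) nl f) (coeff-restrict-yes (λ γ → sum γ ℕP.≟ k) e f)) (+-identityˡ _)))
        by η (tri> nl ne g) = trans (coeff-restrict-no (<? (suc k)) (ℕP.≤⇒≯ g) f) (sym (trans
          (+-cong (coeff-restrict-no (<? k) nl f) (coeff-restrict-no (λ γ → sum γ ℕP.≟ k) ne f)) (+-identityˡ _)))
      below : ∀ k → Symmetric (Ξ (restrict (<? k) f))
      below zero    = ≋-symmetric (≋-trans (≋-sym Ξ-[])
        (Ξ-cong (coeffwise λ η → sym (coeff-restrict-no (<? 0) (λ ()) f)))) (λ _ _ → refl)
      below (suc k) = ≋-symmetric (≋-trans (≋-sym (Ξ-++ (restrict (<? k) f) (top k f))) (Ξ-cong (≋-sym (split k))))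
        (symmetric-++ {p = Ξ (restrict (<? k) f)} {Ξ (top k f)} (below k)
          (SymmetricDual.symmetric-dual (symmetricDual-Ξ k (top k f) (λ η ne → coeff-restrict-no (λ γ → sum γ ℕP.≟ k) ne f) (symmetric-top k))))

    -- The right-hand side is symmetric, has `a · top d P` as its component of degree `d`, and
    -- inherits from `P` the zeros at -(μ + ρδ); uniqueness identifies it with the image under Ξ. No
    -- expansion of P_λ in the E_η has to be computed.
    Ξ-top : ∀ d a (P : Polynomial n) → Symmetric P → (∀ η → d ℕ.< sum η → coeff P η ≈ 0#) →
      (∀ μ → IsPartition μ → sum μ ℕ.< d → eval P (partitionPoint μ) ≈ 0#) →
      Ξ (a · top d P) ≋ (sign d * a) · negArg P
    Ξ-top d a P sP dP vP = ≋-sym (symmetricDual-unique d (a · top d P)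
      (λ η ne → trans (lin-· (δ η) a (top d P)) (trans (*-congˡ (coeff-restrict-no (λ γ → sum γ ℕP.≟ d) ne P)) (zeroʳ a)))
      ((sign d * a) · negArg P)
      (symmetricDual
        (λ w η → trans (coeff-image (act w η)) (trans
          (*-congˡ (*-cong (reflexive (cong sign (sum-act w η))) (sP w η))) (sym (coeff-image η))))
        (top-negArg-Degree< d a P dP)
        (λ μ part l → eval-·-negArg-negate (sign d * a) P (partitionPoint μ) (vP μ part l))))
      where
      coeff-image : ∀ η → coeff ((sign d * a) · negArg P) η ≈ sign d * a * (sign (sum η) * coeff P η)
      coeff-image η = trans (lin-· (δ η) (sign d * a) (negArg P)) (*-congˡ (coeff-negArg P η))

open import Defs

-- The field ℚ(r)

module PolyRing where
  open ≡ using (refl; sym; trans)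
  open QS.+-*-Solver using (solve; _:+_; _:*_; con; _:=_)

  -- A record instead of the Π-type ≈₁, so that p and q can be inferred.
  record _≃₁_ (p q : Poly1) : Set where
    constructor coeffs
    field coeff≡ : p ≈₁ q
  open _≃₁_ public

  coeffAt-add₁ : ∀ p q k → coeffAt (add₁ p q) k ≡ coeffAt p k Q.+ coeffAt q k
  coeffAt-add₁ []      q       k       = sym (QP.+-identityˡ _)
  coeffAt-add₁ (a ∷ p) []      k       = sym (QP.+-identityʳ _)
  coeffAt-add₁ (a ∷ p) (b ∷ q) zero    = refl
  coeffAt-add₁ (a ∷ p) (b ∷ q) (suc k) = coeffAt-add₁ p q k

  coeffAt-scale : ∀ a p k → coeffAt (L.map (a Q.*_) p) k ≡ a Q.* coeffAt p k
  coeffAt-scale a []      k       = sym (QP.*-zeroʳ a)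
  coeffAt-scale a (b ∷ p) zero    = refl
  coeffAt-scale a (b ∷ p) (suc k) = coeffAt-scale a p k

  coeffAt-neg₁ : ∀ p k → coeffAt (neg₁ p) k ≡ Q.- coeffAt p k
  coeffAt-neg₁ []      k       = refl
  coeffAt-neg₁ (b ∷ p) zero    = refl
  coeffAt-neg₁ (b ∷ p) (suc k) = coeffAt-neg₁ p k

  coeffAt-mul₁ : ∀ a p q k →
    coeffAt (mul₁ (a ∷ p) q) k ≡ a Q.* coeffAt q k Q.+ coeffAt (0ℚ ∷ mul₁ p q) k
  coeffAt-mul₁ a p q k = trans (coeffAt-add₁ (L.map (a Q.*_) q) (0ℚ ∷ mul₁ p q) k)
                               (cong (Q._+ _) (coeffAt-scale a q k))

  mul₁-zeroʳ : ∀ p → mul₁ p [] ≈₁ []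
  mul₁-zeroʳ []      k       = refl
  mul₁-zeroʳ (a ∷ p) zero    = refl
  mul₁-zeroʳ (a ∷ p) (suc k) = mul₁-zeroʳ p k

  -- `mul₁` recurses on its left factor. This is the matching recursion on the right factor, from
  -- which commutativity follows by induction.
  mul₁-∷ʳ : ∀ p b q → mul₁ p (b ∷ q) ≈₁ add₁ (L.map (b Q.*_) p) (0ℚ ∷ mul₁ p q)
  mul₁-∷ʳ []      b q zero    = refl
  mul₁-∷ʳ []      b q (suc k) = refl
  mul₁-∷ʳ (a ∷ p) b q zero    = cong (Q._+ 0ℚ) (QP.*-comm a b)
  mul₁-∷ʳ (a ∷ p) b q (suc k) = begin
    coeffAt (mul₁ (a ∷ p) (b ∷ q)) (suc k)
      ≡⟨ coeffAt-mul₁ a p (b ∷ q) (suc k) ⟩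
    a Q.* coeffAt q k Q.+ coeffAt (mul₁ p (b ∷ q)) k
      ≡⟨ cong (a Q.* coeffAt q k Q.+_) (mul₁-∷ʳ p b q k) ⟩
    a Q.* coeffAt q k Q.+ coeffAt (add₁ (L.map (b Q.*_) p) (0ℚ ∷ mul₁ p q)) k
      ≡⟨ cong (a Q.* coeffAt q k Q.+_) (coeffAt-add₁ (L.map (b Q.*_) p) (0ℚ ∷ mul₁ p q) k) ⟩
    a Q.* coeffAt q k Q.+ (coeffAt (L.map (b Q.*_) p) k Q.+ coeffAt (0ℚ ∷ mul₁ p q) k)
      ≡⟨ solve 3 (λ x y z → x :+ (y :+ z) := y :+ (x :+ z)) refl
           (a Q.* coeffAt q k) (coeffAt (L.map (b Q.*_) p) k) (coeffAt (0ℚ ∷ mul₁ p q) k) ⟩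
    coeffAt (L.map (b Q.*_) p) k Q.+ (a Q.* coeffAt q k Q.+ coeffAt (0ℚ ∷ mul₁ p q) k)
      ≡⟨ cong (coeffAt (L.map (b Q.*_) p) k Q.+_) (sym (coeffAt-mul₁ a p q k)) ⟩
    coeffAt (L.map (b Q.*_) p) k Q.+ coeffAt (mul₁ (a ∷ p) q) k
      ≡⟨ sym (coeffAt-add₁ (L.map (b Q.*_) p) (mul₁ (a ∷ p) q) k) ⟩
    coeffAt (add₁ (L.map (b Q.*_) p) (mul₁ (a ∷ p) q)) k ∎
    where open ≡.≡-Reasoning

  ∷-cong : ∀ {a p q} → p ≈₁ q → (a ∷ p) ≈₁ (a ∷ q)
  ∷-cong e zero    = refl
  ∷-cong e (suc k) = e k

  mul₁-comm : ∀ p q → mul₁ p q ≈₁ mul₁ q p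
  mul₁-comm []      q k = sym (mul₁-zeroʳ q k)
  mul₁-comm (a ∷ p) q k = begin
    coeffAt (mul₁ (a ∷ p) q) k
      ≡⟨ coeffAt-add₁ (L.map (a Q.*_) q) (0ℚ ∷ mul₁ p q) k ⟩
    coeffAt (L.map (a Q.*_) q) k Q.+ coeffAt (0ℚ ∷ mul₁ p q) k
      ≡⟨ cong (coeffAt (L.map (a Q.*_) q) k Q.+_) (∷-cong (mul₁-comm p q) k) ⟩
    coeffAt (L.map (a Q.*_) q) k Q.+ coeffAt (0ℚ ∷ mul₁ q p) k
      ≡⟨ sym (coeffAt-add₁ (L.map (a Q.*_) q) (0ℚ ∷ mul₁ q p) k) ⟩
    coeffAt (add₁ (L.map (a Q.*_) q) (0ℚ ∷ mul₁ q p)) k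
      ≡⟨ sym (mul₁-∷ʳ q a p k) ⟩
    coeffAt (mul₁ q (a ∷ p)) k ∎
    where open ≡.≡-Reasoning

  mul₁-congˡ : ∀ p {q q'} → q ≈₁ q' → mul₁ p q ≈₁ mul₁ p q'
  mul₁-congˡ []      e k = refl
  mul₁-congˡ (a ∷ p) {q} {q'} e k =
    trans (coeffAt-mul₁ a p q k)
      (trans (cong₂ Q._+_ (cong (a Q.*_) (e k)) (∷-cong (mul₁-congˡ p e) k))
             (sym (coeffAt-mul₁ a p q' k)))

  mul₁-cong : ∀ {p p' q q'} → p ≈₁ p' → q ≈₁ q' → mul₁ p q ≈₁ mul₁ p' q'
  mul₁-cong {p} {p'} {q} {q'} e f k =
    trans (mul₁-congˡ p f k) (trans (mul₁-comm p q' k)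
      (trans (mul₁-congˡ q' e k) (mul₁-comm q' p' k)))

  add₁-cong : ∀ {p p' q q'} → p ≈₁ p' → q ≈₁ q' → add₁ p q ≈₁ add₁ p' q'
  add₁-cong {p} {p'} {q} {q'} e f k =
    trans (coeffAt-add₁ p q k) (trans (cong₂ Q._+_ (e k) (f k)) (sym (coeffAt-add₁ p' q' k)))

  mul₁-distribˡ : ∀ p q s → mul₁ p (add₁ q s) ≈₁ add₁ (mul₁ p q) (mul₁ p s)
  mul₁-distribˡ []      q s k = refl
  mul₁-distribˡ (a ∷ p) q s k = begin
    coeffAt (mul₁ (a ∷ p) (add₁ q s)) k
      ≡⟨ coeffAt-mul₁ a p (add₁ q s) k ⟩
    a Q.* coeffAt (add₁ q s) k Q.+ coeffAt (0ℚ ∷ mul₁ p (add₁ q s)) k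
      ≡⟨ cong₂ (λ x y → a Q.* x Q.+ y) (coeffAt-add₁ q s k) (shifted k) ⟩
    a Q.* (coeffAt q k Q.+ coeffAt s k)
      Q.+ (coeffAt (0ℚ ∷ mul₁ p q) k Q.+ coeffAt (0ℚ ∷ mul₁ p s) k)
      ≡⟨ solve 5 (λ a x y z w → a :* (x :+ y) :+ (z :+ w) := (a :* x :+ z) :+ (a :* y :+ w))
           refl a _ _ _ _ ⟩
    (a Q.* coeffAt q k Q.+ coeffAt (0ℚ ∷ mul₁ p q) k)
      Q.+ (a Q.* coeffAt s k Q.+ coeffAt (0ℚ ∷ mul₁ p s) k)
      ≡⟨ sym (cong₂ Q._+_ (coeffAt-mul₁ a p q k) (coeffAt-mul₁ a p s k)) ⟩
    coeffAt (mul₁ (a ∷ p) q) k Q.+ coeffAt (mul₁ (a ∷ p) s) k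
      ≡⟨ sym (coeffAt-add₁ (mul₁ (a ∷ p) q) (mul₁ (a ∷ p) s) k) ⟩
    coeffAt (add₁ (mul₁ (a ∷ p) q) (mul₁ (a ∷ p) s)) k ∎
    where
    open ≡.≡-Reasoning
    shifted : ∀ k → coeffAt (0ℚ ∷ mul₁ p (add₁ q s)) k
                    ≡ coeffAt (0ℚ ∷ mul₁ p q) k Q.+ coeffAt (0ℚ ∷ mul₁ p s) k
    shifted zero    = refl
    shifted (suc k) = trans (mul₁-distribˡ p q s k) (coeffAt-add₁ (mul₁ p q) (mul₁ p s) k)

  mul₁-distribʳ : ∀ s p q → mul₁ (add₁ p q) s ≈₁ add₁ (mul₁ p s) (mul₁ q s)
  mul₁-distribʳ s p q k =
    trans (mul₁-comm (add₁ p q) s k) (trans (mul₁-distribˡ s p q k)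
      (add₁-cong {mul₁ s p} {mul₁ p s} {mul₁ s q} {mul₁ q s} (mul₁-comm s p) (mul₁-comm s q) k))

  mul₁-shift : ∀ p q → mul₁ (0ℚ ∷ p) q ≈₁ (0ℚ ∷ mul₁ p q)
  mul₁-shift p q k = trans (coeffAt-mul₁ 0ℚ p q k)
    (solve 2 (λ x y → con 0ℚ :* x :+ y := y) refl (coeffAt q k) (coeffAt (0ℚ ∷ mul₁ p q) k))

  mul₁-scale : ∀ a p q → mul₁ (L.map (a Q.*_) p) q ≈₁ L.map (a Q.*_) (mul₁ p q)
  mul₁-scale a []      q k = refl
  mul₁-scale a (b ∷ p) q k = begin
    coeffAt (mul₁ (a Q.* b ∷ L.map (a Q.*_) p) q) k
      ≡⟨ coeffAt-mul₁ (a Q.* b) (L.map (a Q.*_) p) q k ⟩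
    a Q.* b Q.* coeffAt q k Q.+ coeffAt (0ℚ ∷ mul₁ (L.map (a Q.*_) p) q) k
      ≡⟨ cong (a Q.* b Q.* coeffAt q k Q.+_) (shifted k) ⟩
    a Q.* b Q.* coeffAt q k Q.+ a Q.* coeffAt (0ℚ ∷ mul₁ p q) k
      ≡⟨ solve 4 (λ a b x y → a :* b :* x :+ a :* y := a :* (b :* x :+ y)) refl a b _ _ ⟩
    a Q.* (b Q.* coeffAt q k Q.+ coeffAt (0ℚ ∷ mul₁ p q) k)
      ≡⟨ cong (a Q.*_) (sym (coeffAt-mul₁ b p q k)) ⟩
    a Q.* coeffAt (mul₁ (b ∷ p) q) k
      ≡⟨ sym (coeffAt-scale a (mul₁ (b ∷ p) q) k) ⟩
    coeffAt (L.map (a Q.*_) (mul₁ (b ∷ p) q)) k ∎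
    where
    open ≡.≡-Reasoning
    shifted : ∀ k → coeffAt (0ℚ ∷ mul₁ (L.map (a Q.*_) p) q) k ≡ a Q.* coeffAt (0ℚ ∷ mul₁ p q) k
    shifted zero    = sym (QP.*-zeroʳ a)
    shifted (suc k) = trans (mul₁-scale a p q k) (coeffAt-scale a (mul₁ p q) k)

  mul₁-assoc : ∀ p q s → mul₁ (mul₁ p q) s ≈₁ mul₁ p (mul₁ q s)
  mul₁-assoc []      q s k = refl
  mul₁-assoc (a ∷ p) q s k = begin
    coeffAt (mul₁ (add₁ (L.map (a Q.*_) q) (0ℚ ∷ mul₁ p q)) s) k
      ≡⟨ mul₁-distribʳ s (L.map (a Q.*_) q) (0ℚ ∷ mul₁ p q) k ⟩
    coeffAt (add₁ (mul₁ (L.map (a Q.*_) q) s) (mul₁ (0ℚ ∷ mul₁ p q) s)) k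
      ≡⟨ add₁-cong {mul₁ (L.map (a Q.*_) q) s} {L.map (a Q.*_) (mul₁ q s)}
             {mul₁ (0ℚ ∷ mul₁ p q) s} {0ℚ ∷ mul₁ (mul₁ p q) s}
           (mul₁-scale a q s) (mul₁-shift (mul₁ p q) s) k ⟩
    coeffAt (add₁ (L.map (a Q.*_) (mul₁ q s)) (0ℚ ∷ mul₁ (mul₁ p q) s)) k
      ≡⟨ add₁-cong {L.map (a Q.*_) (mul₁ q s)} {L.map (a Q.*_) (mul₁ q s)}
             {0ℚ ∷ mul₁ (mul₁ p q) s} {0ℚ ∷ mul₁ p (mul₁ q s)}
             (λ _ → refl) (∷-cong {0ℚ} {mul₁ (mul₁ p q) s} (mul₁-assoc p q s)) k ⟩
    coeffAt (mul₁ (a ∷ p) (mul₁ q s)) k ∎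
    where open ≡.≡-Reasoning

  mul₁-identityˡ : ∀ p → mul₁ (1ℚ ∷ []) p ≈₁ p
  mul₁-identityˡ p k = trans (coeffAt-mul₁ 1ℚ [] p k) (lem k)
    where
    lem : ∀ k → 1ℚ Q.* coeffAt p k Q.+ coeffAt (0ℚ ∷ []) k ≡ coeffAt p k
    lem zero    = trans (QP.+-identityʳ _) (QP.*-identityˡ _)
    lem (suc k) = trans (QP.+-identityʳ _) (QP.*-identityˡ _)

  polyRing : CommutativeRing 0ℓ 0ℓ
  polyRing = record
    { Carrier = Poly1
    ; _≈_ = _≃₁_
    ; _+_ = add₁ ; _*_ = mul₁ ; -_ = neg₁ ; 0# = [] ; 1# = 1ℚ ∷ []
    ; isCommutativeRing = record
      { isRing = record
        { +-isAbelianGroup = record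
          { isGroup = record
            { isMonoid = record
              { isSemigroup = record
                { isMagma = record
                  { isEquivalence = record
                    { refl  = coeffs λ _ → refl
                    ; sym   = λ e → coeffs λ k → sym (coeff≡ e k)
                    ; trans = λ e f → coeffs λ k → trans (coeff≡ e k) (coeff≡ f k) }
                  ; ∙-cong = λ {p} {p'} {q} {q'} e f →
                      coeffs (add₁-cong {p} {p'} {q} {q'} (coeff≡ e) (coeff≡ f)) }
                ; assoc = λ p q s → coeffs λ k → begin
                    coeffAt (add₁ (add₁ p q) s) k  ≡⟨ coeffAt-add₁ (add₁ p q) s k ⟩
                    coeffAt (add₁ p q) k Q.+ coeffAt s k
                      ≡⟨ cong (Q._+ _) (coeffAt-add₁ p q k) ⟩
                    coeffAt p k Q.+ coeffAt q k Q.+ coeffAt s k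
                      ≡⟨ QP.+-assoc (coeffAt p k) (coeffAt q k) (coeffAt s k) ⟩
                    coeffAt p k Q.+ (coeffAt q k Q.+ coeffAt s k)
                      ≡⟨ cong (coeffAt p k Q.+_) (sym (coeffAt-add₁ q s k)) ⟩
                    coeffAt p k Q.+ coeffAt (add₁ q s) k
                      ≡⟨ sym (coeffAt-add₁ p (add₁ q s) k) ⟩
                    coeffAt (add₁ p (add₁ q s)) k ∎ }
              ; identity = (λ p → coeffs λ _ → refl)
                         , (λ p → coeffs λ k → trans (coeffAt-add₁ p [] k) (QP.+-identityʳ _)) }
            ; inverse = (λ p → coeffs λ k → trans (coeffAt-add₁ (neg₁ p) p k)
                           (trans (cong (Q._+ coeffAt p k) (coeffAt-neg₁ p k)) (QP.+-inverseˡ (coeffAt p k))))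
                      , (λ p → coeffs λ k → trans (coeffAt-add₁ p (neg₁ p) k)
                           (trans (cong (coeffAt p k Q.+_) (coeffAt-neg₁ p k)) (QP.+-inverseʳ (coeffAt p k))))
            ; ⁻¹-cong = λ {p} {q} e → coeffs λ k →
                trans (coeffAt-neg₁ p k) (trans (cong Q.-_ (coeff≡ e k)) (sym (coeffAt-neg₁ q k))) }
          ; comm = λ p q → coeffs λ k →
              trans (coeffAt-add₁ p q k) (trans (QP.+-comm (coeffAt p k) (coeffAt q k)) (sym (coeffAt-add₁ q p k))) }
        ; *-cong = λ {p} {p'} {q} {q'} e f → coeffs (mul₁-cong {p} {p'} {q} {q'} (coeff≡ e) (coeff≡ f))
        ; *-assoc = λ p q s → coeffs (mul₁-assoc p q s)
        ; *-identity = (λ p → coeffs (mul₁-identityˡ p))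
                     , (λ p → coeffs λ k → trans (mul₁-comm p (1ℚ ∷ []) k) (mul₁-identityˡ p k))
        ; distrib = (λ p q s → coeffs (mul₁-distribˡ p q s)) , (λ p q s → coeffs (mul₁-distribʳ p q s)) }
      ; *-comm = λ p q → coeffs (mul₁-comm p q) } }
    where open ≡.≡-Reasoning

-- The local ring of fractions regular at r = 0

module RegularAtZero {c ℓ} (K : CommutativeRing c ℓ) (embed : Poly1 → CommutativeRing.Carrier K)
  (embed-hom : IsRingHomomorphism (CommutativeRing.rawRing PolyRing.polyRing) (CommutativeRing.rawRing K) embed)
  (embed-injective : ∀ {p q} → CommutativeRing._≈_ K (embed p) (embed q) → p PolyRing.≃₁ q)
  (zero⊎invertible : RingIdentities.ZeroOrInvertible K) where
  open CommutativeRing K hiding (zero; _-_) renaming (_≈_ to _≈ᴷ_)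
  open PolyRing
  open RingIdentities K
  open import Algebra.Properties.Ring ring using (-‿distribˡ-*)
  open IsRingHomomorphism embed-hom using () renaming (*-homo to embed-*; +-homo to embed-+; -‿homo to embed-neg; 1#-homo to embed-1; 0#-homo to embed-0)
  open import Relation.Binary.Reasoning.Setoid setoid
  private module P = CommutativeRing polyRing

  const-* : ∀ p q → coeffAt (mul₁ p q) 0 ≡ coeffAt p 0 Q.* coeffAt q 0
  const-* []      q = ≡.sym (QP.*-zeroˡ (coeffAt q 0))
  const-* (a ∷ p) q = ≡.trans (coeffAt-mul₁ a p q 0) (QP.+-identityʳ _)

  -- x is a fraction p / q whose denominator does not vanish at r = 0, normalised to q(0) = 1.
  record Regular (x : Carrier) : Set ℓ where
    field
      p q      : Poly1
      const-q  : coeffAt q 0 ≡ 1ℚ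
      fraction : x * embed q ≈ᴷ embed p
  open Regular

  -- Thanks to the normalisation q(0) = 1 the value of p / q at r = 0 is p(0), without a division.
  valueAt0 : ∀ {x} → Regular x → ℚ
  valueAt0 R = coeffAt (p R) 0

  regular-≈embed : ∀ {x} p → x ≈ᴷ embed p → Regular x
  regular-≈embed p e = record { p = p ; q = 1ℚ ∷ [] ; const-q = ≡.refl
    ; fraction = trans (*-congˡ embed-1) (trans (*-identityʳ _) e) }

  const-*-1 : ∀ u v → coeffAt u 0 ≡ 1ℚ → coeffAt v 0 ≡ 1ℚ → coeffAt (mul₁ u v) 0 ≡ 1ℚ
  const-*-1 u v e f = ≡.trans (const-* u v) (cong₂ Q._*_ e f)

  regular-+ : ∀ {x y} → Regular x → Regular y → Regular (x + y)
  regular-+ {x} {y} R S = record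
    { p = add₁ (mul₁ (p R) (q S)) (mul₁ (p S) (q R)) ; q = mul₁ (q R) (q S)
    ; const-q = const-*-1 (q R) (q S) (const-q R) (const-q S)
    ; fraction = begin
        (x + y) * embed (mul₁ (q R) (q S))  ≈⟨ *-congˡ (embed-* (q R) (q S)) ⟩
        (x + y) * (embed (q R) * embed (q S))
          ≈⟨ sum-fraction x y (embed (q R)) (embed (q S)) ⟩
        x * embed (q R) * embed (q S) + y * embed (q S) * embed (q R)
          ≈⟨ +-cong (*-congʳ (fraction R)) (*-congʳ (fraction S)) ⟩
        embed (p R) * embed (q S) + embed (p S) * embed (q R)
          ≈⟨ +-cong (embed-* (p R) (q S)) (embed-* (p S) (q R)) ⟨
        embed (mul₁ (p R) (q S)) + embed (mul₁ (p S) (q R))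
          ≈⟨ embed-+ (mul₁ (p R) (q S)) (mul₁ (p S) (q R)) ⟨
        embed (add₁ (mul₁ (p R) (q S)) (mul₁ (p S) (q R))) ∎ }

  regular-* : ∀ {x y} → Regular x → Regular y → Regular (x * y)
  regular-* {x} {y} R S = record
    { p = mul₁ (p R) (p S) ; q = mul₁ (q R) (q S)
    ; const-q = const-*-1 (q R) (q S) (const-q R) (const-q S)
    ; fraction = begin
        x * y * embed (mul₁ (q R) (q S))  ≈⟨ *-congˡ (embed-* (q R) (q S)) ⟩
        x * y * (embed (q R) * embed (q S))
          ≈⟨ *-interchange x y (embed (q R)) (embed (q S)) ⟩
        (x * embed (q R)) * (y * embed (q S))  ≈⟨ *-cong (fraction R) (fraction S) ⟩
        embed (p R) * embed (p S)  ≈⟨ embed-* (p R) (p S) ⟨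
        embed (mul₁ (p R) (p S)) ∎ }

  regular-neg : ∀ {x} → Regular x → Regular (- x)
  regular-neg {x} R = record
    { p = neg₁ (p R) ; q = q R ; const-q = const-q R
    ; fraction = trans (sym (-‿distribˡ-* x (embed (q R)))) (trans (-‿cong (fraction R)) (sym (embed-neg (p R)))) }

  valueAt0-+ : ∀ {x y} (R : Regular x) (S : Regular y) → valueAt0 (regular-+ R S) ≡ valueAt0 R Q.+ valueAt0 S
  valueAt0-+ R S = ≡.trans (coeffAt-add₁ (mul₁ (p R) (q S)) (mul₁ (p S) (q R)) 0)
    (cong₂ Q._+_ (const-factor (p R) (q S) (const-q S)) (const-factor (p S) (q R) (const-q R)))
    where
    const-factor : ∀ u v → coeffAt v 0 ≡ 1ℚ → coeffAt (mul₁ u v) 0 ≡ coeffAt u 0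
    const-factor u v e = ≡.trans (const-* u v) (≡.trans (cong (coeffAt u 0 Q.*_) e) (QP.*-identityʳ _))

  valueAt0-* : ∀ {x y} (R : Regular x) (S : Regular y) → valueAt0 (regular-* R S) ≡ valueAt0 R Q.* valueAt0 S
  valueAt0-* R S = const-* (p R) (p S)

  -- Equality ignores the chosen fraction, so every ring law is inherited from `K`.
  regularRing : CommutativeRing (c ⊔ ℓ) ℓ
  regularRing = record
    { Carrier = Σ Carrier Regular ; _≈_ = λ x y → proj₁ x ≈ᴷ proj₁ y
    ; _+_ = λ (x , R) (y , S) → x + y , regular-+ R S
    ; _*_ = λ (x , R) (y , S) → x * y , regular-* R S
    ; -_ = λ (x , R) → - x , regular-neg R
    ; 0# = 0# , regular-≈embed [] (sym embed-0) ; 1# = 1# , regular-≈embed (1ℚ ∷ []) (sym embed-1)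
    ; isCommutativeRing = record
      { isRing = record
        { +-isAbelianGroup = record
          { isGroup = record
            { isMonoid = record
              { isSemigroup = record
                { isMagma = record
                  { isEquivalence = record { refl = refl ; sym = sym ; trans = trans }
                  ; ∙-cong = +-cong }
                ; assoc = λ x y z → +-assoc (proj₁ x) (proj₁ y) (proj₁ z) }
              ; identity = (λ x → +-identityˡ (proj₁ x)) , (λ x → +-identityʳ (proj₁ x)) }
            ; inverse = (λ x → -‿inverseˡ (proj₁ x)) , (λ x → -‿inverseʳ (proj₁ x))
            ; ⁻¹-cong = -‿cong }
          ; comm = λ x y → +-comm (proj₁ x) (proj₁ y) }
        ; *-cong = *-cong
        ; *-assoc = λ x y z → *-assoc (proj₁ x) (proj₁ y) (proj₁ z)
        ; *-identity = (λ x → *-identityˡ (proj₁ x)) , (λ x → *-identityʳ (proj₁ x))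
        ; distrib = (λ x y z → distribˡ (proj₁ x) (proj₁ y) (proj₁ z)) , (λ x y z → distribʳ (proj₁ x) (proj₁ y) (proj₁ z)) }
      ; *-comm = λ x y → *-comm (proj₁ x) (proj₁ y) } }
  private module R = CommutativeRing regularRing

  -- If p(0) ≠ 0 then x = p / q is nonzero, by injectivity of `embed`, so it has an inverse in `K`.
  -- This inverse is q / p, and multiplying both parts by the constant 1 / p(0) restores the
  -- normalisation of the denominator.
  invertible : ∀ (x : R.Carrier) → valueAt0 (proj₂ x) ≢ 0ℚ → ∃ λ y → x R.* y R.≈ R.1#
  invertible (x , R) nonzero with zero⊎invertible x
  ... | inj₁ x≈0 = contradiction (coeff≡ (embed-injective {p R} {[]}
          (trans (sym (fraction R)) (trans (*-congʳ x≈0) (trans (zeroˡ _) (sym embed-0))))) 0) nonzero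
  ... | inj₂ (y , xy≈1) = (y , record
          { p = mul₁ a (q R) ; q = mul₁ a (p R)
          ; const-q = ≡.trans (const-* a (p R)) (QP.*-inverseˡ (valueAt0 R))
          ; fraction = begin
              y * embed (mul₁ a (p R))  ≈⟨ *-congˡ (embed-* a (p R)) ⟩
              y * (embed a * embed (p R))  ≈⟨ *-congˡ (*-congˡ (fraction R)) ⟨
              y * (embed a * (x * embed (q R)))  ≈⟨ *-regroup y (embed a) x (embed (q R)) ⟩
              (x * y) * (embed a * embed (q R))  ≈⟨ *-congʳ xy≈1 ⟩
              1# * (embed a * embed (q R))  ≈⟨ *-identityˡ _ ⟩
              embed a * embed (q R)  ≈⟨ embed-* a (q R) ⟨
              embed (mul₁ a (q R)) ∎ }) , xy≈1
    where
    instance _ = Q.≢-nonZero nonzero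
    a : Poly1
    a = Q.1/ valueAt0 R ∷ []

  r₀ : R.Carrier
  r₀ = embed (0ℚ ∷ 1ℚ ∷ []) , regular-≈embed (0ℚ ∷ 1ℚ ∷ []) refl

  private module I = Interpolation regularRing

  valueAt0-r* : ∀ (x : R.Carrier) → valueAt0 (proj₂ (r₀ R.* x)) ≡ 0ℚ
  valueAt0-r* (x , S) = ≡.trans (valueAt0-* (proj₂ r₀) S) (QP.*-zeroˡ (valueAt0 S))

  -- Characteristic zero enters here: m + 1 is nonzero in ℚ because it is positive.
  valueAt0-ι : ∀ k → 0ℚ Q.≤ valueAt0 (proj₂ (I.ι k))
  valueAt0-ι+1 : ∀ k → 0ℚ Q.< valueAt0 (proj₂ (I.ι (suc k)))
  valueAt0-ι zero    = QP.≤-refl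
  valueAt0-ι (suc k) = QP.<⇒≤ (valueAt0-ι+1 k)
  valueAt0-ι+1 k = ≡.subst (0ℚ Q.<_) (≡.sym (valueAt0-+ (proj₂ R.1#) (proj₂ (I.ι k))))
    (QP.+-mono-<-≤ {0ℚ} {1ℚ} {0ℚ} (QP.positive⁻¹ 1ℚ) (valueAt0-ι k))

  node-invertible : ∀ m k → ∃ λ y → (I.ι (suc m) R.+ r₀ R.* I.ι k) R.* y R.≈ R.1#
  node-invertible m k = invertible (I.ι (suc m) R.+ r₀ R.* I.ι k) λ e → QP.<-irrefl (≡.sym e)
    (≡.subst (0ℚ Q.<_) (≡.sym (≡.trans (valueAt0-+ (proj₂ (I.ι (suc m))) (proj₂ (r₀ R.* I.ι k)))
      (≡.trans (cong (valueAt0 (proj₂ (I.ι (suc m))) Q.+_) (valueAt0-r* (I.ι k))) (QP.+-identityʳ _)))) (valueAt0-ι+1 m))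

  1-r*-invertible : ∀ x → ∃ λ y → (R.1# R.- r₀ R.* x) R.* y R.≈ R.1#
  1-r*-invertible x = invertible (R.1# R.- r₀ R.* x) λ e → 1≢0 (≡.trans (≡.sym value) e)
    where
    1≢0 : 1ℚ ≢ 0ℚ
    1≢0 ()
    value : valueAt0 (proj₂ (R.1# R.- r₀ R.* x)) ≡ 1ℚ
    value = ≡.trans (valueAt0-+ (proj₂ R.1#) (proj₂ (R.- (r₀ R.* x))))
      (cong (1ℚ Q.+_) (≡.trans (coeffAt-neg₁ (p (proj₂ (r₀ R.* x))) 0) (cong Q.-_ (valueAt0-r* x))))

  forget : IsRingHomomorphism R.rawRing rawRing proj₁
  forget = record { isSemiringHomomorphism = record { isNearSemiringHomomorphism = record
    { +-isMonoidHomomorphism = record { isMagmaHomomorphism = record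
      { isRelHomomorphism = record { cong = λ e → e } ; homo = λ _ _ → refl } ; ε-homo = refl }
    ; *-homo = λ _ _ → refl } ; 1#-homo = refl } ; -‿homo = λ _ → refl }

  private
    module B = BaseChange regularRing K proj₁ forget
    module IK = Interpolation K

  r : Carrier
  r = proj₁ r₀

  r-node-invertible : ∀ m k → ∃ λ y → (IK.ι (suc m) + r * IK.ι k) * y ≈ᴷ 1#
  r-node-invertible m k with node-invertible m k
  ... | y , e = proj₁ y , trans (*-congʳ (sym (+-cong (B.f-ι (suc m)) (*-congˡ (B.f-ι k))))) e

  r-interpolationPoly : ∀ {n} (η : Vec ℕ n) → IK.Points.InterpolationPoly r η
  r-interpolationPoly η = B.mapInterpolationPoly r₀
    (InterpolationPolynomials.interpolationPoly regularRing r₀ node-invertible 1-r*-invertible η)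

-- Fractions with monic denominators as a field

module Fractions where
  open import Data.Integer as ℤ using (+_)
  import Data.Integer.Properties as ℤP
  open ≡ using (refl; sym; trans)
  open PolyRing
  private module P = CommutativeRing polyRing
  open NatSolver P.commutativeSemiring using (solve; _:+_; _:*_; con; _:=_)

  coeffAt-monic : ∀ c k → length c ℕ.< k → coeffAt (monic c) k ≡ 0ℚ
  coeffAt-monic []      (suc k) _       = refl
  coeffAt-monic (a ∷ c) (suc k) (s≤s l) = coeffAt-monic c k l

  monic-lead : ∀ c → coeffAt (monic c) (length c) ≡ 1ℚ
  monic-lead []      = refl
  monic-lead (a ∷ c) = monic-lead c

  private
    drop-zero : ∀ a {x} y {z} → x ≡ 0ℚ → y ≡ z → a Q.* x Q.+ y ≡ z
    drop-zero a y refl refl = trans (cong (Q._+ y) (QP.*-zeroʳ a)) (QP.+-identityˡ y)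

  mul₁-monic-lead : ∀ c d → coeffAt (mul₁ (monic c) (monic d)) (length c ℕ.+ length d) ≡ 1ℚ
  mul₁-monic-lead []      d = trans (mul₁-identityˡ (monic d) (length d)) (monic-lead d)
  mul₁-monic-lead (a ∷ c) d =
    trans (coeffAt-mul₁ a (monic c) (monic d) (suc (length c ℕ.+ length d)))
      (drop-zero a (coeffAt (mul₁ (monic c) (monic d)) (length c ℕ.+ length d))
        (coeffAt-monic d _ (s≤s (ℕP.m≤n+m _ _))) (mul₁-monic-lead c d))

  mul₁-monic-high : ∀ c d k → length c ℕ.+ length d ℕ.< k → coeffAt (mul₁ (monic c) (monic d)) k ≡ 0ℚ
  mul₁-monic-high []      d k l = trans (mul₁-identityˡ (monic d) k) (coeffAt-monic d k l)
  mul₁-monic-high (a ∷ c) d (suc k) (s≤s l) =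
    trans (coeffAt-mul₁ a (monic c) (monic d) (suc k))
      (drop-zero a (coeffAt (mul₁ (monic c) (monic d)) k)
        (coeffAt-monic d _ (s≤s (ℕP.≤-trans (ℕP.m≤n+m _ _) (ℕP.<⇒≤ l))))
        (mul₁-monic-high c d k l))

  monic-tabulate : ∀ n (f : ℕ → ℚ) → f n ≡ 1ℚ → (∀ k → n ℕ.< k → f k ≡ 0ℚ) →
    ∀ k → coeffAt (monic (V.toList (tabulate {n = n} (λ i → f (toℕ i))))) k ≡ f k
  monic-tabulate zero    f one zeros zero    = sym one
  monic-tabulate zero    f one zeros (suc k) = sym (zeros (suc k) (s≤s ℕ.z≤n))
  monic-tabulate (suc n) f one zeros zero    = refl
  monic-tabulate (suc n) f one zeros (suc k) =
    monic-tabulate n (λ j → f (suc j)) one (λ j l → zeros (suc j) (s≤s l)) k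

  -- `monicMul` keeps the coefficients of the product below degree length c + length d. At that
  -- degree the product has coefficient 1 and beyond it 0, so restoring the leading 1 gives the
  -- whole product.
  monic-monicMul : ∀ c d → monic (monicMul c d) ≃₁ mul₁ (monic c) (monic d)
  monic-monicMul c d = coeffs (monic-tabulate (length c ℕ.+ length d) (coeffAt (mul₁ (monic c) (monic d)))
    (mul₁-monic-lead c d) (mul₁-monic-high c d))

  scale : ℚ → Poly1 → Poly1
  scale a = L.map (a Q.*_)

  -- Coefficient lists may end in zeros, so the leading coefficient is found by deciding equality in
  -- ℚ, starting from the highest coefficient; it is then factored out of the lower ones.
  zero⊎monic : ∀ p → (p ≃₁ []) ⊎ (∃ λ a → ∃ λ c → a ≢ 0ℚ × p ≃₁ scale a (monic c))
  zero⊎monic [] = inj₁ P.refl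
  zero⊎monic (b ∷ p) with zero⊎monic p
  ... | inj₂ (a , c , a≢0 , e) = inj₂ (a , Q._*_ (Q.1/ a) b ∷ c , a≢0 , coeffs λ where
          zero    → sym (trans (sym (QP.*-assoc a (Q.1/ a) b))
                          (trans (cong (Q._* b) (QP.*-inverseʳ a)) (QP.*-identityˡ b)))
          (suc k) → coeff≡ e k)
    where instance _ = Q.≢-nonZero a≢0
  ... | inj₁ e with b QP.≟ 0ℚ
  ...   | yes b≡0 = inj₁ (coeffs λ where
          zero    → b≡0
          (suc k) → coeff≡ e k)
  ...   | no b≢0 = inj₂ (b , [] , b≢0 , coeffs λ where
          zero    → sym (QP.*-identityʳ b)
          (suc k) → coeff≡ e k)

  scale-cong : ∀ a {p q} → p ≃₁ q → scale a p ≃₁ scale a q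
  scale-cong a {p} {q} e = coeffs λ k →
    trans (coeffAt-scale a p k) (trans (cong (a Q.*_) (coeff≡ e k)) (sym (coeffAt-scale a q k)))

  scale-mul₁ : ∀ a p q → mul₁ (scale a p) q ≃₁ scale a (mul₁ p q)
  scale-mul₁ a p q = coeffs (mul₁-scale a p q)

  -- If p is a times a monic polynomial, then a reappears as the coefficient of the product in the
  -- sum of the two degrees.
  mul₁-monic-zero : ∀ p c → mul₁ p (monic c) ≃₁ [] → p ≃₁ []
  mul₁-monic-zero p c e with zero⊎monic p
  ... | inj₁ z = z
  ... | inj₂ (a , d , a≢0 , f) = contradiction a≡0 a≢0
    where
    n = length d ℕ.+ length c
    a≡0 : a ≡ 0ℚ
    a≡0 = begin
      a  ≡⟨ sym (QP.*-identityʳ a) ⟩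
      a Q.* 1ℚ  ≡⟨ cong (a Q.*_) (sym (mul₁-monic-lead d c)) ⟩
      a Q.* coeffAt (mul₁ (monic d) (monic c)) n
        ≡⟨ sym (coeffAt-scale a (mul₁ (monic d) (monic c)) n) ⟩
      coeffAt (scale a (mul₁ (monic d) (monic c))) n  ≡⟨ sym (mul₁-scale a (monic d) (monic c) n) ⟩
      coeffAt (mul₁ (scale a (monic d)) (monic c)) n  ≡⟨ sym (coeff≡ (P.*-congʳ {monic c} f) n) ⟩
      coeffAt (mul₁ p (monic c)) n  ≡⟨ coeff≡ e n ⟩
      0ℚ ∎
      where open ≡.≡-Reasoning

  mul₁-monic-cancel : ∀ p q c → mul₁ p (monic c) ≃₁ mul₁ q (monic c) → p ≃₁ q
  mul₁-monic-cancel p q c e = x∙y⁻¹≈ε⇒x≈y p q (mul₁-monic-zero (add₁ p (neg₁ q)) c (begin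
    mul₁ (add₁ p (neg₁ q)) (monic c)  ≈⟨ P.distribʳ (monic c) p (neg₁ q) ⟩
    add₁ (mul₁ p (monic c)) (mul₁ (neg₁ q) (monic c))
      ≈⟨ P.+-cong e (P.sym (-‿distribˡ-* q (monic c))) ⟩
    add₁ (mul₁ q (monic c)) (neg₁ (mul₁ q (monic c)))  ≈⟨ P.-‿inverseʳ (mul₁ q (monic c)) ⟩
    [] ∎))
    where
    open import Algebra.Properties.Group P.+-group using (x∙y⁻¹≈ε⇒x≈y)
    open import Algebra.Properties.Ring P.ring using (-‿distribˡ-*)
    open import Relation.Binary.Reasoning.Setoid P.setoid

  infix 4 _≃_
  record _≃_ (x y : 𝔽) : Set where
    constructor cross
    field uncross : x ≈ y
  open _≃_ public

  D : 𝔽 → Poly1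
  D x = monic (den x)

  -- x represents the fraction n / d; unlike num and den this is stable under ≃₁.
  record _≃_over_ (x : 𝔽) (n d : Poly1) : Set where
    constructor repr
    field
      num≃ : num x ≃₁ n
      den≃ : D x ≃₁ d
  open _≃_over_

  ⟦_⟧ : ∀ x → x ≃ num x over D x
  ⟦ x ⟧ = repr P.refl P.refl

  _⟦+⟧_ : ∀ {x y n d n' d'} → x ≃ n over d → y ≃ n' over d' →
    (x +F y) ≃ add₁ (mul₁ n d') (mul₁ n' d) over mul₁ d d'
  _⟦+⟧_ {x} {y} (repr e f) (repr e' f') = repr
    (P.+-cong (P.*-cong e f') (P.*-cong e' f))
    (P.trans (monic-monicMul (den x) (den y)) (P.*-cong f f'))

  _⟦*⟧_ : ∀ {x y n d n' d'} → x ≃ n over d → y ≃ n' over d' →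
    (x *F y) ≃ mul₁ n n' over mul₁ d d'
  _⟦*⟧_ {x} {y} (repr e f) (repr e' f') = repr
    (P.*-cong e e')
    (P.trans (monic-monicMul (den x) (den y)) (P.*-cong f f'))

  ⟦-⟧_ : ∀ {x n d} → x ≃ n over d → (-F x) ≃ neg₁ n over d
  ⟦-⟧ (repr e f) = repr (P.-‿cong e) f

  over⇒≃ : ∀ {x y n d n' d'} → x ≃ n over d → y ≃ n' over d' →
    mul₁ n d' ≃₁ mul₁ n' d → x ≃ y
  over⇒≃ (repr e f) (repr e' f') eq =
    cross (coeff≡ (P.trans (P.*-cong e f') (P.trans eq (P.sym (P.*-cong e' f)))))

  ≃⇒cross : ∀ {x y} → x ≃ y → mul₁ (num x) (D y) ≃₁ mul₁ (num y) (D x)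
  ≃⇒cross e = coeffs (uncross e)

  -- Cross multiplication yields the desired equation multiplied by the denominator of `y`, which is
  -- monic and therefore cancels.
  ≃-trans : ∀ {x y z} → x ≃ y → y ≃ z → x ≃ z
  ≃-trans {x} {y} {z} e f = cross (coeff≡ (mul₁-monic-cancel (mul₁ (num x) (D z)) (mul₁ (num z) (D x)) (den y) (begin
    mul₁ (mul₁ (num x) (D z)) (D y)  ≈⟨ swap (num x) (D z) (D y) ⟩
    mul₁ (mul₁ (num x) (D y)) (D z)  ≈⟨ P.*-congʳ (≃⇒cross e) ⟩
    mul₁ (mul₁ (num y) (D x)) (D z)  ≈⟨ swap (num y) (D x) (D z) ⟩
    mul₁ (mul₁ (num y) (D z)) (D x)  ≈⟨ P.*-congʳ (≃⇒cross f) ⟩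
    mul₁ (mul₁ (num z) (D y)) (D x)  ≈⟨ swap (num z) (D y) (D x) ⟩
    mul₁ (mul₁ (num z) (D x)) (D y) ∎)))
    where
    open import Relation.Binary.Reasoning.Setoid P.setoid
    swap : ∀ a b c → mul₁ (mul₁ a b) c ≃₁ mul₁ (mul₁ a c) b
    swap = solve 3 (λ a b c → a :* b :* c := a :* c :* b) P.refl

  +F-cong : ∀ {x x' y y'} → x ≃ x' → y ≃ y' → x +F y ≃ x' +F y'
  +F-cong {x} {x'} {y} {y'} e f = over⇒≃ (⟦ x ⟧ ⟦+⟧ ⟦ y ⟧) (⟦ x' ⟧ ⟦+⟧ ⟦ y' ⟧) (begin
    mul₁ (add₁ (mul₁ (num x) (D y)) (mul₁ (num y) (D x))) (mul₁ (D x') (D y'))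
      ≈⟨ solve 6 (λ n d n' d' e e' → (n :* d' :+ n' :* d) :* (e :* e')
             := (n :* e) :* (d' :* e') :+ (n' :* e') :* (d :* e)) P.refl
           (num x) (D x) (num y) (D y) (D x') (D y') ⟩
    add₁ (mul₁ (mul₁ (num x) (D x')) (mul₁ (D y) (D y'))) (mul₁ (mul₁ (num y) (D y')) (mul₁ (D x) (D x')))
      ≈⟨ P.+-cong (P.*-congʳ (≃⇒cross e)) (P.*-congʳ (≃⇒cross f)) ⟩
    add₁ (mul₁ (mul₁ (num x') (D x)) (mul₁ (D y) (D y'))) (mul₁ (mul₁ (num y') (D y)) (mul₁ (D x) (D x')))
      ≈⟨ solve 6 (λ n d n' d' e e' → (n :* e) :* (e' :* d') :+ (n' :* e') :* (e :* d)
             := (n :* d' :+ n' :* d) :* (e :* e')) P.refl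
           (num x') (D x') (num y') (D y') (D x) (D y) ⟩
    mul₁ (add₁ (mul₁ (num x') (D y')) (mul₁ (num y') (D x'))) (mul₁ (D x) (D y)) ∎)
    where open import Relation.Binary.Reasoning.Setoid P.setoid

  *F-cong : ∀ {x x' y y'} → x ≃ x' → y ≃ y' → x *F y ≃ x' *F y'
  *F-cong {x} {x'} {y} {y'} e f = over⇒≃ (⟦ x ⟧ ⟦*⟧ ⟦ y ⟧) (⟦ x' ⟧ ⟦*⟧ ⟦ y' ⟧) (begin
    mul₁ (mul₁ (num x) (num y)) (mul₁ (D x') (D y'))  ≈⟨ swap (num x) (num y) (D x') (D y') ⟩
    mul₁ (mul₁ (num x) (D x')) (mul₁ (num y) (D y'))  ≈⟨ P.*-cong (≃⇒cross e) (≃⇒cross f) ⟩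
    mul₁ (mul₁ (num x') (D x)) (mul₁ (num y') (D y))  ≈⟨ swap (num x') (D x) (num y') (D y) ⟩
    mul₁ (mul₁ (num x') (num y')) (mul₁ (D x) (D y)) ∎)
    where
    open import Relation.Binary.Reasoning.Setoid P.setoid
    swap : ∀ a b c d → mul₁ (mul₁ a b) (mul₁ c d) ≃₁ mul₁ (mul₁ a c) (mul₁ b d)
    swap = solve 4 (λ a b c d → (a :* b) :* (c :* d) := (a :* c) :* (b :* d)) P.refl

  -F-cong : ∀ {x y} → x ≃ y → (-F x) ≃ (-F y)
  -F-cong {x} {y} e = over⇒≃ (⟦-⟧ ⟦ x ⟧) (⟦-⟧ ⟦ y ⟧) (begin
    mul₁ (neg₁ (num x)) (D y)  ≈⟨ -‿distribˡ-* (num x) (D y) ⟨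
    neg₁ (mul₁ (num x) (D y))  ≈⟨ P.-‿cong (≃⇒cross e) ⟩
    neg₁ (mul₁ (num y) (D x))  ≈⟨ -‿distribˡ-* (num y) (D x) ⟩
    mul₁ (neg₁ (num y)) (D x) ∎)
    where
    open import Algebra.Properties.Ring P.ring using (-‿distribˡ-*)
    open import Relation.Binary.Reasoning.Setoid P.setoid

  ⟦0⟧ : 0F ≃ [] over (1ℚ ∷ [])
  ⟦0⟧ = ⟦ 0F ⟧

  ⟦1⟧ : 1F ≃ (1ℚ ∷ []) over (1ℚ ∷ [])
  ⟦1⟧ = ⟦ 1F ⟧

  +F-comm : ∀ x y → x +F y ≃ y +F x
  +F-comm x y = over⇒≃ (⟦ x ⟧ ⟦+⟧ ⟦ y ⟧) (⟦ y ⟧ ⟦+⟧ ⟦ x ⟧)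
    (solve 4 (λ n d n' d' → (n :* d' :+ n' :* d) :* (d' :* d) := (n' :* d :+ n :* d') :* (d :* d')) P.refl
      (num x) (D x) (num y) (D y))

  *F-comm : ∀ x y → x *F y ≃ y *F x
  *F-comm x y = over⇒≃ (⟦ x ⟧ ⟦*⟧ ⟦ y ⟧) (⟦ y ⟧ ⟦*⟧ ⟦ x ⟧)
    (solve 4 (λ n d n' d' → (n :* n') :* (d' :* d) := (n' :* n) :* (d :* d')) P.refl
      (num x) (D x) (num y) (D y))

  +F-identityˡ : ∀ x → 0F +F x ≃ x
  +F-identityˡ x = over⇒≃ (⟦0⟧ ⟦+⟧ ⟦ x ⟧) ⟦ x ⟧
    (solve 2 (λ n d → (con 0 :* d :+ n :* con 1) :* d := n :* (con 1 :* d)) P.refl (num x) (D x))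

  *F-identityˡ : ∀ x → 1F *F x ≃ x
  *F-identityˡ x = over⇒≃ (⟦1⟧ ⟦*⟧ ⟦ x ⟧) ⟦ x ⟧
    (solve 2 (λ n d → (con 1 :* n) :* d := n :* (con 1 :* d)) P.refl (num x) (D x))

  +F-assoc : ∀ x y z → (x +F y) +F z ≃ x +F (y +F z)
  +F-assoc x y z = over⇒≃ ((⟦ x ⟧ ⟦+⟧ ⟦ y ⟧) ⟦+⟧ ⟦ z ⟧) (⟦ x ⟧ ⟦+⟧ (⟦ y ⟧ ⟦+⟧ ⟦ z ⟧))
    (solve 6 (λ n d n' d' n″ d″ →
        ((n :* d' :+ n' :* d) :* d″ :+ n″ :* (d :* d')) :* (d :* (d' :* d″))
        := (n :* (d' :* d″) :+ (n' :* d″ :+ n″ :* d') :* d) :* ((d :* d') :* d″)) P.refl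
      (num x) (D x) (num y) (D y) (num z) (D z))

  *F-assoc : ∀ x y z → (x *F y) *F z ≃ x *F (y *F z)
  *F-assoc x y z = over⇒≃ ((⟦ x ⟧ ⟦*⟧ ⟦ y ⟧) ⟦*⟧ ⟦ z ⟧) (⟦ x ⟧ ⟦*⟧ (⟦ y ⟧ ⟦*⟧ ⟦ z ⟧))
    (solve 6 (λ n d n' d' n″ d″ →
        ((n :* n') :* n″) :* (d :* (d' :* d″)) := (n :* (n' :* n″)) :* ((d :* d') :* d″)) P.refl
      (num x) (D x) (num y) (D y) (num z) (D z))

  *F-distribˡ : ∀ x y z → x *F (y +F z) ≃ x *F y +F x *F z
  *F-distribˡ x y z = over⇒≃ (⟦ x ⟧ ⟦*⟧ (⟦ y ⟧ ⟦+⟧ ⟦ z ⟧)) ((⟦ x ⟧ ⟦*⟧ ⟦ y ⟧) ⟦+⟧ (⟦ x ⟧ ⟦*⟧ ⟦ z ⟧))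
    (solve 6 (λ n d n' d' n″ d″ →
        (n :* (n' :* d″ :+ n″ :* d')) :* ((d :* d') :* (d :* d″))
        := ((n :* n') :* (d :* d″) :+ (n :* n″) :* (d :* d')) :* (d :* (d' :* d″))) P.refl
      (num x) (D x) (num y) (D y) (num z) (D z))

  -F-inverseˡ : ∀ x → (-F x) +F x ≃ 0F
  -F-inverseˡ x = over⇒≃ ((⟦-⟧ ⟦ x ⟧) ⟦+⟧ ⟦ x ⟧) ⟦0⟧ (begin
    mul₁ (add₁ (mul₁ (neg₁ (num x)) (D x)) (mul₁ (num x) (D x))) (1ℚ ∷ [])
      ≈⟨ solve 3 (λ m n d → (m :* d :+ n :* d) :* con 1 := (m :+ n) :* d) P.refl (neg₁ (num x)) (num x) (D x) ⟩
    mul₁ (add₁ (neg₁ (num x)) (num x)) (D x)  ≈⟨ P.*-congʳ {D x} (P.-‿inverseˡ (num x)) ⟩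
    [] ∎)
    where open import Relation.Binary.Reasoning.Setoid P.setoid

  𝔽-ring : CommutativeRing 0ℓ 0ℓ
  𝔽-ring = record
    { Carrier = 𝔽 ; _≈_ = _≃_ ; _+_ = _+F_ ; _*_ = _*F_ ; -_ = -F_ ; 0# = 0F ; 1# = 1F
    ; isCommutativeRing = record
      { isRing = record
        { +-isAbelianGroup = record
          { isGroup = record
            { isMonoid = record
              { isSemigroup = record
                { isMagma = record
                  { isEquivalence = record
                    { refl  = cross λ _ → refl
                    ; sym   = λ e → cross λ k → sym (uncross e k)
                    ; trans = ≃-trans }
                  ; ∙-cong = +F-cong }
                ; assoc = +F-assoc }
              ; identity = +F-identityˡ , λ x → ≃-trans (+F-comm x 0F) (+F-identityˡ x) }
            ; inverse = -F-inverseˡ , λ x → ≃-trans (+F-comm x (-F x)) (-F-inverseˡ x)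
            ; ⁻¹-cong = -F-cong }
          ; comm = +F-comm }
        ; *-cong = *F-cong
        ; *-assoc = *F-assoc
        ; *-identity = *F-identityˡ , λ x → ≃-trans (*F-comm x 1F) (*F-identityˡ x)
        ; distrib = *F-distribˡ , λ x y z → ≃-trans (*F-comm (y +F z) x)
            (≃-trans (*F-distribˡ x y z) (+F-cong (*F-comm x y) (*F-comm x z))) }
      ; *-comm = *F-comm } }

  private module 𝔽R = CommutativeRing 𝔽-ring

  -- The inverse needs a monic denominator too. If the numerator of `x` is a times `monic c`, then
  -- `monic c` becomes the new denominator and 1 / a goes into the new numerator.
  zero⊎invertible : ∀ x → x ≃ 0F ⊎ ∃ λ y → x *F y ≃ 1F
  zero⊎invertible x with zero⊎monic (num x)
  ... | inj₁ z = inj₁ (over⇒≃ (repr z P.refl) ⟦0⟧ P.refl)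
  ... | inj₂ (a , c , a≢0 , e) = inj₂ (y , over⇒≃ (repr {x} e P.refl ⟦*⟧ ⟦ y ⟧) ⟦1⟧ (begin
      mul₁ (mul₁ (scale a (monic c)) (scale (Q.1/ a) (D x))) (1ℚ ∷ [])
        ≈⟨ P.*-identityʳ _ ⟩
      mul₁ (scale a (monic c)) (scale (Q.1/ a) (D x))
        ≈⟨ scale-mul₁ a (monic c) (scale (Q.1/ a) (D x)) ⟩
      scale a (mul₁ (monic c) (scale (Q.1/ a) (D x)))
        ≈⟨ scale-cong a (P.*-comm (monic c) (scale (Q.1/ a) (D x))) ⟩
      scale a (mul₁ (scale (Q.1/ a) (D x)) (monic c))
        ≈⟨ scale-cong a (scale-mul₁ (Q.1/ a) (D x) (monic c)) ⟩
      scale a (scale (Q.1/ a) (mul₁ (D x) (monic c)))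
        ≈⟨ scale-inverse (mul₁ (D x) (monic c)) ⟩
      mul₁ (D x) (monic c)
        ≈⟨ P.*-identityˡ _ ⟨
      mul₁ (1ℚ ∷ []) (mul₁ (D x) (monic c)) ∎))
    where
    open import Relation.Binary.Reasoning.Setoid P.setoid
    instance _ = Q.≢-nonZero a≢0
    y : 𝔽
    y = scale (Q.1/ a) (D x) // c
    scale-inverse : ∀ p → scale a (scale (Q.1/ a) p) ≃₁ p
    scale-inverse p = coeffs λ k → trans (coeffAt-scale a (scale (Q.1/ a) p) k)
      (trans (cong (a Q.*_) (coeffAt-scale (Q.1/ a) p k))
        (trans (sym (QP.*-assoc a (Q.1/ a) (coeffAt p k)))
          (trans (cong (Q._* coeffAt p k) (QP.*-inverseʳ a)) (QP.*-identityˡ (coeffAt p k)))))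

  -- `Q./` normalises by a gcd and does not compute for a variable `k`, so the identity is checked
  -- on unnormalised rationals.
  ℕ→ℚ-suc : ∀ k → (+ suc k) Q./ 1 ≡ 1ℚ Q.+ (+ k) Q./ 1
  ℕ→ℚ-suc k = QP.toℚᵘ-injective (begin
    Q.toℚᵘ ((+ suc k) Q./ 1)  ≈⟨ QP.toℚᵘ-fromℚᵘ (QU.mkℚᵘ (+ suc k) 0) ⟩
    QU.mkℚᵘ (+ suc k) 0
      ≈⟨ QU.*≡* (cong (ℤ._* + 1) (cong (ℤ._+_ (+ 1)) (sym (ℤP.*-identityʳ (+ k))))) ⟩
    QU.1ℚᵘ QU.+ QU.mkℚᵘ (+ k) 0
      ≈⟨ QUP.+-congʳ QU.1ℚᵘ (QP.toℚᵘ-fromℚᵘ (QU.mkℚᵘ (+ k) 0)) ⟨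
    QU.1ℚᵘ QU.+ Q.toℚᵘ ((+ k) Q./ 1)  ≈⟨ QP.toℚᵘ-homo-+ 1ℚ ((+ k) Q./ 1) ⟨
    Q.toℚᵘ (1ℚ Q.+ (+ k) Q./ 1) ∎)
    where
    open QUP.≃-Reasoning

  constant : ℚ → 𝔽
  constant a = (a ∷ []) // []

  constant-1+ : ∀ {a} b → a ≡ 1ℚ Q.+ b → constant a ≃ 1F +F constant b
  constant-1+ b refl = over⇒≃ ⟦ constant (1ℚ Q.+ b) ⟧ (⟦1⟧ ⟦+⟧ ⟦ constant b ⟧)
    (solve 1 (λ x → (con 1 :+ x) :* (con 1 :* con 1) := (con 1 :* con 1 :+ x :* con 1) :* con 1)
       P.refl (b ∷ []))

  ℕ→F-suc : ∀ k → ℕ→F (suc k) ≃ 1F +F ℕ→F k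
  ℕ→F-suc k = constant-1+ ((+ k) Q./ 1) (ℕ→ℚ-suc k)

  ℕ→F-zero : ℕ→F 0 ≃ 0F
  ℕ→F-zero = cross λ { zero → refl ; (suc zero) → refl ; (suc (suc k)) → refl }

-- Specialisation to ℚ(r)

module RationalFunctions where
  open PolyRing
  open Fractions
  private
    module P = CommutativeRing polyRing
    module F = CommutativeRing 𝔽-ring

  embed : Poly1 → 𝔽
  embed p = p // []

  embed-injective : ∀ {p q} → embed p ≃ embed q → p ≃₁ q
  embed-injective {p} {q} e = P.trans (P.sym (P.*-identityʳ p)) (P.trans (coeffs (uncross e)) (P.*-identityʳ q))

  embed-* : ∀ p q → embed (mul₁ p q) ≃ embed p *F embed q
  embed-* p q = over⇒≃ ⟦ embed (mul₁ p q) ⟧ (⟦ embed p ⟧ ⟦*⟧ ⟦ embed q ⟧) (P.*-congˡ {mul₁ p q} (P.*-identityˡ P.1#))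

  embed-+ : ∀ p q → embed (add₁ p q) ≃ embed p +F embed q
  embed-+ p q = over⇒≃ ⟦ embed (add₁ p q) ⟧ (⟦ embed p ⟧ ⟦+⟧ ⟦ embed q ⟧)
    (P.*-cong (P.+-cong (P.sym (P.*-identityʳ p)) (P.sym (P.*-identityʳ q))) (P.*-identityˡ P.1#))

  embed-hom : IsRingHomomorphism P.rawRing F.rawRing embed
  embed-hom = record { isSemiringHomomorphism = record { isNearSemiringHomomorphism = record
    { +-isMonoidHomomorphism = record { isMagmaHomomorphism = record
      { isRelHomomorphism = record { cong = λ e → cross (coeff≡ (P.*-congʳ {monic []} e)) } ; homo = embed-+ } ; ε-homo = F.refl }
    ; *-homo = embed-* } ; 1#-homo = F.refl } ; -‿homo = λ p → F.refl {embed (neg₁ p)} }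

  module R₀ = RegularAtZero 𝔽-ring embed embed-hom embed-injective zero⊎invertible
  module I  = Interpolation 𝔽-ring
  module IP = I.Points rF

  -- Opaque, so that conversion checking never unfolds the recursively built inverses and
  -- interpolation polynomials; below they are used through their specifications.
  abstract
    node-invertible : ∀ m k → ∃ λ y → (I.ι (suc m) +F rF *F I.ι k) *F y ≃ 1F
    node-invertible = R₀.r-node-invertible

    interpolationPoly : ∀ {n} (η : Comp n) → IP.InterpolationPoly η
    interpolationPoly = R₀.r-interpolationPoly

  module S = SymmetricInterpolation 𝔽-ring rF node-invertible
  module X = DualOperator 𝔽-ring rF node-invertible interpolationPoly
  open I using (_≋_; coeffwise; coeff≈; _≈ᵛ_)
  open Algebra.Properties.Semiring.Exp F.semiring using (_^_)

  α*r≃1 : αF *F rF ≃ 1F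
  α*r≃1 = cross λ { zero → ≡.refl ; (suc zero) → ≡.refl ; (suc (suc zero)) → ≡.refl ; (suc (suc (suc zero))) → ≡.refl
                  ; (suc (suc (suc (suc k)))) → ≡.refl }

  ℕ→F≃ι : ∀ k → ℕ→F k ≃ I.ι k
  ℕ→F≃ι zero    = ℕ→F-zero
  ℕ→F≃ι (suc k) = F.trans (ℕ→F-suc k) (F.+-congˡ {1F} (ℕ→F≃ι k))

  ^F≡^ : ∀ x k → x ^F k ≡ x ^ k
  ^F≡^ x zero    = ≡.refl
  ^F≡^ x (suc k) = cong (x *F_) (^F≡^ x k)

  monoEval≡mono : ∀ {n} γ (x : Vec 𝔽 n) → monoEval γ x ≡ I.mono x γ
  monoEval≡mono []      []       = ≡.refl
  monoEval≡mono (k ∷ γ) (x ∷ xs) = cong₂ _*F_ (^F≡^ x k) (monoEval≡mono γ xs)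

  eval≡ : ∀ {n} (p : Poly n) x → eval p x ≡ I.eval p x
  eval≡ []            x = ≡.refl
  eval≡ ((γ , a) ∷ p) x = cong₂ _+F_ (cong (a *F_) (monoEval≡mono γ x)) (eval≡ p x)

  -- The given coefficient function skips terms of other exponents, while `lin` adds them multiplied
  -- by zero. The two thus agree only up to `≃`, in contrast to evaluations and signs, which agree
  -- up to `≡`.
  coeff≃ : ∀ {n} (p : Poly n) η → coeff p η ≃ I.coeff p η
  coeff≃ []            η = F.refl
  coeff≃ ((γ , a) ∷ p) η with VP.≡-dec ℕP._≟_ γ η
  ... | yes _ = F.+-cong {a} {a *F 1F} {coeff p η} {I.coeff p η} (F.sym (F.*-identityʳ a)) (coeff≃ p η)
  ... | no  _ = F.trans (coeff≃ p η) (F.trans (F.sym (F.+-identityˡ (I.coeff p η))) (F.+-congʳ {I.coeff p η} {0F} {a *F 0F} (F.sym (F.zeroʳ a))))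

  sign≡ : ∀ k → sign k ≡ X.sign k
  sign≡ = ^F≡^ (-F 1F)

  negArg≡ : ∀ {n} (p : Poly n) → negArg p ≡ X.negArg p
  negArg≡ = LP.map-cong λ t → cong (λ s → proj₁ t , s *F proj₂ t) (sign≡ (sum (proj₁ t)))

  to≋ : ∀ {n} {p q : Poly n} → p ≈P q → p ≋ q
  to≋ {p = p} {q} e = coeffwise λ η → F.trans (F.sym (coeff≃ p η)) (F.trans (cross (e η)) (coeff≃ q η))

  from≋ : ∀ {n} {p q : Poly n} → p ≋ q → p ≈P q
  from≋ {p = p} {q} e η = uncross (F.trans (coeff≃ p η) (F.trans (coeff≈ e η) (F.sym (coeff≃ q η))))

  coeff-to : ∀ {n} {p : Poly n} {η x} → coeff p η ≈ x → I.coeff p η ≃ x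
  coeff-to {p = p} {η} e = F.trans (F.sym (coeff≃ p η)) (cross e)

  coeff-from : ∀ {n} {p : Poly n} {η x} → I.coeff p η ≃ x → coeff p η ≈ x
  coeff-from {p = p} {η} e = uncross (F.trans (coeff≃ p η) e)

  symmetric-to : ∀ {n} {p : Poly n} → Symmetric p → S.Symmetric p
  symmetric-to {p = p} sp w η = coeff-to {p = p} {act w η} {I.coeff p η} (uncross (F.trans {coeff p (act w η)} (cross (sp w η)) (coeff≃ p η)))

  symmetric-from : ∀ {n} {p : Poly n} → S.Symmetric p → Symmetric p
  symmetric-from {p = p} sp w η = coeff-from {p = p} {act w η} {coeff p η} (F.trans (sp w η) (F.sym (coeff≃ p η)))

  eval-to : ∀ {n} (p : Poly n) {x y} → x ≈ᵛ y → eval p x ≈ 0F → I.eval p y ≃ 0F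
  eval-to p {x} {y} e z = F.trans (F.sym (I.eval-cong p e)) (≡.subst (_≃ 0F) (eval≡ p x) (cross z))

  eval-from : ∀ {n} (p : Poly n) {x y} → x ≈ᵛ y → I.eval p y ≃ 0F → eval p x ≈ 0F
  eval-from p {x} {y} e z = uncross (≡.subst (_≃ 0F) (≡.sym (eval≡ p x)) (F.trans (I.eval-cong p e) z))

  -- A sorting permutation of minimal length keeps ties in their order from left to right, and
  -- `ranks` counts with the same convention.
  bar≈ : ∀ {n} (w : Permutation′ n) γ → IsMinSort w γ → bar w γ ≈ᵛ IP.bar γ
  bar≈ {n} w γ ms = I.pointwise λ i → begin
    lookup (bar w γ) i
      ≡⟨ VP.lookup-zipWith _+F_ i (toF γ) (act w (rδ n)) ⟩
    lookup (toF γ) i +F lookup (act w (rδ n)) i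
      ≡⟨ cong₂ _+F_ (VP.lookup-map i ℕ→F γ)
           (≡.trans (PermutationAction.lookup-act w (rδ n) i) (VP.lookup∘tabulate (λ i → rF *F ℕ→F (n ∸ suc (toℕ i))) (w ⟨$⟩ˡ i))) ⟩
    ℕ→F (lookup γ i) +F rF *F ℕ→F (n ∸ suc (toℕ (w ⟨$⟩ˡ i)))
      ≈⟨ F.+-cong (ℕ→F≃ι (lookup γ i)) (F.*-congˡ {rF} (ℕ→F≃ι (n ∸ suc (toℕ (w ⟨$⟩ˡ i))))) ⟩
    I.ι (lookup γ i) +F rF *F I.ι (n ∸ suc (toℕ (w ⟨$⟩ˡ i)))
      ≡⟨ cong (λ k → I.ι (lookup γ i) +F rF *F I.ι k)
           (SortingPermutations.orders⇒rank w γ (SortingPermutations.minSort⇒orders w γ ms) i) ⟩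
    I.ι (lookup γ i) +F rF *F I.ι (lookup (ranks (const 0) γ) i)
      ≡⟨ VP.lookup-zipWith (λ a k → I.ι a +F rF *F I.ι k) i γ (ranks (const 0) γ) ⟨
    lookup (IP.bar γ) i ∎
    where open import Relation.Binary.Reasoning.Setoid F.setoid

  partitionPoint≈ : ∀ {n} (μ : Comp n) → (toF μ +V rδ n) ≈ᵛ S.partitionPoint μ
  partitionPoint≈ {n} μ = points μ (λ i → n ∸ suc (toℕ i))
    where
    points : ∀ {m} (μ : Comp m) (f : Fin m → ℕ) → (toF μ +V tabulate (λ i → rF *F ℕ→F (f i))) ≈ᵛ IP.point μ (tabulate f)
    points []      f = []
    points (a ∷ μ) f = F.+-cong (ℕ→F≃ι a) (F.*-congˡ {rF} (ℕ→F≃ι (f zero))) ∷ points μ (f ∘ suc)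

  -- The factor is α ((a + 1) + (l + 1) r), so up to α it is one of the elements m + 1 + kr already
  -- inverted for the nodes.
  box-invertible : ∀ a l → ∃ λ y → (αF *F ℕ→F (suc a) +F ℕ→F (suc l)) *F y ≃ 1F
  box-invertible a l with node-invertible a (suc l)
  ... | y , e = rF *F y , F.trans (F.*-congʳ {rF *F y} (F.+-cong (F.*-congˡ {αF} (ℕ→F≃ι (suc a))) (ℕ→F≃ι (suc l))))
                  (RingIdentities.common-denominator 𝔽-ring {αF} {rF} {I.ι (suc a)} {I.ι (suc l)} {y} α*r≃1 e)

  prodF-invertible : ∀ {A : Set} (g : A → 𝔽) → (∀ a → ∃ λ y → g a *F y ≃ 1F) →
    ∀ as → ∃ λ y → prodF (L.map g as) *F y ≃ 1F
  prodF-invertible g inv []       = 1F , F.*-identityˡ 1F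
  prodF-invertible g inv (a ∷ as) with inv a | prodF-invertible g inv as
  ... | y , e | z , f = y *F z , RingIdentities.product-invertible 𝔽-ring {g a} {y} {prodF (L.map g as)} {z} e f

  dη-invertible : ∀ {n} (η : Comp n) → ∃ λ y → dη η *F y ≃ 1F
  dη-invertible η = prodF-invertible
    (λ s → αF *F ℕ→F (suc (lookup η (proj₁ s) ∸ proj₂ s)) +F ℕ→F (suc (legE η (proj₁ s) (proj₂ s))))
    (λ s → box-invertible (lookup η (proj₁ s) ∸ proj₂ s) (legE η (proj₁ s) (proj₂ s))) (boxes η)

  -- This makes the hypothesis on Ξ applicable: the constructed polynomials satisfy the definition
  -- of E_η for every choice of minimal sorting permutations.
  isE : ∀ {n} (η : Comp n) → IsE η (IP.E (interpolationPoly η))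
  isE η = (λ ζ l → coeff-from {p = P} {ζ} (I.coeff-above (IP.degree-E ip) l)) ,
    (λ γ l ne w ms → eval-from P (bar≈ w γ ms) (IP.vanishing-E ip γ l ne)) ,
    coeff-from {p = P} {η} (IP.monic-E ip)
    where
    ip = interpolationPoly η
    P = IP.E ip

  module _ {n} (Ξ : Poly n → Poly n) (isΞ : IsΞ Ξ) where
    Ξ-E : ∀ η → let P = IP.E (interpolationPoly η) in
      Ξ (dη η I.· X.top (sum η) P) ≋ (X.sign (sum η) *F dη η) I.· X.negArg P
    Ξ-E η = ≡.subst (Ξ (Fα η P) ≋_) (cong₂ (λ s q → (s *F dη η) ·P q) (sign≡ (sum η)) (negArg≡ P))
      (to≋ {q = Frδ η P} (proj₂ isΞ η P (isE η)))
      where P = IP.E (interpolationPoly η)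

    private
      Ξ-cong : ∀ {p q} → p ≋ q → Ξ p ≋ Ξ q
      Ξ-cong {p} {q} e = to≋ (proj₁ (proj₁ isΞ) p q (from≋ e))
      Ξ-++ : ∀ p q → Ξ (p ++ q) ≋ Ξ p ++ Ξ q
      Ξ-++ p q = to≋ (proj₁ (proj₂ (proj₁ isΞ)) p q)
      Ξ-· : ∀ a p → Ξ (a I.· p) ≋ a I.· Ξ p
      Ξ-· a p = to≋ (proj₂ (proj₂ (proj₁ isΞ)) a p)

    Ξ-symmetric : ∀ f → Symmetric f → Symmetric (Ξ f)
    Ξ-symmetric f sf = symmetric-from {p = Ξ f}
      (X.Ξ-symmetric Ξ Ξ-cong Ξ-++ Ξ-· dη dη-invertible Ξ-E f (symmetric-to {p = f} sf))

    Ξ-J : ∀ λ' → (P : Poly n) → IsP λ' P → Ξ (Jα λ' P) ≈P Jrδ λ' P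
    Ξ-J λ' P (sP , dP , vP , _) = from≋ {q = Jrδ λ' P}
      (≡.subst (Ξ (Jα λ' P) ≋_) (≡.sym (cong₂ (λ s q → (s *F cλ λ') ·P q) (sign≡ (sum λ')) (negArg≡ P)))
        (X.Ξ-top Ξ Ξ-cong Ξ-++ Ξ-· dη dη-invertible Ξ-E (sum λ') (cλ λ') P (symmetric-to {p = P} sP)
          (λ η l → coeff-to {p = P} {η} (dP η l))
          -- |μ| < |λ| excludes μ = λ, the one partition of size at most |λ| at which `IsP`
          -- prescribes no zero.
          (λ μ part l → eval-to P (partitionPoint≈ μ) (vP μ part (ℕP.<⇒≤ l) λ { ≡.refl → ℕP.<-irrefl ≡.refl l }))))

    char-to : ∀ {d} {f g : Poly n} → Char d f g → X.SymmetricDual d f g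
    char-to {f = f} {g} (sg , dg , vg) = X.symmetricDual (symmetric-to {p = g} sg)
      (λ η l → coeff-to {p = g -P f} {η} (dg η l))
      (λ μ part l → eval-to g (X.negate-cong (partitionPoint≈ μ)) (vg μ part l))

    char-from : ∀ {d} {f g : Poly n} → X.SymmetricDual d f g → Char d f g
    char-from {f = f} {g} (X.symmetricDual sg dg vg) = symmetric-from {p = g} sg ,
      (λ η l → coeff-from {p = g -P f} {η} (dg η l)) ,
      (λ μ part l → eval-from g (X.negate-cong (partitionPoint≈ μ)) (vg μ part l))

    Ξ-char : ∀ d (f : Poly n) → Homogeneous d f → Symmetric f →
      Char d f (Ξ f) × ((h : Poly n) → Char d f h → h ≈P Ξ f)
    Ξ-char d f hf sf =
      char-from {f = f} {Ξ f} (X.symmetricDual-Ξ Ξ Ξ-cong Ξ-++ Ξ-· dη dη-invertible Ξ-E d f hf′ (symmetric-to {p = f} sf)) ,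
      λ h ch → from≋ {p = h} {Ξ f} (X.symmetricDual-unique Ξ Ξ-cong Ξ-++ Ξ-· dη dη-invertible Ξ-E d f hf′ h (char-to {f = f} {h} ch))
      where
      hf′ : X.Homogeneous d f
      hf′ η ne = coeff-to {p = f} {η} (hf η ne)

theorem3p9 : (n : ℕ) → 1 ≤ n → (Ξ : Poly n → Poly n) → IsΞ Ξ →
    ((f : Poly n) → Symmetric f → Symmetric (Ξ f)) ×
    ((λ' : Comp n) → IsPartition λ' → (P : Poly n) → IsP λ' P →
    Ξ (Jα λ' P) ≈P Jrδ λ' P) ×
    ((d : ℕ) (f : Poly n) → Homogeneous d f → Symmetric f →
    Char d f (Ξ f) × ((h : Poly n) → Char d f h → h ≈P Ξ f))
theorem3p9 n _ Ξ isΞ =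
  Ξ-symmetric Ξ isΞ , (λ λ' _ → Ξ-J Ξ isΞ λ') , Ξ-char Ξ isΞ
  where open RationalFunctions
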